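{- Let $d^B(\pi)$ denote the total degree of $\pi\in B_n$, i.e. the number of elements of $B_n$ that cover or are covered by $\pi$ in the strong Bruhat order. Then $\max\{d^B(\pi):\pi\in B_n\}=4(n-1)$ for $2\le n\le 5$, and $\max\{d^B(\pi):\pi\in B_n\}=\lfloor n^2/2\rfloor+n-1$ for $n\ge 5$.
   Context: $B_n$ is the group of signed permutations, i.e. permutations $\pi$ of $[-n,n]\setminus\{0\}$ with $\pi(-i)=-\pi(i)$, viewed as the Coxeter group of type $B_n$ with generators $s_0=t_{1,-1}$ and $s_i=t_{i,i+1}t_{ -i,-(i+1)}$ ($t_{x,y}$ the transposition of $x,y$); the strong Bruhat order is the Bruhat order of this Coxeter group. (For $n=5$ both formulas give $16$.) -}

module Defs where

open import Data.Bool using (Bool; true; false; not; _xor_; if_then_else_; T; _∧_)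
open import Data.Nat using (ℕ; zero; suc; _<_; _≤_)
open import Data.Fin using (Fin; zero; suc; inject₁; _≟_)
open import Data.List.Base using (allFin)
open import Data.Vec using (Vec; lookup; tabulate; map; toList)
open import Data.List using (List; []; _∷_; _++_; length; foldr; reverse)
import Data.Bool.ListAction as L
open import Data.Product using (_×_; _,_; ∃; ∃-syntax; Σ)
open import Data.Sum using (_⊎_)
open import Relation.Nullary using (¬_; does)
open import Relation.Binary.PropositionalEquality using (_≡_)
open import Relation.Binary.Construct.Closure.ReflexiveTransitive using (Star)
open import Data.List.Relation.Unary.Unique.Propositional using (Unique)
open import Data.List.Membership.Propositional using (_∈_)
open import Function.Bundles using (_⇔_)

-- An element of [-n,n]∖{0}: (negative?, |x|-1).  (b , i) stands for ±(i+1).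
Elt : ℕ → Set
Elt n = Bool × Fin n

-- A candidate signed permutation: position i (0-based) stores π(i+1).
-- π(-x) = -π(x) is built into how such a vector acts (see `act`).
W : ℕ → Set
W n = Vec (Elt n) n

isSigned : ∀ {n} → W n → Bool
isSigned {n} v = L.all (λ j → L.any (λ e → does (Data.Product.proj₂ e ≟ j)) (toList v)) (allFin n)

InB : ∀ {n} → W n → Set
InB v = T (isSigned v)

-- action of π on [-n,n]∖{0}, using π(-x) = -π(x)
act : ∀ {n} → W n → Elt n → Elt n
act π (b , i) with lookup π i
... | (c , j) = (b xor c , j)

_∘ˢ_ : ∀ {n} → W n → W n → W n
π ∘ˢ σ = map (act π) σ

idˢ : ∀ {n} → W n
idˢ = tabulate (λ i → (false , i))

flipFirst : ∀ {m} → W (suc m)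
flipFirst = tabulate (λ i → (does (i ≟ zero) , i))

swapˢ : ∀ {n} → Fin n → Fin n → W n
swapˢ a b = tabulate (λ i → (false , (if does (i ≟ a) then b else (if does (i ≟ b) then a else i))))

gen : ∀ {n} → Fin n → W n
gen {suc m} zero = flipFirst
gen {suc m} (suc i) = swapˢ (inject₁ i) (suc i)

eval : ∀ {n} → List (Fin n) → W n
eval w = foldr (λ s acc → gen s ∘ˢ acc) idˢ w

HasLength : ∀ {n} → W n → ℕ → Set
HasLength {n} w k =
  (∃[ ws ] (eval ws ≡ w × length ws ≡ k)) ×
  (∀ (ws : List (Fin n)) → eval ws ≡ w → k ≤ length ws)

-- reflections: conjugates of the simple generators, u s u⁻¹
Reflection : ∀ {n} → W n → Set
Reflection {n} t = ∃[ u ] ∃[ s ] (t ≡ eval (u ++ (s ∷ reverse u)))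

Arrow : ∀ {n} → W n → W n → Set
Arrow u w = ∃[ t ] (Reflection t × w ≡ u ∘ˢ t ×
              ∃[ a ] ∃[ b ] (HasLength u a × HasLength w b × a < b))

_≤B_ : ∀ {n} → W n → W n → Set
_≤B_ = Star Arrow

Covers : ∀ {n} → W n → W n → Set
Covers {n} u v = InB u × InB v × u ≤B v × ¬ (u ≡ v) ×
  (∀ (w : W n) → InB w → u ≤B w → w ≤B v → (w ≡ u ⊎ w ≡ v))

Adjacent : ∀ {n} → W n → W n → Set
Adjacent π v = Covers π v ⊎ Covers v π

HasDegree : ∀ {n} → W n → ℕ → Set
HasDegree {n} π d = ∃[ xs ] (Unique xs × length xs ≡ d × (∀ (v : W n) → (v ∈ xs ⇔ Adjacent π v)))

MaxDegree : ℕ → ℕ → Set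
MaxDegree n M =
  (∃[ π ] (InB {n} π × HasDegree π M)) ×
  (∀ (π : W n) (d : ℕ) → InB π → HasDegree π d → d ≤ M)

{-# OPTIONS --safe #-}
module Submission where

-- Identify π ∈ B_n with the centrally symmetric set of the 2n points (i , π i), i ∈ ±[n].
-- The inversions of this set, counted up to sign and with the origin as a further point,
-- give the Coxeter length, and multiplying by the reflection that exchanges the points x
-- and y changes the length by one plus twice the number of points in the box spanned by
-- x and y.  Hence the neighbours of π in the Hasse diagram correspond to the empty boxes
-- (not containing the origin either, unless y = -x); if a box is not empty, a conjugation
-- t₁ t₂ t₁ of the reflection yields a chain between the two elements.
--
-- The number of empty boxes is bounded by induction on n, deleting entries.  Let p be
-- the position of the entry of largest absolute value, without loss of generality
-- positive.  If p is not the first position, let q be its neighbour with the smaller value: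
-- at most two points span empty boxes with both p and q, and deleting p and q destroys at
-- most 2n boxes.  If p is the first position, either p and the second position destroy at
-- most 2n boxes, or some single entry destroys at most n of them.  The induction starts with
-- n = 5, settled by exhaustive search, and n = 6, which follows from n = 5 by averaging over
-- all deletions.  The bound is attained by 1, …, k, -n, …, -(k+1) with k = ⌊n/2⌋.

open import Defs
open import Data.Nat using (ℕ; _≤_; _+_; _*_; _∸_; _/_)
open import Data.Product using (_×_)
open import Data.Bool using (Bool; true; false; if_then_else_; not; _xor_; _∧_; T)
import Data.Bool.ListAction as ListAction
import Data.Bool.Properties as Bool
open import Data.Empty using (⊥; ⊥-elim)
open import Data.Fin as F using (Fin; zero; suc; toℕ; punchIn; punchOut; _↑ˡ_; _↑ʳ_)
import Data.Fin.Properties as F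
open import Data.Integer as ℤ using (ℤ; -[1+_]; +[1+_]; 0ℤ; -_)
import Data.Integer.Properties as ℤ
open import Data.List using (List; []; _∷_; _++_; reverse; length; allFin; filter; cartesianProduct)
import Data.List as List
open import Data.List.Membership.Propositional using (_∈_; _∉_)
open import Data.List.Membership.Propositional.Properties using (∈-map⁺; ∈-map⁻; ∈-filter⁺; ∈-filter⁻; ∈-cartesianProduct⁺; ∈-allFin; ∈-lookup)
import Data.List.Properties as List
import Data.List.Relation.Unary.All as All
open import Data.List.Relation.Unary.AllPairs using ([]; _∷_)
open import Data.List.Relation.Unary.Any as Any using (here; there; any?)
open import Data.List.Relation.Unary.Any.Properties using (lookup-index)
open import Data.List.Relation.Unary.Unique.Propositional using (Unique)
import Data.List.Relation.Unary.Unique.Propositional.Properties as Unique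
open import Data.Nat using (zero; suc; _<_; _≤ᵇ_; z≤n; s≤s)
open import Data.Nat.DivMod using (+-distrib-/-∣ʳ; m*n/n≡m)
open import Data.Nat.Divisibility using (divides)
import Data.Nat.Properties as ℕ
open import Algebra.Properties.CommutativeMonoid.Sum ℕ.+-0-commutativeMonoid using (sum; sum-remove; ∑-distrib-+; ∑-comm; sum-cong-≗)
open import Data.Nat.Tactic.RingSolver using (solve-∀)
open import Data.Product using (_,_; proj₁; proj₂; ∃-syntax)
open import Data.Product.Properties using (≡-dec)
open import Data.Sum as Sum using (_⊎_; inj₁; inj₂; [_,_]′; swap)
open import Data.Unit using (⊤; tt)
open import Data.Vec using (Vec; []; _∷_; lookup; tabulate; toList)
open import Data.Vec.Properties using (lookup∘tabulate; tabulate∘lookup; tabulate-cong; lookup-map)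
open import Function using (_∘_; id; case_of_; _⇔_; mk⇔; Equivalence)
open import Relation.Binary using (Tri; tri<; tri≈; tri>)
open import Relation.Binary.Construct.Closure.ReflexiveTransitive using (ε; _◅_)
open import Relation.Binary.PropositionalEquality using (_≡_; _≢_; refl; sym; trans; cong; cong₂; subst; subst₂; module ≡-Reasoning)
open import Relation.Nullary using (¬_; Dec; yes; no; does; contradiction)
open import Relation.Nullary.Decidable using (_×-dec_; _⊎-dec_; ¬?; _→-dec_; map′; from-yes; dec-true; dec-false; does-⇔)

-- Counting over finite index sets

-- The target f(n) = ⌊n²/2⌋ + n - 1 satisfies f(n) - f(n-2) = 2n, while f(n) - f(n-1) is n or n + 1.
-- These differences are the budgets of the induction: a pair of entries may cost 2n boxes, a single
-- entry n. The start cannot lie below 5: f(4) = 11, but the true maximum for n = 4 is 12. A descent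
-- by two needs two consecutive starting values, and 6 is treated apart because the last alternative
-- for a maximum in first position finds an entry with up to 7 boxes, which fits the single budget
-- only from n = 7 on. Deleting entries leaves gaps among the absolute values. Boxes and their
-- number are therefore defined for arbitrary integer sequences, and the induction runs over those
-- with distinct nonzero absolute values; only the exhaustive search has to return to signed
-- permutations. Deletion may also create new empty boxes, which is harmless for an upper bound.

ι : {A : Set} → Dec A → ℕ
ι d = if does d then 1 else 0

module _ {A : Set} where

  ι≤1 : (a? : Dec A) → ι a? ≤ 1
  ι≤1 (yes _) = ℕ.≤-refl
  ι≤1 (no _)  = z≤n

  ι-yes : (a? : Dec A) → A → ι a? ≡ 1
  ι-yes (yes _) _ = refl
  ι-yes (no ¬a) a = contradiction a ¬a

  ι-no : (a? : Dec A) → ¬ A → ι a? ≡ 0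
  ι-no (yes a) ¬a = contradiction a ¬a
  ι-no (no _)  _  = refl

ι-mono : ∀ {A B : Set} (a? : Dec A) (b? : Dec B) → (A → B) → ι a? ≤ ι b?
ι-mono (no _)  _       _ = z≤n
ι-mono (yes _) (yes _) _ = ℕ.≤-refl
ι-mono (yes a) (no ¬b) f = contradiction (f a) ¬b

ι-cong : ∀ {A B : Set} (a? : Dec A) (b? : Dec B) → (A → B) → (B → A) → ι a? ≡ ι b?
ι-cong a? b? f g = ℕ.≤-antisym (ι-mono a? b? f) (ι-mono b? a? g)

ι-exclusive : ∀ {A B : Set} (a? : Dec A) (b? : Dec B) → ¬ (A × B) → ι a? + ι b? ≤ 1
ι-exclusive (yes a) (yes b) h = contradiction (a , b) h
ι-exclusive (yes _) (no _)  _ = ℕ.≤-refl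
ι-exclusive (no _)  b?      _ = ι≤1 b?

sum-mono : ∀ {n} {f g : Fin n → ℕ} → (∀ i → f i ≤ g i) → sum f ≤ sum g
sum-mono {zero}  _ = z≤n
sum-mono {suc n} h = ℕ.+-mono-≤ (h zero) (sum-mono (h ∘ suc))

sum-const : ∀ n c → sum {n} (λ _ → c) ≡ n * c
sum-const zero    c = refl
sum-const (suc n) c = cong (c +_) (sum-const n c)

sum-const-1 : ∀ n → sum {n} (λ _ → 1) ≡ n
sum-const-1 n = trans (sum-const n 1) (ℕ.*-identityʳ n)

sum-none : ∀ {n} {P : Fin n → Set} (P? : ∀ i → Dec (P i)) → (∀ i → ¬ P i) → sum (ι ∘ P?) ≡ 0
sum-none {zero}  P? h = refl
sum-none {suc n} P? h rewrite ι-no (P? zero) (h zero) = sum-none (P? ∘ suc) (h ∘ suc)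

AtMostOne : ∀ {n} → (Fin n → Set) → Set
AtMostOne P = ∀ i j → P i → P j → i ≡ j

sum-atMostOne : ∀ {n} {P : Fin n → Set} (P? : ∀ i → Dec (P i)) → AtMostOne P → sum (ι ∘ P?) ≤ 1
sum-atMostOne {zero}  P? h = z≤n
sum-atMostOne {suc n} P? h with P? zero
... | yes p = s≤s (ℕ.≤-reflexive (sum-none (P? ∘ suc) (λ i q → case h zero (suc i) p q of λ ())))
... | no _  = sum-atMostOne (P? ∘ suc) (λ i j p q → F.suc-injective (h (suc i) (suc j) p q))

f≤sum : ∀ {n} (f : Fin n → ℕ) i → f i ≤ sum f
f≤sum {suc n} f zero    = ℕ.m≤m+n _ _
f≤sum {suc n} f (suc i) = ℕ.≤-trans (f≤sum (f ∘ suc) i) (ℕ.m≤n+m _ _)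

sum-mono-< : ∀ {n} {f g : Fin n → ℕ} → (∀ i → f i ≤ g i) → ∀ i → f i < g i → sum f < sum g
sum-mono-< {suc n} h zero    lt = ℕ.+-mono-<-≤ lt (sum-mono (h ∘ suc))
sum-mono-< {suc n} h (suc i) lt = ℕ.+-mono-≤-< (h zero) (sum-mono-< (h ∘ suc) i lt)

-- Square matrices of counts and the removal of indices

total : ∀ {n} → (Fin n → Fin n → ℕ) → ℕ
total M = sum (λ i → sum (M i))

total-mono : ∀ {n} {M N : Fin n → Fin n → ℕ} → (∀ i j → M i j ≤ N i j) → total M ≤ total N
total-mono h = sum-mono (λ i → sum-mono (h i))

minor : ∀ {n} {A : Set} → Fin (suc n) → (Fin (suc n) → Fin (suc n) → A) → Fin n → Fin n → A
minor p M i j = M (punchIn p i) (punchIn p j)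

cross : ∀ {n} → (Fin n → Fin n → ℕ) → Fin n → Fin n → ℕ
cross M i j = M i j + M j i

total-remove : ∀ {n} (M : Fin (suc n) → Fin (suc n) → ℕ) p →
  total M ≡ (M p p + sum (λ r → cross M p (punchIn p r))) + total (minor p M)
total-remove M p = begin
  total M
    ≡⟨ sum-remove {i = p} (λ i → sum (M i)) ⟩
  sum (M p) + sum (λ i → sum (M (↑ i)))
    ≡⟨ cong₂ _+_ (sum-remove {i = p} (M p)) (sum-cong-≗ (λ i → sum-remove {i = p} (M (↑ i)))) ⟩
  (M p p + sum (λ r → M p (↑ r))) + sum (λ i → M (↑ i) p + sum (λ j → M (↑ i) (↑ j)))
    ≡⟨ cong (λ z → M p p + sum (λ r → M p (↑ r)) + z) (∑-distrib-+ (λ i → M (↑ i) p) _) ⟩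
  (M p p + sum (λ r → M p (↑ r))) + (sum (λ i → M (↑ i) p) + total (minor p M))
    ≡⟨ rearr (M p p) _ _ _ ⟩
  (M p p + (sum (λ r → M p (↑ r)) + sum (λ i → M (↑ i) p))) + total (minor p M)
    ≡⟨ cong (λ z → M p p + z + total (minor p M)) (∑-distrib-+ (λ r → M p (↑ r)) _) ⟨
  (M p p + sum (λ r → cross M p (↑ r))) + total (minor p M) ∎
  where
  open ≡-Reasoning
  ↑ = punchIn p
  rearr : ∀ a b c d → (a + b) + (c + d) ≡ (a + (b + c)) + d
  rearr = solve-∀

total-remove₂ : ∀ {n} (M : Fin (suc (suc n)) → Fin (suc (suc n)) → ℕ) p q′ →
  let q = punchIn p q′ ; ↑ = λ r → punchIn p (punchIn q′ r) in
  total M ≡ (M p p + M q q + cross M p q + sum (λ r → cross M p (↑ r) + cross M q (↑ r)))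
            + total (minor q′ (minor p M))
total-remove₂ M p q′ = begin
  total M
    ≡⟨ total-remove M p ⟩
  (M p p + sum (λ r → cross M p (punchIn p r))) + total (minor p M)
    ≡⟨ cong₂ (λ a b → M p p + a + b) (sum-remove {i = q′} (λ r → cross M p (punchIn p r))) (total-remove (minor p M) q′) ⟩
  (M p p + (cross M p q + sum (λ r → cross M p (↑ r)))) + ((M q q + sum (λ r → cross M q (↑ r))) + rest)
    ≡⟨ rearr (M p p) (cross M p q) _ (M q q) _ rest ⟩
  (M p p + M q q + cross M p q + (sum (λ r → cross M p (↑ r)) + sum (λ r → cross M q (↑ r)))) + rest
    ≡⟨ cong (λ z → M p p + M q q + cross M p q + z + rest) (∑-distrib-+ (λ r → cross M p (↑ r)) _) ⟨
  (M p p + M q q + cross M p q + sum (λ r → cross M p (↑ r) + cross M q (↑ r))) + rest ∎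
  where
  open ≡-Reasoning
  q = punchIn p q′
  ↑ = λ r → punchIn p (punchIn q′ r)
  rest = total (minor q′ (minor p M))
  rearr : ∀ a b c d e f → (a + (b + c)) + ((d + e) + f) ≡ (a + d + b + (c + e)) + f
  rearr = solve-∀

-- The edges of a sequence of signed values

Btw : {A : Set} → (A → A → Set) → A → A → A → Set
Btw _<_ a b c = (a < b × b < c) ⊎ (c < b × b < a)

Btwᶠ : ∀ {n} → Fin n → Fin n → Fin n → Set
Btwᶠ = Btw F._<_

Btwᶻ : ℤ → ℤ → ℤ → Set
Btwᶻ = Btw ℤ._<_

btwᶠ? : ∀ {n} (i j k : Fin n) → Dec (Btwᶠ i j k)
btwᶠ? i j k = (i F.<? j ×-dec j F.<? k) ⊎-dec (k F.<? j ×-dec j F.<? i)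

btwᶻ? : ∀ a b c → Dec (Btwᶻ a b c)
btwᶻ? a b c = (a ℤ.<? b ×-dec b ℤ.<? c) ⊎-dec (c ℤ.<? b ×-dec b ℤ.<? a)

Btwᶻ-neg : ∀ {a b c} → Btwᶻ a b c → Btwᶻ (- a) (- b) (- c)
Btwᶻ-neg (inj₁ (p , q)) = inj₂ (ℤ.neg-mono-< q , ℤ.neg-mono-< p)
Btwᶻ-neg (inj₂ (p , q)) = inj₁ (ℤ.neg-mono-< q , ℤ.neg-mono-< p)

Btwᶻ-neg⁻¹ : ∀ {a b c} → Btwᶻ (- a) (- b) (- c) → Btwᶻ a b c
Btwᶻ-neg⁻¹ (inj₁ (p , q)) = inj₂ (ℤ.neg-cancel-< q , ℤ.neg-cancel-< p)
Btwᶻ-neg⁻¹ (inj₂ (p , q)) = inj₁ (ℤ.neg-cancel-< q , ℤ.neg-cancel-< p)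

-- R and D say that the box spanned by two points of the centrally symmetric set
-- {±(i , V i)} is empty: by (i , V i) and (j , V j) for R i j, by (-i , -V i) and (j , V j)
-- for D i j; L moreover excludes the origin.  Each pair (i , j) stands for one reflection:
-- a sign change if i = j, a transposition if i < j, a signed transposition if i > j.
module _ {n} (V : Fin n → ℤ) where

  R D L : Fin n → Fin n → Set
  R i j = ∀ k → Btwᶠ i k j → ¬ Btwᶻ (V i) (V k) (V j)
  D i j = ∀ k → (k F.< j → ¬ Btwᶻ (- V i) (V k) (V j)) × (k F.< i → ¬ Btwᶻ (- V j) (V k) (V i))
  L i j = ¬ Btwᶻ (- V i) 0ℤ (V j) × D i j

  R? : ∀ i j → Dec (R i j)
  R? i j = F.all? (λ k → btwᶠ? i k j →-dec ¬? (btwᶻ? (V i) (V k) (V j)))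

  D? : ∀ i j → Dec (D i j)
  D? i j = F.all? (λ k → (k F.<? j →-dec ¬? (btwᶻ? (- V i) (V k) (V j)))
                   ×-dec (k F.<? i →-dec ¬? (btwᶻ? (- V j) (V k) (V i))))

  L? : ∀ i j → Dec (L i j)
  L? i j = ¬? (btwᶻ? (- V i) 0ℤ (V j)) ×-dec D? i j

  EdgeBy : ∀ i j → Tri (i F.< j) (i ≡ j) (j F.< i) → Set
  EdgeBy i j (tri< _ _ _) = R i j
  EdgeBy i j (tri≈ _ _ _) = D i i
  EdgeBy i j (tri> _ _ _) = L i j

  EdgeBy? : ∀ i j t → Dec (EdgeBy i j t)
  EdgeBy? i j (tri< _ _ _) = R? i j
  EdgeBy? i j (tri≈ _ _ _) = D? i i
  EdgeBy? i j (tri> _ _ _) = L? i j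

  -- All three kinds of reflections fill one square matrix, so that deleting an entry of `V` becomes
  -- deleting a row and a column.
  Edge : Fin n → Fin n → Set
  Edge i j = EdgeBy i j (F.<-cmp i j)

  Edge? : ∀ i j → Dec (Edge i j)
  Edge? i j = EdgeBy? i j (F.<-cmp i j)

  edge# : Fin n → Fin n → ℕ
  edge# i j = ι (Edge? i j)

  degree : ℕ
  degree = total edge#

  -- The weight of an unordered pair. `R` and `L` are symmetric, so the two indices may be given in
  -- either order, whereas `Edge` reads off the kind of the reflection from their order.
  mult : Fin n → Fin n → ℕ
  mult i j = ι (R? i j) + ι (L? i j)

  loop : Fin n → ℕ
  loop i = ι (D? i i)

  R-sym : ∀ {i j} → R i j → R j i
  R-sym r k b b′ = r k (swap b) (swap b′)

  D-sym : ∀ {i j} → D i j → D j i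
  D-sym d k = proj₂ (d k) , proj₁ (d k)

  L-sym : ∀ {i j} → L i j → L j i
  L-sym {i} {j} (o , d) = (λ b → o (subst (Btwᶻ (- V i) 0ℤ) (ℤ.neg-involutive _) (swap (Btwᶻ-neg b)))) , D-sym d

  edge-diag : ∀ i → edge# i i ≡ loop i
  edge-diag i with F.<-cmp i i
  ... | tri< _ ≢ _ = contradiction refl ≢
  ... | tri≈ _ _ _ = refl
  ... | tri> _ ≢ _ = contradiction refl ≢

  cross-edge : ∀ {i j} → i ≢ j → cross edge# i j ≡ mult i j
  cross-edge {i} {j} i≢j with F.<-cmp i j | F.<-cmp j i
  ... | tri≈ _ i≡j _ | _            = contradiction i≡j i≢j
  ... | _            | tri≈ _ j≡i _ = contradiction (sym j≡i) i≢j
  ... | tri< _ _ ¬a  | tri< a _ _   = contradiction a ¬a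
  ... | tri> ¬a _ _  | tri> _ _ a   = contradiction a ¬a
  ... | tri< _ _ _   | tri> _ _ _   = cong (ι (R? i j) +_) (ι-cong (L? j i) (L? i j) L-sym L-sym)
  ... | tri> _ _ _   | tri< _ _ _   = trans (ℕ.+-comm (ι (L? i j)) _) (cong (_+ ι (L? i j)) (ι-cong (R? j i) (R? i j) R-sym R-sym))

-- Deletion of entries and change of sign

punchIn-mono-< : ∀ {n} (p : Fin (suc n)) {i j : Fin n} → i F.< j → punchIn p i F.< punchIn p j
punchIn-mono-< p {i} {j} i<j = ℕ.≰⇒> (λ h → ℕ.<⇒≱ i<j (F.punchIn-cancel-≤ p j i h))

del : ∀ {n} → Fin (suc n) → (Fin (suc n) → ℤ) → Fin n → ℤ
del p V i = V (punchIn p i)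

module _ {n} (V : Fin (suc n) → ℤ) (p : Fin (suc n)) where
  private ↑ = punchIn p

  R-del : ∀ {i j} → R V (↑ i) (↑ j) → R (del p V) i j
  R-del r k (inj₁ (a , b)) = r (↑ k) (inj₁ (punchIn-mono-< p a , punchIn-mono-< p b))
  R-del r k (inj₂ (a , b)) = r (↑ k) (inj₂ (punchIn-mono-< p a , punchIn-mono-< p b))

  D-del : ∀ {i j} → D V (↑ i) (↑ j) → D (del p V) i j
  D-del d k = (λ k<j → proj₁ (d (↑ k)) (punchIn-mono-< p k<j)) , (λ k<i → proj₂ (d (↑ k)) (punchIn-mono-< p k<i))

  -- Deleting a point cannot spoil an empty box, and since `punchIn` is strictly monotone the kind
  -- of the reflection stays the same.
  Edge-del : ∀ i j → Edge V (↑ i) (↑ j) → Edge (del p V) i j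
  Edge-del i j with F.<-cmp i j | F.<-cmp (↑ i) (↑ j)
  ... | tri< _ _ _   | tri< _ _ _   = R-del
  ... | tri≈ _ _ _   | tri≈ _ _ _   = D-del
  ... | tri> _ _ _   | tri> _ _ _   = λ (o , d) → o , D-del d
  ... | tri< a _ _   | tri≈ ¬a _ _  = contradiction (punchIn-mono-< p a) ¬a
  ... | tri< a _ _   | tri> ¬a _ _  = contradiction (punchIn-mono-< p a) ¬a
  ... | tri≈ _ q _   | tri< _ ¬q _  = contradiction (cong ↑ q) ¬q
  ... | tri≈ _ q _   | tri> _ ¬q _  = contradiction (cong ↑ q) ¬q
  ... | tri> _ _ a   | tri< _ _ ¬a  = contradiction (punchIn-mono-< p a) ¬a
  ... | tri> _ _ a   | tri≈ _ _ ¬a  = contradiction (punchIn-mono-< p a) ¬a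

  edge-del : ∀ i j → edge# V (↑ i) (↑ j) ≤ edge# (del p V) i j
  edge-del i j = ι-mono (Edge? V (↑ i) (↑ j)) (Edge? (del p V) i j) (Edge-del i j)

  degree-remove : degree V ≤ (loop V p + sum (λ r → mult V p (↑ r))) + degree (del p V)
  degree-remove = ℕ.≤-trans (ℕ.≤-reflexive (trans (total-remove (edge# V) p)
      (cong₂ (λ a b → a + b + total (minor p (edge# V))) (edge-diag V p)
        (sum-cong-≗ (λ r → cross-edge V (F.punchInᵢ≢i p r ∘ sym))))))
    (ℕ.+-monoʳ-≤ (loop V p + sum (λ r → mult V p (↑ r))) (total-mono edge-del))

degree-remove₂ : ∀ {n} (V : Fin (suc (suc n)) → ℤ) p q′ →
  let q = punchIn p q′ ; ↑ = λ r → punchIn p (punchIn q′ r) in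
  degree V ≤ (loop V p + loop V q + mult V p q + sum (λ r → mult V p (↑ r) + mult V q (↑ r))) + degree (del q′ (del p V))
degree-remove₂ V p q′ = ℕ.≤-trans (ℕ.≤-reflexive (trans (total-remove₂ (edge# V) p q′)
      (cong (_+ total (minor q′ (minor p (edge# V))))
        (cong₂ _+_ (cong₂ _+_ (cong₂ _+_ (edge-diag V p) (edge-diag V q)) (cross-edge V p≢q))
          (sum-cong-≗ (λ r → cong₂ _+_ (cross-edge V (F.punchInᵢ≢i p (punchIn q′ r) ∘ sym))
            (cross-edge V (λ h → F.punchInᵢ≢i q′ r (sym (F.punchIn-injective p _ _ h))))))))))
    (ℕ.+-monoʳ-≤ (loop V p + loop V q + mult V p q + sum (λ r → mult V p (↑ r) + mult V q (↑ r)))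
      (total-mono (λ i j → ℕ.≤-trans (edge-del V p (punchIn q′ i) (punchIn q′ j)) (edge-del (del p V) q′ i j))))
  where
  q = punchIn p q′
  ↑ = λ r → punchIn p (punchIn q′ r)
  p≢q : p ≢ q
  p≢q = F.punchInᵢ≢i p q′ ∘ sym

-- What deletion preserves of the window of a signed permutation: the absolute values are distinct,
-- and nonzero by the case `i = j` of the second part.
Signed : ∀ {n} → (Fin n → ℤ) → Set
Signed V = (∀ {i j} → V i ≡ V j → i ≡ j) × (∀ i j → V i ≢ - V j)

Signed-del : ∀ {n} {V : Fin (suc n) → ℤ} p → Signed V → Signed (del p V)
Signed-del p (inj , anti) = (λ {i} {j} h → F.punchIn-injective p i j (inj h)) , (λ i j → anti (punchIn p i) (punchIn p j))

negate : ∀ {n} → (Fin n → ℤ) → Fin n → ℤ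
negate V i = - V i

Signed-negate : ∀ {n} {V : Fin n → ℤ} → Signed V → Signed (negate V)
Signed-negate (inj , anti) = (λ h → inj (ℤ.neg-injective h)) , (λ i j h → anti i j (ℤ.neg-injective h))

-- Turning the picture upside down maps empty boxes to empty boxes.
degree-negate : ∀ {n} (V : Fin n → ℤ) → degree V ≤ degree (negate V)
degree-negate V = total-mono (λ i j → ι-mono (Edge? V i j) (Edge? (negate V) i j) (edge i j))
  where
  R-neg : ∀ {i j} → R V i j → R (negate V) i j
  R-neg r k b b′ = r k b (Btwᶻ-neg⁻¹ b′)
  D-neg : ∀ {i j} → D V i j → D (negate V) i j
  D-neg d k = (λ lt b → proj₁ (d k) lt (Btwᶻ-neg⁻¹ b)) , (λ lt b → proj₂ (d k) lt (Btwᶻ-neg⁻¹ b))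
  edge : ∀ i j → Edge V i j → Edge (negate V) i j
  edge i j with F.<-cmp i j
  ... | tri< _ _ _ = R-neg
  ... | tri≈ _ _ _ = D-neg
  ... | tri> _ _ _ = λ (o , d) → o ∘ Btwᶻ-neg⁻¹ , D-neg d

-- Tools for counting the boxes lost with one or two entries

module _ {a b c : ℤ} where

  squeeze : ¬ Btwᶻ a b c → b ℤ.< c → b ≢ a → b ℤ.< a
  squeeze nb b<c b≢a = ℤ.≤∧≢⇒< (ℤ.≮⇒≥ (λ a<b → nb (inj₁ (a<b , b<c)))) b≢a

  squeeze⁻ : ¬ Btwᶻ a b c → a ℤ.< b → b ≢ c → c ℤ.< b
  squeeze⁻ nb a<b b≢c = ℤ.≤∧≢⇒< (ℤ.≮⇒≥ (λ b<c → nb (inj₁ (a<b , b<c)))) (b≢c ∘ sym)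

neg-flip : ∀ {a b} → a ℤ.< - b → b ℤ.< - a
neg-flip {a} {b} h = subst (ℤ._< - a) (ℤ.neg-involutive b) (ℤ.neg-mono-< h)

neg-pos : ∀ {a} → 0ℤ ℤ.< a → - a ℤ.< 0ℤ
neg-pos = ℤ.neg-mono-<

pos-neg : ∀ {a} → a ℤ.< 0ℤ → 0ℤ ℤ.< - a
pos-neg = ℤ.neg-mono-<

AtMostOne-< : ∀ {n} {P : Fin n → Set} → (∀ {i j} → i F.< j → P i → P j → ⊥) → AtMostOne P
AtMostOne-< h i j p q with F.<-cmp i j
... | tri< i<j _ _ = ⊥-elim (h i<j p q)
... | tri≈ _ i≡j _ = i≡j
... | tri> _ _ j<i = ⊥-elim (h j<i q p)

ι-pair : ∀ {A B : Set} (a? : Dec A) (b? : Dec B) {x} → (A → B → 1 ≤ x) → ι a? + ι b? ≤ 1 + x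
ι-pair (yes a) (yes b) h = s≤s (h a b)
ι-pair (yes _) (no _)  _ = s≤s z≤n
ι-pair (no _)  b?      _ = ℕ.≤-trans (ι≤1 b?) (s≤s z≤n)

ι-⊎ : ∀ {A B : Set} (a? : Dec A) (b? : Dec B) → ¬ (A × B) → ι a? + ι b? ≤ ι (a? ⊎-dec b?)
ι-⊎ (yes a) (yes b) h = contradiction (a , b) h
ι-⊎ (yes _) (no _)  _ = ℕ.≤-refl
ι-⊎ (no _)  b?      _ = ℕ.≤-refl

sum-classes : ∀ {n} {P Q : Fin n → Set} (P? : ∀ i → Dec (P i)) (Q? : ∀ i → Dec (Q i)) {f : Fin n → ℕ} →
  (∀ r → f r ≤ 2 + (ι (P? r) + ι (Q? r))) → sum f ≤ 2 * n + (sum (ι ∘ P?) + sum (ι ∘ Q?))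
sum-classes {n} P? Q? {f} h = begin
  sum f                                                     ≤⟨ sum-mono h ⟩
  sum {n} (λ r → 2 + (ι (P? r) + ι (Q? r)))                 ≡⟨ ∑-distrib-+ {n} (λ _ → 2) _ ⟩
  sum {n} (λ _ → 2) + sum {n} (λ r → ι (P? r) + ι (Q? r))   ≡⟨ cong₂ _+_ (trans (sum-const n 2) (ℕ.*-comm n 2)) (∑-distrib-+ {n} (ι ∘ P?) _) ⟩
  2 * n + (sum (ι ∘ P?) + sum (ι ∘ Q?))                     ∎
  where open ℕ.≤-Reasoning

-- The bound is demanded along every injection because the sums run over the indices that remain
-- after `p` and `q` are taken out.
Bounded : ∀ {n} {P : Fin n → Set} → (∀ i → Dec (P i)) → ℕ → Set
Bounded {n} P? b = ∀ {m} (f : Fin m → Fin n) → (∀ {i j} → f i ≡ f j → i ≡ j) → sum (ι ∘ P? ∘ f) ≤ b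

atMostOne-bounded : ∀ {n} {P : Fin n → Set} (P? : ∀ i → Dec (P i)) → AtMostOne P → Bounded P? 1
atMostOne-bounded P? h f f-inj = sum-atMostOne (P? ∘ f) (λ i j p q → f-inj (h (f i) (f j) p q))

none-bounded : ∀ {n} {P : Fin n → Set} (P? : ∀ i → Dec (P i)) → (∀ i → ¬ P i) → Bounded P? 0
none-bounded P? h f _ = ℕ.≤-reflexive (sum-none (P? ∘ f) (h ∘ f))

-- Groups the edges from `r` to `p` and `q` by kind: one edge of each kind is free, and `x` and `y`
-- pay for a second one.
shuffle : ∀ a b c d {x y} → a + c ≤ 1 + x → b + d ≤ 1 + y → (a + b) + (c + d) ≤ 2 + (x + y)
shuffle a b c d {x} {y} h h′ = begin
  (a + b) + (c + d)   ≡⟨ lhs a b c d ⟩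
  (a + c) + (b + d)   ≤⟨ ℕ.+-mono-≤ h h′ ⟩
  (1 + x) + (1 + y)   ≡⟨ rhs x y ⟩
  2 + (x + y)         ∎
  where
  open ℕ.≤-Reasoning
  lhs : ∀ a b c d → (a + b) + (c + d) ≡ (a + c) + (b + d)
  lhs = solve-∀
  rhs : ∀ x y → (1 + x) + (1 + y) ≡ 2 + (x + y)
  rhs = solve-∀

regroup : ∀ a {b c} → b ≤ 1 → a + c ≤ 1 → a + (b + c) ≤ 2
regroup a {b} {c} h h′ = ℕ.≤-trans (ℕ.≤-reflexive (lhs a b c)) (ℕ.+-mono-≤ h h′)
  where
  lhs : ∀ a b c → a + (b + c) ≡ b + (a + c)
  lhs = solve-∀

swapped : ∀ {a b c} → ¬ Btwᶻ a b c → ¬ Btwᶻ c b a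
swapped h = h ∘ swap

-- The two admissible descents. With N = 2 + n entries, a single entry may cost N edges and a pair
-- 2N, which is exactly the growth of the claimed maximum from N - 2 to N.
Light : ∀ {n} → (Fin (2 + n) → ℤ) → Set
Light {n} V =
    (∃[ p ] loop V p + sum (λ r → mult V p (punchIn p r)) ≤ 2 + n)
  ⊎ (∃[ p ] ∃[ q′ ] let q = punchIn p q′ in
      loop V p + loop V q + mult V p q + sum (λ r → mult V p (punchIn p (punchIn q′ r)) + mult V q (punchIn p (punchIn q′ r)))
        ≤ 2 * (2 + n))

record Top {n} (V : Fin n → ℤ) (p : Fin n) : Set where
  field
    positive : 0ℤ ℤ.< V p
    above    : ∀ k → k ≢ p → V k ℤ.< V p
    below    : ∀ k → - V p ℤ.< V k

-- Removing the entry p of largest absolute value together with its smaller neighbour q.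
-- An index adjacent to both p and q belongs to one of two classes P and Q (on either side
-- of p), and each class has at most one element.
module PairRemoval {n} (V : Fin (2 + n) → ℤ) (signed : Signed V) (p : Fin (2 + n)) (top : Top V p) where
  open Top top
  private
    inj = proj₁ signed
    anti = proj₂ signed

  V≢ : ∀ {i j} → i ≢ j → V i ≢ V j
  V≢ h eq = h (inj eq)

  V≢0 : ∀ i → V i ≢ 0ℤ
  V≢0 i h = anti i i (trans h (sym (cong -_ h)))

  -- The box starts at height - V p < 0 on the negative side and has to miss the origin.
  L⇒negative : ∀ {r} → L V p r → V r ℤ.< 0ℤ
  L⇒negative {r} (o , _) = ℤ.≤∧≢⇒< (ℤ.≮⇒≥ (λ h → o (inj₁ (neg-pos positive , h)))) (V≢0 r)

  <⇒≢ᶠ : ∀ {i j : Fin (2 + n)} → i F.< j → i ≢ j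
  <⇒≢ᶠ i<j refl = ℕ.<-irrefl refl i<j

  -- The box of this sign change covers all heights between - V p and V p, so it contains every
  -- earlier entry.
  no-loop : ∀ {k} → k F.< p → ¬ D V p p
  no-loop {k} k<p d = proj₁ (d k) k<p (inj₁ (below k , above k (<⇒≢ᶠ k<p)))

  -- All entries lie below V p, so the box between `p` and `r` can only be empty if V r is a record
  -- as seen from `p`.
  R⇒> : ∀ {k r} → Btwᶠ p k r → R V p r → V k ℤ.< V r
  R⇒> {k} {r} b rp = squeeze (λ bt → rp k b (swap bt)) (above k (k≢p b)) (V≢ (k≢r b))
    where
    k≢p : Btwᶠ p k r → k ≢ p
    k≢p (inj₁ (a , _)) = <⇒≢ᶠ a ∘ sym
    k≢p (inj₂ (_ , a)) = <⇒≢ᶠ a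
    k≢r : Btwᶠ p k r → k ≢ r
    k≢r (inj₁ (_ , a)) = <⇒≢ᶠ a
    k≢r (inj₂ (a , _)) = <⇒≢ᶠ a ∘ sym

  module _ (q : Fin (2 + n)) (p≢q : p ≢ q) where
    private
      q′ = punchOut p≢q
      ↑ : Fin n → Fin (2 + n)
      ↑ r = punchIn p (punchIn q′ r)

      q′-eq : punchIn p q′ ≡ q
      q′-eq = F.punchIn-punchOut p≢q

      ↑-inj : ∀ {i j} → ↑ i ≡ ↑ j → i ≡ j
      ↑-inj h = F.punchIn-injective q′ _ _ (F.punchIn-injective p _ _ h)

      ↑≢p : ∀ r → ↑ r ≢ p
      ↑≢p r = F.punchInᵢ≢i p _

      ↑≢q : ∀ r → ↑ r ≢ q
      ↑≢q r h = F.punchInᵢ≢i q′ r (F.punchIn-injective p _ _ (trans h (sym q′-eq)))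

    -- The accounting for the budget 2 (2 + n): each of the other n indices has two edges for free,
    -- which leaves 4 for the edges within {p, q} and for the exceptional indices.
    light : ∀ {P Q : Fin (2 + n) → Set} (P? : ∀ r → Dec (P r)) (Q? : ∀ r → Dec (Q r)) {b c} →
      (∀ r → r ≢ p → r ≢ q → mult V p r + mult V q r ≤ 2 + (ι (P? r) + ι (Q? r))) →
      Bounded P? b → Bounded Q? c → loop V p + loop V q + mult V p q + (b + c) ≤ 4 → Light V
    light P? Q? {b} {c} h hP hQ le = inj₂ (p , q′ , subst (λ z → loop V p + loop V z + mult V p z + sum (λ r → mult V p (↑ r) + mult V z (↑ r)) ≤ 2 * (2 + n)) (sym q′-eq) bound)
      where
      open ℕ.≤-Reasoning
      rearr : ∀ a b m → a + (m + b) ≡ (a + b) + m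
      rearr = solve-∀
      own = loop V p + loop V q + mult V p q
      bound = begin
        own + sum (λ r → mult V p (↑ r) + mult V q (↑ r))
          ≤⟨ ℕ.+-monoʳ-≤ own (sum-classes (P? ∘ ↑) (Q? ∘ ↑) (λ r → h (↑ r) (↑≢p r) (↑≢q r))) ⟩
        own + (2 * n + (sum (ι ∘ P? ∘ ↑) + sum (ι ∘ Q? ∘ ↑)))
          ≤⟨ ℕ.+-monoʳ-≤ own (ℕ.+-monoʳ-≤ (2 * n) (ℕ.+-mono-≤ (hP ↑ ↑-inj) (hQ ↑ ↑-inj))) ⟩
        own + (2 * n + (b + c))
          ≡⟨ rearr own (b + c) (2 * n) ⟩
        own + (b + c) + 2 * n
          ≤⟨ ℕ.+-monoˡ-≤ (2 * n) le ⟩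
        4 + 2 * n
          ≡⟨ ℕ.*-distribˡ-+ 2 2 n ⟨
        2 * (2 + n) ∎

  -- Here the smaller neighbour follows `p`. The point at `m`, just before `p` and above V q, is the
  -- obstruction: because of it no index is joined to both `p` and `q` by `L`, and the sign change
  -- at `q` excludes `L V p q`.
  light-up : ∀ {m q} → suc (toℕ m) ≡ toℕ p → toℕ q ≡ suc (toℕ p) → V q ℤ.< V m → Light V
  light-up {m} {q} m+1≡p q≡p+1 Vq<Vm =
    light q (<⇒≢ᶠ p<q) P? Q? pointwise (atMostOne-bounded P? P-unique) (atMostOne-bounded Q? Q-unique) own
    where
    p<q : p F.< q
    p<q = ℕ.≤-reflexive (sym q≡p+1)
    m<p : m F.< p
    m<p = ℕ.≤-reflexive m+1≡p
    m<q : m F.< q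
    m<q = ℕ.<-trans m<p p<q
    P Q : Fin (2 + n) → Set
    P r = q F.< r × R V p r × R V q r
    Q r = r F.< p × R V p r × R V q r
    P? : ∀ r → Dec (P r)
    P? r = q F.<? r ×-dec R? V p r ×-dec R? V q r
    Q? : ∀ r → Dec (Q r)
    Q? r = r F.<? p ×-dec R? V p r ×-dec R? V q r
    -- Both indices are records seen from `p`, so V q < V r < V r′ and `r` lies in the box of `q`
    -- and `r′`.
    P-unique : AtMostOne P
    P-unique = AtMostOne-< λ {r} {r′} r<r′ (q<r , Rpr , _) (_ , Rpr′ , Rqr′) →
      Rqr′ r (inj₁ (q<r , r<r′)) (inj₁ (R⇒> (inj₁ (p<q , q<r)) Rpr , R⇒> (inj₁ (ℕ.<-trans p<q q<r , r<r′)) Rpr′))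
    -- Going left from `p`, the first record is `m` itself, and all later ones are higher.
    Vq<Vr : ∀ {r} → r F.< p → R V p r → V q ℤ.< V r
    Vq<Vr {r} r<p Rpr with F.<-cmp r m
    ... | tri< r<m _ _  = ℤ.<-trans Vq<Vm (R⇒> (inj₂ (r<m , m<p)) Rpr)
    ... | tri≈ _ refl _ = Vq<Vm
    ... | tri> _ _ m<r  = contradiction (ℕ.≤-trans (ℕ.≤-reflexive (cong suc (sym m+1≡p))) (ℕ.≤-trans (s≤s m<r) r<p)) ℕ.1+n≰n
    Q-unique : AtMostOne Q
    Q-unique = AtMostOne-< λ {r} {r′} r<r′ (_ , Rpr , Rqr) (r′<p , Rpr′ , _) →
      Rqr r′ (inj₂ (r<r′ , ℕ.<-trans r′<p p<q)) (inj₁ (Vq<Vr r′<p Rpr′ , R⇒> (inj₂ (r<r′ , r′<p)) Rpr))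
    no-LL : ∀ {r} → L V p r → L V q r → ⊥
    no-LL {r} (_ , dp) (_ , dq) = proj₂ (dq m) m<q
      (inj₂ (Vq<Vm , squeeze (proj₂ (dp m) m<p) (above m (<⇒≢ᶠ m<p)) (anti m r)))
    class : ∀ r → r ≢ p → r ≢ q → R V p r → R V q r → 1 ≤ ι (P? r) + ι (Q? r)
    class r r≢p r≢q a b with F.<-cmp r p
    ... | tri< r<p _ _ = ℕ.≤-trans (ℕ.≤-reflexive (sym (ι-yes (Q? r) (r<p , a , b)))) (ℕ.m≤n+m _ (ι (P? r)))
    ... | tri≈ _ eq _  = contradiction eq r≢p
    ... | tri> _ _ p<r = ℕ.≤-trans (ℕ.≤-reflexive (sym (ι-yes (P? r) (q<r , a , b)))) (ℕ.m≤m+n _ (ι (Q? r)))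
      where
      q<r : q F.< r
      q<r = ℕ.≤∧≢⇒< (ℕ.≤-trans (ℕ.≤-reflexive q≡p+1) p<r) (λ h → r≢q (F.toℕ-injective (sym h)))
    pointwise : ∀ r → r ≢ p → r ≢ q → mult V p r + mult V q r ≤ 2 + (ι (P? r) + ι (Q? r))
    pointwise r r≢p r≢q = ℕ.≤-trans (shuffle (ι (R? V p r)) (ι (L? V p r)) (ι (R? V q r)) (ι (L? V q r))
      (ι-pair (R? V p r) (R? V q r) {ι (P? r) + ι (Q? r)} (class r r≢p r≢q))
      (ι-pair (L? V p r) (L? V q r) {0} (λ a b → ⊥-elim (no-LL a b))))
      (ℕ.≤-reflexive (cong (2 +_) (ℕ.+-identityʳ _)))
    own : loop V p + loop V q + mult V p q + (1 + 1) ≤ 4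
    own rewrite ι-no (D? V p p) (no-loop m<p) = ℕ.+-monoˡ-≤ 2 {loop V q + mult V p q} {2}
      -- `D V q q` pushes V m above - V q, and then `m` lies in the box of `L V p q`.
      (regroup (loop V q) (ι≤1 (R? V p q)) (ι-exclusive (D? V q q) (L? V p q) λ (dq , _ , dpq) →
        proj₂ (dpq m) m<p (inj₁ (squeeze⁻ (swapped (proj₁ (dq m) m<q)) Vq<Vm (anti m q) , above m (<⇒≢ᶠ m<p)))))

  -- Here the smaller neighbour precedes `p`; the condition on the right neighbour is quantified so
  -- that it also covers a last `p`. Now `L` may join an index to both `p` and `q`, and such indices
  -- (`Q₂`) share one class with the indices of `Q₁`, so that the budget still suffices.
  module Classes {q} (q+1≡p : suc (toℕ q) ≡ toℕ p) (Vq<V+ : ∀ m → toℕ m ≡ suc (toℕ p) → V q ℤ.< V m) where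
    private
      q<p : q F.< p
      q<p = ℕ.≤-reflexive q+1≡p
    P Q₁ Q₂ Q : Fin (2 + n) → Set
    P r = p F.< r × R V p r × R V q r
    Q₁ r = r F.< q × R V p r × R V q r
    Q₂ r = L V p r × L V q r
    Q r = Q₁ r ⊎ Q₂ r
    P? : ∀ r → Dec (P r)
    P? r = p F.<? r ×-dec R? V p r ×-dec R? V q r
    Q₁? : ∀ r → Dec (Q₁ r)
    Q₁? r = r F.<? q ×-dec R? V p r ×-dec R? V q r
    Q₂? : ∀ r → Dec (Q₂ r)
    Q₂? r = L? V p r ×-dec L? V q r
    Q? : ∀ r → Dec (Q r)
    Q? r = Q₁? r ⊎-dec Q₂? r
    Vq<Vr : ∀ {r} → p F.< r → R V p r → V q ℤ.< V r
    Vq<Vr {r} p<r Rpr with ℕ.m≤n⇒m<n∨m≡n p<r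
    ... | inj₂ p+1≡r = Vq<V+ r (sym p+1≡r)
    ... | inj₁ p+1<r = ℤ.<-trans (Vq<V+ m m≡p+1) (R⇒> (inj₁ (ℕ.≤-reflexive (sym m≡p+1) , subst (_< toℕ r) (sym m≡p+1) p+1<r)) Rpr)
      where
      m = F.fromℕ< (ℕ.<-trans p+1<r (F.toℕ<n r))
      m≡p+1 : toℕ m ≡ suc (toℕ p)
      m≡p+1 = F.toℕ-fromℕ< (ℕ.<-trans p+1<r (F.toℕ<n r))
    P-unique : AtMostOne P
    P-unique = AtMostOne-< λ {r} {r′} r<r′ (p<r , Rpr , _) (_ , Rpr′ , Rqr′) →
      Rqr′ r (inj₁ (ℕ.<-trans q<p p<r , r<r′)) (inj₁ (Vq<Vr p<r Rpr , R⇒> (inj₁ (p<r , r<r′)) Rpr′))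
    Q₁-excl : ∀ {r r′} → r F.< r′ → Q₁ r → Q₁ r′ → ⊥
    Q₁-excl {r} {r′} r<r′ (_ , Rpr , Rqr) (r′<q , Rpr′ , _) =
      Rqr r′ (inj₂ (r<r′ , r′<q)) (inj₁ (R⇒> (inj₂ (r′<q , q<p)) Rpr′ , R⇒> (inj₂ (r<r′ , ℕ.<-trans r′<q q<p)) Rpr))
    -- `L V p r′` gives V r′ < V r, and `q` staying out of the box of `L V p r` gives V r < - V q.
    -- Hence `r` lies in the box of `L V q r′`.
    Q₂-excl : ∀ {r r′} → r F.< r′ → Q₂ r → Q₂ r′ → ⊥
    Q₂-excl {r} {r′} r<r′ ((_ , dpr) , _) ((_ , dpr′) , (_ , dqr′)) = proj₁ (dqr′ r) r<r′
      (inj₂ ( squeeze⁻ (proj₁ (dpr′ r) r<r′) (below r) (V≢ (<⇒≢ᶠ r<r′))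
            , neg-flip (squeeze (proj₂ (dpr q) q<p) (above q (<⇒≢ᶠ q<p)) (anti q r))))
    -- As a record, `r` is higher than `q`; as it avoids the box of `L V p r′`, it is lower than - V
    -- r′. This places it in the box of `L V q r′`.
    Q₁₂-excl : ∀ {r r′} → Q₁ r → Q₂ r′ → ⊥
    Q₁₂-excl {r} {r′} (r<q , Rpr , _) ((_ , dpr′) , (_ , dqr′)) = proj₂ (dqr′ r) r<q
      (inj₂ ( R⇒> (inj₂ (r<q , q<p)) Rpr
            , squeeze (proj₂ (dpr′ r) (ℕ.<-trans r<q q<p)) (above r (<⇒≢ᶠ (ℕ.<-trans r<q q<p))) (anti r r′)))
    Q-excl : ∀ {r r′} → r F.< r′ → Q r → Q r′ → ⊥
    Q-excl r<r′ (inj₁ a) (inj₁ b) = Q₁-excl r<r′ a b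
    Q-excl r<r′ (inj₂ a) (inj₂ b) = Q₂-excl r<r′ a b
    Q-excl _    (inj₁ a) (inj₂ b) = Q₁₂-excl a b
    Q-excl _    (inj₂ a) (inj₁ b) = Q₁₂-excl b a
    Q-unique : AtMostOne Q
    Q-unique = AtMostOne-< Q-excl
    class : ∀ r → r ≢ p → r ≢ q → R V p r → R V q r → 1 ≤ ι (P? r) + ι (Q₁? r)
    class r r≢p r≢q a b with F.<-cmp r p
    ... | tri> _ _ p<r = ℕ.≤-trans (ℕ.≤-reflexive (sym (ι-yes (P? r) (p<r , a , b)))) (ℕ.m≤m+n _ (ι (Q₁? r)))
    ... | tri≈ _ eq _  = contradiction eq r≢p
    ... | tri< r<p _ _ = ℕ.≤-trans (ℕ.≤-reflexive (sym (ι-yes (Q₁? r) (r<q , a , b)))) (ℕ.m≤n+m _ (ι (P? r)))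
      where
      r<q : r F.< q
      r<q = ℕ.≤∧≢⇒< (ℕ.≤-pred (ℕ.≤-trans r<p (ℕ.≤-reflexive (sym q+1≡p)))) (λ h → r≢q (F.toℕ-injective h))
    Q-split : ∀ r → ι (Q₁? r) + ι (Q₂? r) ≤ ι (Q? r)
    Q-split r = ι-⊎ (Q₁? r) (Q₂? r) (λ (a , b) → Q₁₂-excl a b)
    pointwise : ∀ r → r ≢ p → r ≢ q → mult V p r + mult V q r ≤ 2 + (ι (P? r) + ι (Q? r))
    pointwise r r≢p r≢q = ℕ.≤-trans (shuffle (ι (R? V p r)) (ι (L? V p r)) (ι (R? V q r)) (ι (L? V q r))
      (ι-pair (R? V p r) (R? V q r) {ι (P? r) + ι (Q₁? r)} (class r r≢p r≢q))
      (ι-pair (L? V p r) (L? V q r) {ι (Q₂? r)} (λ a b → ℕ.≤-reflexive (sym (ι-yes (Q₂? r) (a , b))))))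
      (s≤s (s≤s (ℕ.≤-trans (ℕ.≤-reflexive (ℕ.+-assoc (ι (P? r)) _ _)) (ℕ.+-monoʳ-≤ (ι (P? r)) (Q-split r)))))

  -- If `D V q q` and `L V p q` both hold, the edges within {p, q} may number 3 instead of 2, but
  -- then the class `Q` is empty. So the budget 4 is spent either as 3 + 1 + 0 or as 2 + 1 + 1.
  light-down : ∀ {q} → suc (toℕ q) ≡ toℕ p → (∀ m → toℕ m ≡ suc (toℕ p) → V q ℤ.< V m) → Light V
  light-down {q} q+1≡p Vq<V+ with D? V q q ×-dec L? V p q
  ... | yes (dq , lpq) = light q (<⇒≢ᶠ q<p ∘ sym) P? Q? pointwise (atMostOne-bounded P? P-unique) (none-bounded Q? no-Q) own
    where
    q<p : q F.< p
    q<p = ℕ.≤-reflexive q+1≡p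
    open Classes q+1≡p Vq<V+
    no-Q : ∀ r → ¬ Q r
    no-Q r (inj₁ (r<q , rp , rq)) = proj₂ (proj₂ lpq r) (ℕ.<-trans r<q q<p)
      (inj₁ (squeeze⁻ (swapped (proj₁ (dq r) r<q)) (R⇒> (inj₂ (r<q , q<p)) rp) (anti r q) , above r (<⇒≢ᶠ (ℕ.<-trans r<q q<p))))
    no-Q r (inj₂ (lp , lq)) = proj₁ lq (inj₂ (L⇒negative lp , pos-neg (L⇒negative lpq)))
    own : loop V p + loop V q + mult V p q + (1 + 0) ≤ 4
    own rewrite ι-no (D? V p p) (no-loop q<p) = ℕ.+-monoˡ-≤ 1 {loop V q + mult V p q} {3}
      (ℕ.+-mono-≤ (ι≤1 (D? V q q)) (ℕ.+-mono-≤ (ι≤1 (R? V p q)) (ι≤1 (L? V p q))))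
  ... | no ¬both = light q (<⇒≢ᶠ q<p ∘ sym) P? Q? pointwise (atMostOne-bounded P? P-unique) (atMostOne-bounded Q? Q-unique) own
    where
    q<p : q F.< p
    q<p = ℕ.≤-reflexive q+1≡p
    open Classes q+1≡p Vq<V+
    own : loop V p + loop V q + mult V p q + (1 + 1) ≤ 4
    own rewrite ι-no (D? V p p) (no-loop q<p) = ℕ.+-monoˡ-≤ 2 {loop V q + mult V p q} {2}
      (regroup (loop V q) (ι≤1 (R? V p q)) (ι-exclusive (D? V q q) (L? V p q) ¬both))

ι-dropʳ : ∀ {A B : Set} (a? : Dec A) (b? : Dec B) → ¬ B → ι a? + ι b? ≤ ι a?
ι-dropʳ a? b? ¬b = ℕ.≤-reflexive (trans (cong (ι a? +_) (ι-no b? ¬b)) (ℕ.+-identityʳ _))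

ι-sum≢0 : ∀ {A B : Set} (a? : Dec A) (b? : Dec B) → ι a? + ι b? ≢ 0 → A ⊎ B
ι-sum≢0 (yes a) _       _ = inj₁ a
ι-sum≢0 (no _)  (yes b) _ = inj₂ b
ι-sum≢0 (no _)  (no _)  h = contradiction refl h

last-two : ∀ {n} {P : Fin n → Set} → (∀ i → Dec (P i)) →
  AtMostOne P ⊎ (∃[ a′ ] ∃[ a ] a′ F.< a × P a′ × P a × (∀ r → a F.< r → ¬ P r))
last-two {zero}  P? = inj₁ (λ ())
last-two {suc n} {P} P? with last-two (P? ∘ suc)
... | inj₂ (a′ , a , lt , pa′ , pa , max) = inj₂ (suc a′ , suc a , s≤s lt , pa′ , pa , max′)
  where
  max′ : ∀ r → suc a F.< r → ¬ P r
  max′ (suc r) (s≤s a<r) = max r a<r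
... | inj₁ one with P? zero | F.any? (P? ∘ suc)
... | yes p₀ | yes (a , pa) = inj₂ (zero , suc a , s≤s z≤n , p₀ , pa , max)
  where
  max : ∀ r → suc a F.< r → ¬ P r
  max (suc r) (s≤s a<r) pr with refl ← one a r pa pr = ℕ.<-irrefl refl a<r
... | yes _  | no none = inj₁ λ where
  zero    zero    _ _ → refl
  zero    (suc j) _ q → contradiction (j , q) none
  (suc i) _       p _ → contradiction (i , p) none
... | no ¬p₀ | _ = inj₁ λ where
  zero    _       p _ → contradiction p ¬p₀
  (suc i) zero    _ q → contradiction q ¬p₀
  (suc i) (suc j) p q → cong suc (one i j p q)

-- The maximum is the first entry.  Either it has small degree, or it can be removed
-- together with the second entry, or almost all entries are positive and increasing,
-- and then the last positive entry has small degree.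
module Corner {n} (V : Fin (2 + n) → ℤ) (signed : Signed V) (top : Top V zero) (5≤n : 5 ≤ n) where
  open Top top
  open PairRemoval V signed zero top
  private
    anti = proj₂ signed

    ₀ ₁ : Fin (2 + n)
    ₀ = zero
    ₁ = suc zero

    ⁺ : Fin n → Fin (2 + n)
    ⁺ r = suc (suc r)

    ₀<₁ : ₀ F.< ₁
    ₀<₁ = s≤s z≤n

    ₁<⁺ : ∀ r → ₁ F.< ⁺ r
    ₁<⁺ r = s≤s (s≤s z≤n)

    ⁺-mono : ∀ {r r′} → r F.< r′ → ⁺ r F.< ⁺ r′
    ⁺-mono h = s≤s (s≤s h)

  -- Seen from a maximum in first position, `R` leads to the running maxima of the later entries and
  -- `L` to their running minima.
  record-max : ∀ {k r} → ₀ F.< k → k F.< r → R V ₀ r → V k ℤ.< V r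
  record-max a b = R⇒> (inj₁ (a , b))

  record-min : ∀ {k r} → k F.< r → L V ₀ r → V r ℤ.< V k
  record-min {k} k<r (_ , d) = squeeze⁻ (proj₁ (d k) k<r) (below k) (V≢ (<⇒≢ᶠ k<r))

  -- `R` would place the value above V ₁ and `L` would place it below.
  e₀≤1 : ∀ r → mult V ₀ (⁺ r) ≤ 1
  e₀≤1 r = ι-exclusive (R? V ₀ (⁺ r)) (L? V ₀ (⁺ r)) λ (a , b) →
    ℤ.<-asym (record-max ₀<₁ (₁<⁺ r) a) (record-min (₁<⁺ r) b)

  e≤2 : ∀ i j → mult V i j ≤ 2
  e≤2 i j = ℕ.+-mono-≤ (ι≤1 (R? V i j)) (ι≤1 (L? V i j))

  e≢0 : ∀ {i j} → mult V i j ≢ 0 → R V i j ⊎ L V i j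
  e≢0 {i} {j} = ι-sum≢0 (R? V i j) (L? V i j)

  remove-₀ : mult V ₀ ₁ + sum (λ r → mult V ₀ (⁺ r)) ≤ 1 + n → Light V
  remove-₀ h = inj₁ (₀ , ℕ.+-mono-≤ (ι≤1 (D? V ₀ ₀)) h)

  corner-light : Light V
  corner-light with V ₁ ℤ.<? 0ℤ
  ... | no V₁≮0 = remove-₀ (ℕ.+-mono-≤ e₀₁≤1 (ℕ.≤-trans (sum-mono e₀≤1) (ℕ.≤-reflexive (sum-const-1 n))))
    where
    e₀₁≤1 : mult V ₀ ₁ ≤ 1
    e₀₁≤1 = ι-exclusive (R? V ₀ ₁) (L? V ₀ ₁) (V₁≮0 ∘ L⇒negative ∘ proj₂)
  ... | yes V₁<0 with F.any? (λ r → mult V ₀ (⁺ r) ℕ.≟ 0)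
  -- With V ₁ negative, `₀` and `₁` may share two edges; the index not joined to `₀` makes up for
  -- this. Without such an index every later entry is a record.
  ... | yes (r , e≡0) = remove-₀ (ℕ.≤-trans (ℕ.+-monoˡ-≤ _ (e≤2 ₀ ₁)) (s≤s
        (ℕ.≤-trans (sum-mono-< e₀≤1 r (ℕ.≤-reflexive (cong suc e≡0))) (ℕ.≤-reflexive (sum-const-1 n)))))
  ... | no e₀≢0 = split
    where
    recorded : ∀ r → R V ₀ (⁺ r) ⊎ L V ₀ (⁺ r)
    recorded r = e≢0 (λ h → e₀≢0 (r , h))

    L₁⇒positive : ∀ {r} → L V ₁ r → 0ℤ ℤ.< V r
    L₁⇒positive {r} (o , _) = ℤ.≤∧≢⇒< (ℤ.≮⇒≥ (λ h → o (inj₂ (h , pos-neg V₁<0)))) (V≢0 r ∘ sym)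

    positive⇒max : ∀ {r} → 0ℤ ℤ.< V (⁺ r) → R V ₀ (⁺ r)
    positive⇒max {r} h with recorded r
    ... | inj₁ a = a
    ... | inj₂ b = ⊥-elim (ℤ.<-asym h (L⇒negative b))

    Double : Fin n → Set
    Double r = R V ₁ (⁺ r) × L V ₁ (⁺ r)
    Double? : ∀ r → Dec (Double r)
    Double? r = R? V ₁ (⁺ r) ×-dec L? V ₁ (⁺ r)

    max-between : ∀ {r r′} → r F.< r′ → R V ₀ (⁺ r) → R V ₀ (⁺ r′) → ¬ R V ₁ (⁺ r′)
    max-between {r} r<r′ a b R₁ = R₁ (⁺ r) (inj₁ (₁<⁺ r , ⁺-mono r<r′))
      (inj₁ (record-max ₀<₁ (₁<⁺ r) a , record-max (s≤s z≤n) (⁺-mono r<r′) b))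

    -- `L` from the negative entry `₁` makes both entries positive, hence running maxima, and the
    -- earlier one lies in the `R` box from `₁` to the later one.
    Double-unique : AtMostOne Double
    Double-unique = AtMostOne-< λ r<r′ (_ , a) (c , b) →
      max-between r<r′ (positive⇒max (L₁⇒positive a)) (positive⇒max (L₁⇒positive b)) c

    e₁≤ : ∀ r → mult V ₁ (⁺ r) ≤ 1 + ι (Double? r)
    e₁≤ r = ι-pair (R? V ₁ (⁺ r)) (L? V ₁ (⁺ r)) (λ a b → ℕ.≤-reflexive (sym (ι-yes (Double? r) (a , b))))

    sum-1+Double : sum (λ r → 1 + ι (Double? r)) ≤ n + 1
    sum-1+Double = ℕ.≤-trans (ℕ.≤-reflexive (∑-distrib-+ {n} (λ _ → 1) (ι ∘ Double?)))
      (ℕ.+-mono-≤ (ℕ.≤-reflexive (sum-const-1 n)) (sum-atMostOne Double? Double-unique))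

    -- Every later entry is now joined to both `₀` and `₁`. A negative one is joined to `₁` by `R`,
    -- which leaves room for at most one negative running maximum and one negative running minimum.
    -- All the others are positive, hence running maxima, hence increasing.
    module Positive (e₁≢0 : ¬ (∃[ r ] mult V ₁ (⁺ r) ≡ 0)) where

      reached : ∀ r → R V ₁ (⁺ r) ⊎ L V ₁ (⁺ r)
      reached r = e≢0 (λ h → e₁≢0 (r , h))

      Pos NegMax NegMin : Fin n → Set
      Pos r = 0ℤ ℤ.< V (⁺ r)
      NegMax r = V (⁺ r) ℤ.< 0ℤ × R V ₀ (⁺ r)
      NegMin r = V (⁺ r) ℤ.< 0ℤ × L V ₀ (⁺ r)
      Pos? : ∀ r → Dec (Pos r)
      Pos? r = 0ℤ ℤ.<? V (⁺ r)
      NegMax? : ∀ r → Dec (NegMax r)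
      NegMax? r = V (⁺ r) ℤ.<? 0ℤ ×-dec R? V ₀ (⁺ r)
      NegMin? : ∀ r → Dec (NegMin r)
      NegMin? r = V (⁺ r) ℤ.<? 0ℤ ×-dec L? V ₀ (⁺ r)

      negative⇒R₁ : ∀ {r} → V (⁺ r) ℤ.< 0ℤ → R V ₁ (⁺ r)
      negative⇒R₁ {r} h with reached r
      ... | inj₁ a = a
      ... | inj₂ b = ⊥-elim (ℤ.<-asym h (L₁⇒positive b))

      NegMax-unique : AtMostOne NegMax
      NegMax-unique = AtMostOne-< λ r<r′ (_ , a) (h , b) → max-between r<r′ a b (negative⇒R₁ h)

      NegMin-unique : AtMostOne NegMin
      NegMin-unique = AtMostOne-< λ {r} r<r′ (_ , a) (h , b) → negative⇒R₁ h (⁺ r) (inj₁ (₁<⁺ r , ⁺-mono r<r′))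
        (inj₂ (record-min (⁺-mono r<r′) b , record-min (₁<⁺ r) a))

      classified : ∀ r → Pos r ⊎ NegMax r ⊎ NegMin r
      classified r with ℤ.<-cmp 0ℤ (V (⁺ r)) | recorded r
      ... | tri< h _ _ | _      = inj₁ h
      ... | tri≈ _ h _ | _      = contradiction (sym h) (V≢0 (⁺ r))
      ... | tri> _ _ h | inj₁ a = inj₂ (inj₁ (h , a))
      ... | tri> _ _ h | inj₂ b = inj₂ (inj₂ (h , b))

      not-one : ¬ AtMostOne Pos
      -- One element in each of the three classes would mean n ≤ 3.
      not-one one = ℕ.<⇒≱ (ℕ.≤-trans (ℕ.n≤1+n 4) 5≤n) (begin
        n                                                             ≡⟨ sum-const-1 n ⟨
        sum {n} (λ _ → 1)                                             ≤⟨ sum-mono count ⟩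
        sum {n} (λ r → ι (Pos? r) + (ι (NegMax? r) + ι (NegMin? r)))  ≡⟨ ∑-distrib-+ {n} (ι ∘ Pos?) _ ⟩
        sum (ι ∘ Pos?) + sum {n} (λ r → ι (NegMax? r) + ι (NegMin? r)) ≡⟨ cong (sum (ι ∘ Pos?) +_) (∑-distrib-+ {n} (ι ∘ NegMax?) _) ⟩
        sum (ι ∘ Pos?) + (sum (ι ∘ NegMax?) + sum (ι ∘ NegMin?))
          ≤⟨ ℕ.+-mono-≤ (sum-atMostOne Pos? one) (ℕ.+-mono-≤ (sum-atMostOne NegMax? NegMax-unique) (sum-atMostOne NegMin? NegMin-unique)) ⟩
        3 ∎)
        where
        open ℕ.≤-Reasoning
        count : ∀ r → 1 ≤ ι (Pos? r) + (ι (NegMax? r) + ι (NegMin? r))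
        count r with classified r
        ... | inj₁ a        = ℕ.≤-trans (ℕ.≤-reflexive (sym (ι-yes (Pos? r) a))) (ℕ.m≤m+n _ _)
        ... | inj₂ (inj₁ a) = ℕ.≤-trans (ℕ.≤-trans (ℕ.≤-reflexive (sym (ι-yes (NegMax? r) a))) (ℕ.m≤m+n _ _)) (ℕ.m≤n+m _ (ι (Pos? r)))
        ... | inj₂ (inj₂ a) = ℕ.≤-trans (ℕ.≤-trans (ℕ.≤-reflexive (sym (ι-yes (NegMin? r) a))) (ℕ.m≤n+m _ (ι (NegMax? r)))) (ℕ.m≤n+m _ (ι (Pos? r)))

      -- The last positive entry has at most 7 edges: one to `₀`, one to `₁`, one to its predecessor
      -- among the positive entries, and two to each of at most two negative entries. The earlier
      -- positive entry `a′` lies in the box of its sign change and in that of `R` towards `₁`. The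
      -- assumption 5 ≤ n is made for the sake of 7 ≤ 2 + n.
      module Last {a′ a} (a′<a : a′ F.< a) (pa′ : Pos a′) (pa : Pos a) (max : ∀ r → a F.< r → ¬ Pos r) where

        Pred : Fin n → Set
        Pred r = Pos r × r ≢ a × R V (⁺ a) (⁺ r)
        Pred? : ∀ r → Dec (Pred r)
        Pred? r = Pos? r ×-dec ¬? (r F.≟ a) ×-dec R? V (⁺ a) (⁺ r)

        increasing : ∀ {r r′} → r F.< r′ → Pos r′ → V (⁺ r) ℤ.< V (⁺ r′)
        increasing r<r′ p = record-max (s≤s z≤n) (⁺-mono r<r′) (positive⇒max p)

        Pred-unique : AtMostOne Pred
        Pred-unique = AtMostOne-< excl
          where
          excl : ∀ {r r′} → r F.< r′ → Pred r → Pred r′ → ⊥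
          excl {r} {r′} r<r′ (_ , _ , b) (p , r′≢a , _) with F.<-cmp r′ a
          ... | tri< r′<a _ _ = b (⁺ r′) (inj₂ (⁺-mono r<r′ , ⁺-mono r′<a)) (inj₂ (increasing r<r′ p , increasing r′<a pa))
          ... | tri≈ _ eq _   = r′≢a eq
          ... | tri> _ _ a<r′ = max r′ a<r′ p

        g : Fin (2 + n) → ℕ
        g zero          = 1
        g (suc zero)    = 1
        g (suc (suc r)) = ι (Pred? r) + (2 * ι (NegMax? r) + 2 * ι (NegMin? r))

        not-both-positive : ∀ {i j} → 0ℤ ℤ.< V i → 0ℤ ℤ.< V j → ¬ L V i j
        not-both-positive pi pj (o , _) = o (inj₁ (neg-pos pi , pj))

        e≤g : ∀ r → r ≢ ⁺ a → mult V (⁺ a) r ≤ g r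
        e≤g zero _ = ι-exclusive (R? V (⁺ a) ₀) (L? V (⁺ a) ₀) (not-both-positive {⁺ a} {₀} pa positive ∘ proj₂)
        e≤g (suc zero) _ = ι-exclusive (R? V (⁺ a) ₁) (L? V (⁺ a) ₁) (λ (b , _) → b (⁺ a′) (inj₂ (₁<⁺ a′ , ⁺-mono a′<a))
            (inj₂ (ℤ.<-trans V₁<0 pa′ , increasing a′<a pa)))
        e≤g (suc (suc r)) r≢a with classified r
        ... | inj₁ p =
          ℕ.≤-trans (ι-dropʳ (R? V (⁺ a) (⁺ r)) (L? V (⁺ a) (⁺ r)) (not-both-positive {⁺ a} {⁺ r} pa p)) (ℕ.≤-trans
            (ι-mono (R? V (⁺ a) (⁺ r)) (Pred? r) (λ b → p , (λ h → r≢a (cong ⁺ h)) , b)) (ℕ.m≤m+n _ _))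
        ... | inj₂ (inj₁ c) = ℕ.≤-trans (e≤2 (⁺ a) (⁺ r)) (ℕ.≤-trans
            (ℕ.≤-trans (ℕ.≤-reflexive (cong (2 *_) (sym (ι-yes (NegMax? r) c)))) (ℕ.m≤m+n _ _)) (ℕ.m≤n+m _ (ι (Pred? r))))
        ... | inj₂ (inj₂ c) = ℕ.≤-trans (e≤2 (⁺ a) (⁺ r)) (ℕ.≤-trans
            (ℕ.≤-trans (ℕ.≤-reflexive (cong (2 *_) (sym (ι-yes (NegMin? r) c)))) (ℕ.m≤n+m _ (2 * ι (NegMax? r)))) (ℕ.m≤n+m _ (ι (Pred? r))))

        sum-double : ∀ {P : Fin n → Set} (P? : ∀ r → Dec (P r)) → AtMostOne P → sum (λ r → 2 * ι (P? r)) ≤ 2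
        sum-double P? one = begin
          sum {n} (λ r → 2 * ι (P? r))                 ≡⟨ sum-cong-≗ {n} (λ r → cong (ι (P? r) +_) (ℕ.+-identityʳ _)) ⟩
          sum {n} (λ r → ι (P? r) + ι (P? r))          ≡⟨ ∑-distrib-+ {n} (ι ∘ P?) _ ⟩
          sum (ι ∘ P?) + sum (ι ∘ P?)                  ≤⟨ ℕ.+-mono-≤ (sum-atMostOne P? one) (sum-atMostOne P? one) ⟩
          2                                            ∎
          where open ℕ.≤-Reasoning

        sum-g : sum g ≤ 7
        sum-g = s≤s (s≤s (begin
          sum {n} (λ r → ι (Pred? r) + (2 * ι (NegMax? r) + 2 * ι (NegMin? r)))  ≡⟨ ∑-distrib-+ {n} (ι ∘ Pred?) _ ⟩
          sum (ι ∘ Pred?) + sum {n} (λ r → 2 * ι (NegMax? r) + 2 * ι (NegMin? r)) ≡⟨ cong (sum (ι ∘ Pred?) +_) (∑-distrib-+ {n} (λ r → 2 * ι (NegMax? r)) _) ⟩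
          sum (ι ∘ Pred?) + (sum {n} (λ r → 2 * ι (NegMax? r)) + sum {n} (λ r → 2 * ι (NegMin? r)))
            ≤⟨ ℕ.+-mono-≤ (sum-atMostOne Pred? Pred-unique) (ℕ.+-mono-≤ (sum-double NegMax? NegMax-unique) (sum-double NegMin? NegMin-unique)) ⟩
          5 ∎))
          where open ℕ.≤-Reasoning

        no-loop-a : ¬ D V (⁺ a) (⁺ a)
        no-loop-a d = proj₁ (d (⁺ a′)) (⁺-mono a′<a) (inj₁ (ℤ.<-trans (neg-pos pa) pa′ , increasing a′<a pa))

        remove-a : Light V
        remove-a = inj₁ (⁺ a , (begin
          loop V (⁺ a) + sum (λ r → mult V (⁺ a) (punchIn (⁺ a) r))  ≡⟨ cong (_+ sum (λ r → mult V (⁺ a) (punchIn (⁺ a) r))) (ι-no (D? V (⁺ a) (⁺ a)) no-loop-a) ⟩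
          sum (λ r → mult V (⁺ a) (punchIn (⁺ a) r))                 ≤⟨ sum-mono (λ r → e≤g (punchIn (⁺ a) r) (F.punchInᵢ≢i (⁺ a) r)) ⟩
          sum (λ r → g (punchIn (⁺ a) r))                         ≤⟨ ℕ.m≤n+m _ (g (⁺ a)) ⟩
          g (⁺ a) + sum (λ r → g (punchIn (⁺ a) r))               ≡⟨ sum-remove {i = ⁺ a} g ⟨
          sum g                                                   ≤⟨ sum-g ⟩
          7                                                       ≤⟨ s≤s (s≤s 5≤n) ⟩
          2 + n                                                   ∎))
          where open ℕ.≤-Reasoning

    split : Light V
    split with F.any? (λ r → mult V ₁ (⁺ r) ℕ.≟ 0)
    ... | yes (r , e≡0) = inj₂ (₀ , zero , (begin
        loop V ₀ + loop V ₁ + mult V ₀ ₁ + sum (λ r → mult V ₀ (⁺ r) + mult V ₁ (⁺ r))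
          ≡⟨ cong (loop V ₀ + loop V ₁ + mult V ₀ ₁ +_) (∑-distrib-+ {n} (λ r → mult V ₀ (⁺ r)) _) ⟩
        loop V ₀ + loop V ₁ + mult V ₀ ₁ + (sum {n} (λ r → mult V ₀ (⁺ r)) + sum {n} (λ r → mult V ₁ (⁺ r)))
          ≤⟨ ℕ.+-mono-≤ (ℕ.+-mono-≤ (ℕ.+-mono-≤ (ι≤1 (D? V ₀ ₀)) (ι≤1 (D? V ₁ ₁))) (e≤2 ₀ ₁))
               (ℕ.+-mono-≤ (ℕ.≤-trans (sum-mono e₀≤1) (ℕ.≤-reflexive (sum-const-1 n))) Σe₁) ⟩
        4 + (n + n)
          ≡⟨ arith n ⟩
        2 * (2 + n) ∎))
      where
      open ℕ.≤-Reasoning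
      arith : ∀ n → 4 + (n + n) ≡ 2 * (2 + n)
      arith = solve-∀
      -- The index not joined to `₁` makes up for the only one that may be joined to it twice.
      Σe₁ : sum (λ r → mult V ₁ (⁺ r)) ≤ n
      Σe₁ = ℕ.≤-pred (ℕ.≤-trans (sum-mono-< e₁≤ r (ℕ.≤-trans (ℕ.≤-reflexive (cong suc e≡0)) (s≤s z≤n)))
        (ℕ.≤-trans sum-1+Double (ℕ.≤-reflexive (ℕ.+-comm n 1))))
    ... | no e₁≢0 with last-two (Positive.Pos? e₁≢0)
    ... | inj₁ one = contradiction one (Positive.not-one e₁≢0)
    ... | inj₂ (a′ , a , lt , pa′ , pa , max) = Positive.Last.remove-a e₁≢0 lt pa′ pa max

-- Signed permutations as integer sequences

key : ∀ {n} → Elt n → ℤ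
key (false , i) = +[1+ toℕ i ]
key (true  , i) = -[1+ toℕ i ]

window : ∀ {n} → W n → Fin n → ℤ
window π i = key (lookup π i)

-- `isSigned` tests surjectivity of the absolute values. Injectivity also makes sense for vectors
-- shorter than n, on which the search recurses.
DistinctAbs : ∀ {n m} → Vec (Elt n) m → Set
DistinctAbs v = ∀ {i j} → proj₂ (lookup v i) ≡ proj₂ (lookup v j) → i ≡ j

-- Small cases, by exhaustive search

Fresh : ∀ {n m} → List (Fin n) → Vec (Elt n) m → Set
Fresh used []            = ⊤
Fresh used ((_ , i) ∷ v) = i ∉ used × Fresh (i ∷ used) v

distinct⇒Fresh : ∀ {n m} used (v : Vec (Elt n) m) → DistinctAbs v → (∀ i → proj₂ (lookup v i) ∉ used) → Fresh used v
distinct⇒Fresh used []      inj h = tt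
distinct⇒Fresh used (x ∷ v) inj h = h zero , distinct⇒Fresh (proj₂ x ∷ used) v (λ eq → F.suc-injective (inj eq)) fresh
  where
  fresh : ∀ i → proj₂ (lookup v i) ∉ proj₂ x ∷ used
  fresh i (here eq)  = case inj {suc i} {zero} eq of λ ()
  fresh i (there h′) = h (suc i) h′

-- The search prunes a branch as soon as an absolute value repeats, so that it visits 2ⁿ n! vectors
-- and not all (2n)ⁿ of them.
all-fresh? : ∀ {n} m {P : Vec (Elt n) m → Set} → (∀ v → Dec (P v)) → ∀ used → Dec (∀ v → Fresh used v → P v)
all-fresh? zero    P? used = map′ (λ { p [] _ → p }) (λ f → f [] tt) (P? [])
all-fresh? (suc m) P? used = map′
  (λ { f ((false , i) ∷ v) (fr , frs) → proj₁ (f i fr) v frs ; f ((true , i) ∷ v) (fr , frs) → proj₂ (f i fr) v frs })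
  (λ f i fr → (λ v frs → f _ (fr , frs)) , (λ v frs → f _ (fr , frs)))
  (F.all? (λ i → ¬? (any? (i F.≟_) used) →-dec
    (all-fresh? m (λ v → P? ((false , i) ∷ v)) (i ∷ used) ×-dec all-fresh? m (λ v → P? ((true , i) ∷ v)) (i ∷ used))))

BoundedBy : ℕ → ℕ → Set
BoundedBy n b = ∀ (v : W n) → Fresh [] v → degree (window v) ≤ b

-- Opaque, so that no later conversion check unfolds the search.
abstract

  bounded-2 : BoundedBy 2 4
  bounded-2 = from-yes (all-fresh? 2 (λ v → degree (window v) ℕ.≤? 4) [])

  bounded-3 : BoundedBy 3 8
  bounded-3 = from-yes (all-fresh? 3 (λ v → degree (window v) ℕ.≤? 8) [])

  bounded-4 : BoundedBy 4 12
  bounded-4 = from-yes (all-fresh? 4 (λ v → degree (window v) ℕ.≤? 12) [])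

  bounded-5 : BoundedBy 5 16
  bounded-5 = from-yes (all-fresh? 5 (λ v → degree (window v) ℕ.≤? 16) [])

small-bound : ∀ {n b} → BoundedBy n b → (v : W n) → DistinctAbs v → degree (window v) ≤ b
small-bound h v inj = h v (distinct⇒Fresh [] v inj (λ _ ()))

-- Standardisation

record Reflects {n} (V V′ : Fin n → ℤ) : Set where
  field
    pp : ∀ i j → V′ i ℤ.< V′ j → V i ℤ.< V j
    np : ∀ i j → - V′ i ℤ.< V′ j → - V i ℤ.< V j
    pn : ∀ i j → V′ i ℤ.< - V′ j → V i ℤ.< - V j
    p0 : ∀ i → V′ i ℤ.< 0ℤ → V i ℤ.< 0ℤ
    0p : ∀ i → 0ℤ ℤ.< V′ i → 0ℤ ℤ.< V i

-- Edges say that boxes are empty, so they travel against the inequalities: a point in a box of V′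
-- has to give a point in the corresponding box of V.
degree-reflects : ∀ {n} {V V′ : Fin n → ℤ} → Reflects V V′ → degree V ≤ degree V′
degree-reflects {n} {V} {V′} ref = total-mono (λ i j → ι-mono (Edge? V i j) (Edge? V′ i j) (edge i j))
  where
  open Reflects ref
  btw : ∀ i k j → Btwᶻ (V′ i) (V′ k) (V′ j) → Btwᶻ (V i) (V k) (V j)
  btw i k j (inj₁ (a , b)) = inj₁ (pp i k a , pp k j b)
  btw i k j (inj₂ (a , b)) = inj₂ (pp j k a , pp k i b)
  btw⁻ : ∀ i k j → Btwᶻ (- V′ i) (V′ k) (V′ j) → Btwᶻ (- V i) (V k) (V j)
  btw⁻ i k j (inj₁ (a , b)) = inj₁ (np i k a , pp k j b)
  btw⁻ i k j (inj₂ (a , b)) = inj₂ (pp j k a , pn k i b)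
  btw⁰ : ∀ i j → Btwᶻ (- V′ i) 0ℤ (V′ j) → Btwᶻ (- V i) 0ℤ (V j)
  btw⁰ i j (inj₁ (a , b)) = inj₁ (neg-pos (0p i (ℤ.neg-cancel-< a)) , 0p j b)
  btw⁰ i j (inj₂ (a , b)) = inj₂ (p0 j a , pos-neg (p0 i (ℤ.neg-cancel-< b)))
  R→ : ∀ {i j} → R V i j → R V′ i j
  R→ {i} {j} r k b = r k b ∘ btw i k j
  D→ : ∀ {i j} → D V i j → D V′ i j
  D→ {i} {j} d k = (λ lt → proj₁ (d k) lt ∘ btw⁻ i k j) , (λ lt → proj₂ (d k) lt ∘ btw⁻ j k i)
  edge : ∀ i j → Edge V i j → Edge V′ i j
  edge i j with F.<-cmp i j
  ... | tri< _ _ _ = R→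
  ... | tri≈ _ _ _ = D→
  ... | tri> _ _ _ = λ (o , d) → o ∘ btw⁰ i j , D→ d

∣i∣≡∣j∣⇒i≡±j : ∀ {i j} → ℤ.∣ i ∣ ≡ ℤ.∣ j ∣ → i ≡ j ⊎ i ≡ - j
∣i∣≡∣j∣⇒i≡±j {ℤ.+ _}    {ℤ.+ _}    refl = inj₁ refl
∣i∣≡∣j∣⇒i≡±j {ℤ.+ _}    { -[1+ _ ]} refl = inj₂ refl
∣i∣≡∣j∣⇒i≡±j { -[1+ _ ]} {ℤ.+ _}    refl = inj₂ refl
∣i∣≡∣j∣⇒i≡±j { -[1+ _ ]} { -[1+ _ ]} refl = inj₁ refl

-- Each absolute value is replaced by its rank and the signs are kept. This returns from a sequence
-- with gaps to a signed permutation, where the exhaustive search applies.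
module Standardise {n} (V : Fin n → ℤ) (signed : Signed V) where
  private
    ∣V∣ : Fin n → ℕ
    ∣V∣ i = ℤ.∣ V i ∣

  ∣V∣-injective : ∀ {i j} → ∣V∣ i ≡ ∣V∣ j → i ≡ j
  ∣V∣-injective {i} {j} h = [ proj₁ signed , (λ eq → contradiction eq (proj₂ signed i j)) ]′ (∣i∣≡∣j∣⇒i≡±j h)

  rank : Fin n → ℕ
  rank i = sum (λ k → ι (∣V∣ k ℕ.<? ∣V∣ i))

  rank<n : ∀ i → rank i < n
  rank<n i = ℕ.≤-trans
    (sum-mono-< (λ k → ι≤1 (∣V∣ k ℕ.<? ∣V∣ i)) i (ℕ.≤-reflexive (cong suc (ι-no (∣V∣ i ℕ.<? ∣V∣ i) (ℕ.<-irrefl refl)))))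
    (ℕ.≤-reflexive (sum-const-1 n))

  rank-mono : ∀ {i j} → ∣V∣ i < ∣V∣ j → rank i < rank j
  rank-mono {i} {j} lt = sum-mono-< (λ k → ι-mono (∣V∣ k ℕ.<? ∣V∣ i) (∣V∣ k ℕ.<? ∣V∣ j) (λ h → ℕ.<-trans h lt)) i
    (ℕ.≤-reflexive (trans (cong suc (ι-no (∣V∣ i ℕ.<? ∣V∣ i) (ℕ.<-irrefl refl))) (sym (ι-yes (∣V∣ i ℕ.<? ∣V∣ j) lt))))

  rank-reflect : ∀ {i j} → rank i < rank j → ∣V∣ i < ∣V∣ j
  rank-reflect {i} {j} lt with ℕ.<-cmp (∣V∣ i) (∣V∣ j)
  ... | tri< h _ _ = h
  ... | tri≈ _ h _ = contradiction lt (ℕ.<-irrefl (cong rank (∣V∣-injective h)))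
  ... | tri> _ _ h = contradiction lt (ℕ.<-asym (rank-mono h))

  rank-injective : ∀ {i j} → rank i ≡ rank j → i ≡ j
  rank-injective {i} {j} eq with ℕ.<-cmp (∣V∣ i) (∣V∣ j)
  ... | tri< h _ _ = contradiction (rank-mono h) (ℕ.<-irrefl eq)
  ... | tri≈ _ h _ = ∣V∣-injective h
  ... | tri> _ _ h = contradiction (rank-mono h) (ℕ.<-irrefl (sym eq))

  negative? : ℤ → Bool
  negative? (ℤ.+ _)  = false
  negative? -[1+ _ ] = true

  value : Fin n → Elt n
  value i = negative? (V i) , F.fromℕ< (rank<n i)

  standard : W n
  standard = tabulate value

  standard-distinct : DistinctAbs standard
  standard-distinct {i} {j} eq = rank-injective (trans (sym (F.toℕ-fromℕ< (rank<n i)))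
    (trans (cong toℕ (trans (cong proj₂ (sym (lookup∘tabulate value i))) (trans eq (cong proj₂ (lookup∘tabulate value j)))))
      (F.toℕ-fromℕ< (rank<n j))))

  private
    sgn : Bool → ℕ → ℤ
    sgn false m = +[1+ m ]
    sgn true  m = -[1+ m ]

    V≢0 : ∀ i → V i ≢ 0ℤ
    V≢0 i h = proj₂ signed i i (trans h (sym (cong -_ h)))

    window-standard : ∀ i → window standard i ≡ sgn (negative? (V i)) (rank i)
    window-standard i rewrite lookup∘tabulate value i with negative? (V i)
    ... | false = cong +[1+_] (F.toℕ-fromℕ< (rank<n i))
    ... | true  = cong -[1+_] (F.toℕ-fromℕ< (rank<n i))

    reflect< : ∀ a b {m k} → a ≢ 0ℤ → b ≢ 0ℤ → (m < k → ℤ.∣ a ∣ < ℤ.∣ b ∣) → (k < m → ℤ.∣ b ∣ < ℤ.∣ a ∣) →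
      sgn (negative? a) m ℤ.< sgn (negative? b) k → a ℤ.< b
    reflect< (ℤ.+ a)  (ℤ.+ b)  _ _ f g (ℤ.+<+ (s≤s h)) = ℤ.+<+ (f h)
    reflect< (ℤ.+ a)  -[1+ b ] _ _ f g ()
    reflect< -[1+ a ] (ℤ.+ b)  _ _ f g _ = ℤ.-<+
    reflect< -[1+ a ] -[1+ b ] _ _ f g (ℤ.-<- h) = ℤ.-<- (ℕ.≤-pred (g h))

    -sgn : ∀ a m → a ≢ 0ℤ → - sgn (negative? a) m ≡ sgn (negative? (- a)) m
    -sgn (ℤ.+ zero) m h = contradiction refl h
    -sgn +[1+ _ ]   m _ = refl
    -sgn -[1+ _ ]   m _ = refl

    neg≢0 : ∀ {a} → a ≢ 0ℤ → - a ≢ 0ℤ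
    neg≢0 h eq = h (ℤ.neg-injective eq)

    V′ = window standard

  reflects : Reflects V V′
  reflects = record { pp = pp ; np = np ; pn = pn ; p0 = p0 ; 0p = 0p }
    where
    pp : ∀ i j → V′ i ℤ.< V′ j → V i ℤ.< V j
    pp i j h rewrite window-standard i | window-standard j =
      reflect< (V i) (V j) (V≢0 i) (V≢0 j) rank-reflect rank-reflect h
    np : ∀ i j → - V′ i ℤ.< V′ j → - V i ℤ.< V j
    np i j h rewrite window-standard i | window-standard j | -sgn (V i) (rank i) (V≢0 i) =
      reflect< (- V i) (V j) (neg≢0 (V≢0 i)) (V≢0 j)
        (λ lt → subst (_< ∣V∣ j) (sym (ℤ.∣-i∣≡∣i∣ (V i))) (rank-reflect lt))
        (λ lt → subst (∣V∣ j <_) (sym (ℤ.∣-i∣≡∣i∣ (V i))) (rank-reflect lt)) h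
    pn : ∀ i j → V′ i ℤ.< - V′ j → V i ℤ.< - V j
    pn i j h rewrite window-standard i | window-standard j | -sgn (V j) (rank j) (V≢0 j) =
      reflect< (V i) (- V j) (V≢0 i) (neg≢0 (V≢0 j))
        (λ lt → subst (∣V∣ i <_) (sym (ℤ.∣-i∣≡∣i∣ (V j))) (rank-reflect lt))
        (λ lt → subst (_< ∣V∣ i) (sym (ℤ.∣-i∣≡∣i∣ (V j))) (rank-reflect lt)) h
    p0 : ∀ i → V′ i ℤ.< 0ℤ → V i ℤ.< 0ℤ
    p0 i h rewrite window-standard i with V i
    ... | -[1+ _ ] = ℤ.-<+
    ... | ℤ.+ _ with h
    ... | ℤ.+<+ ()
    0p : ∀ i → 0ℤ ℤ.< V′ i → 0ℤ ℤ.< V i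
    0p i h rewrite window-standard i with V i | V≢0 i
    ... | -[1+ _ ] | _ with () ← h
    ... | +[1+ _ ] | _ = ℤ.+<+ (s≤s z≤n)
    ... | ℤ.+ zero | ne = contradiction refl ne

  standard-bound : ∀ {b} → BoundedBy n b → degree V ≤ b
  standard-bound h = ℕ.≤-trans (degree-reflects reflects) (small-bound h standard standard-distinct)

-- The induction for the upper bound

argmax : ∀ {n} (f : Fin (suc n) → ℕ) → ∃[ p ] ∀ k → f k ≤ f p
argmax {zero}  f = zero , λ { zero → ℕ.≤-refl }
argmax {suc n} f with argmax (f ∘ suc)
... | p , max with ℕ.≤-total (f zero) (f (suc p))
... | inj₁ le = suc p , λ { zero → le ; (suc k) → max k }
... | inj₂ le = zero , λ { zero → ℕ.≤-refl ; (suc k) → ℕ.≤-trans (max k) le }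

Top-intro : ∀ {n} (V : Fin n → ℤ) → Signed V → ∀ p → 0ℤ ℤ.< V p → (∀ k → ℤ.∣ V k ∣ ≤ ℤ.∣ V p ∣) → Top V p
Top-intro V (inj , anti) p pos max = record
  { positive = pos
  ; above    = λ k k≢p → ℤ.≤∧≢⇒< (upper (V k) (V p) pos (max k)) (k≢p ∘ inj)
  ; below    = λ k → ℤ.≤∧≢⇒< (lower (V k) (V p) pos (max k)) (anti k p ∘ sym)
  }
  where
  upper : ∀ a b → 0ℤ ℤ.< b → ℤ.∣ a ∣ ≤ ℤ.∣ b ∣ → a ℤ.≤ b
  upper (ℤ.+ _)  (ℤ.+ _)  _ h = ℤ.+≤+ h
  upper -[1+ _ ] (ℤ.+ _)  _ _ = ℤ.-≤+
  lower : ∀ a b → 0ℤ ℤ.< b → ℤ.∣ a ∣ ≤ ℤ.∣ b ∣ → - b ℤ.≤ a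
  lower (ℤ.+ _)  (ℤ.+ m)  _ _ = ℤ.neg-≤-pos {m}
  lower -[1+ _ ] +[1+ _ ] _ (s≤s h) = ℤ.-≤- h

light-top : ∀ {n} (V : Fin (2 + n) → ℤ) → Signed V → 5 ≤ n → ∀ p → Top V p → Light V
light-top V signed 5≤n zero top = Corner.corner-light V signed top 5≤n
light-top {n} V signed 5≤n p@(suc p′) top with suc (toℕ p) ℕ.<? 2 + n
-- Without a right neighbour the left one counts as the smaller, and the condition on the right
-- neighbour holds vacuously.
... | no p-last = light-down q+1≡p (λ m eq → contradiction (subst (_< 2 + n) eq (F.toℕ<n m)) p-last)
  where
  open PairRemoval V signed p top
  q+1≡p : suc (toℕ (F.inject₁ p′)) ≡ toℕ p
  q+1≡p = cong suc (F.toℕ-inject₁ p′)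
... | yes p+1<n with ℤ.<-cmp (V (F.inject₁ p′)) (V (F.fromℕ< p+1<n))
... | tri< lt _ _ = light-down q+1≡p
        (λ m eq → subst (λ z → V q ℤ.< V z) (F.toℕ-injective (trans (F.toℕ-fromℕ< p+1<n) (sym eq))) lt)
  where
  open PairRemoval V signed p top
  q = F.inject₁ p′
  q+1≡p : suc (toℕ q) ≡ toℕ p
  q+1≡p = cong suc (F.toℕ-inject₁ p′)
... | tri> _ _ gt = light-up (cong suc (F.toℕ-inject₁ p′)) (F.toℕ-fromℕ< p+1<n) gt
  where open PairRemoval V signed p top
... | tri≈ _ eq _ = contradiction (trans (sym (F.toℕ-inject₁ p′)) (trans (cong toℕ (proj₁ signed eq)) (F.toℕ-fromℕ< p+1<n)))
        (ℕ.<⇒≢ (ℕ.≤-trans (ℕ.n<1+n (toℕ p′)) (ℕ.n≤1+n _)))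

-- maxDegree m is the value for n = 5 + m.
maxDegree : ℕ → ℕ
maxDegree 0             = 16
maxDegree 1             = 23
maxDegree (suc (suc m)) = maxDegree m + 2 * (7 + m)

-- With N = 6 + m, the maximum grows from N - 1 to N by N + 1 if N is even and by N if N is odd;
-- either way the budget of a single removal fits.
maxDegree-step : ∀ m → maxDegree m + (6 + m) ≤ maxDegree (suc m)
maxDegree-step 0 = ℕ.n≤1+n 22
maxDegree-step 1 = ℕ.≤-refl
maxDegree-step (suc (suc m)) = ℕ.≤-trans (ℕ.≤-reflexive (arith (maxDegree m) m)) (ℕ.+-monoˡ-≤ (2 * (8 + m)) (maxDegree-step m))
  where
  arith : ∀ b m → b + 2 * (7 + m) + (8 + m) ≡ b + (6 + m) + 2 * (8 + m)
  arith = solve-∀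

-- An edge between two entries is incident with two of the deletions, a loop with only one, so that
-- loops are gained on the left. The summand 1 is the loop at the first position, before which no
-- point can obstruct.
averaging : ∀ {n b} (V : Fin (suc n) → ℤ) → (∀ p → degree (del p V) ≤ b) →
  suc n * degree V + 1 ≤ 2 * degree V + suc n * b
averaging {n} {b} V h = begin
  suc n * degree V + 1                                          ≤⟨ ℕ.+-mono-≤ (ℕ.≤-reflexive (sym (sum-const (suc n) (degree V)))) 1≤loops ⟩
  sum {suc n} (λ _ → degree V) + sum (loop V)                   ≡⟨ ∑-distrib-+ {suc n} (λ _ → degree V) (loop V) ⟨
  sum {suc n} (λ p → degree V + loop V p)                       ≤⟨ sum-mono bound ⟩
  sum {suc n} (λ p → (sum (edge# V p) + sum (λ i → edge# V i p)) + b)   ≡⟨ ∑-distrib-+ {suc n} (λ p → sum (edge# V p) + sum (λ i → edge# V i p)) (λ _ → b) ⟩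
  sum {suc n} (λ p → sum (edge# V p) + sum (λ i → edge# V i p)) + sum {suc n} (λ _ → b)
    ≡⟨ cong₂ _+_ (∑-distrib-+ {suc n} (λ p → sum (edge# V p)) (λ p → sum (λ i → edge# V i p))) (sum-const (suc n) b) ⟩
  degree V + sum {suc n} (λ p → sum (λ i → edge# V i p)) + suc n * b
    ≡⟨ cong (λ z → degree V + z + suc n * b) (trans (sym (∑-comm {suc n} {suc n} (edge# V))) (sym (ℕ.+-identityʳ _))) ⟩
  2 * degree V + suc n * b                                      ∎
  where
  open ℕ.≤-Reasoning
  1≤loops : 1 ≤ sum (loop V)
  1≤loops = ℕ.≤-trans (ℕ.≤-reflexive (sym (ι-yes (D? V zero zero) (λ k → (λ ()) , (λ ()))))) (f≤sum (loop V) zero)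
  bound : ∀ p → degree V + loop V p ≤ (sum (edge# V p) + sum (λ i → edge# V i p)) + b
  bound p = begin
    degree V + loop V p
      ≡⟨ cong₂ _+_ (total-remove (edge# V) p) (sym (edge-diag V p)) ⟩
    (edge# V p p + sum (λ r → edge# V p (↑ r) + edge# V (↑ r) p)) + total (minor p (edge# V)) + edge# V p p
      ≡⟨ cong (λ z → (edge# V p p + z) + total (minor p (edge# V)) + edge# V p p) (∑-distrib-+ {n} (λ r → edge# V p (↑ r)) (λ r → edge# V (↑ r) p)) ⟩
    (edge# V p p + (sum (λ r → edge# V p (↑ r)) + sum (λ r → edge# V (↑ r) p))) + total (minor p (edge# V)) + edge# V p p
      ≡⟨ assoc (edge# V p p) _ _ _ ⟩
    (edge# V p p + sum (λ r → edge# V p (↑ r))) + (edge# V p p + sum (λ r → edge# V (↑ r) p)) + total (minor p (edge# V))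
      ≡⟨ cong₂ (λ y z → y + z + total (minor p (edge# V))) (sum-remove {i = p} (edge# V p)) (sum-remove {i = p} (λ i → edge# V i p)) ⟨
    sum (edge# V p) + sum (λ i → edge# V i p) + total (minor p (edge# V))
      ≤⟨ ℕ.+-monoʳ-≤ (sum (edge# V p) + sum (λ i → edge# V i p)) (ℕ.≤-trans (total-mono (edge-del V p)) (h p)) ⟩
    sum (edge# V p) + sum (λ i → edge# V i p) + b ∎
    where
    ↑ = punchIn p
    assoc : ∀ a b c d → (a + (b + c)) + d + a ≡ (a + b) + (a + c) + d
    assoc = solve-∀

-- The summand 1 is decisive: 4 d ≤ 96 would leave d = 24.
six-step : ∀ d → 6 * d + 1 ≤ 2 * d + 6 * 16 → d ≤ 23
six-step d h = ℕ.≤-pred (ℕ.*-cancelˡ-< 4 d 24 (ℕ.+-cancelˡ-≤ (2 * d) (suc (4 * d)) (4 * 24)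
  (ℕ.≤-trans (ℕ.≤-reflexive (arith d)) h)))
  where
  arith : ∀ d → 2 * d + suc (4 * d) ≡ 6 * d + 1
  arith = solve-∀

light-bound : ∀ {n} (V : Fin (2 + n) → ℤ) {b₁ b₂} → Light V →
  (∀ p → degree (del p V) ≤ b₁) → (∀ p q → degree (del q (del p V)) ≤ b₂) →
  degree V ≤ (2 + n) + b₁ ⊎ degree V ≤ 2 * (2 + n) + b₂
light-bound V (inj₁ (p , le)) h₁ h₂ = inj₁ (ℕ.≤-trans (degree-remove V p) (ℕ.+-mono-≤ le (h₁ p)))
light-bound V (inj₂ (p , q , le)) h₁ h₂ = inj₂ (ℕ.≤-trans (degree-remove₂ V p q) (ℕ.+-mono-≤ le (h₂ p q)))

degree≤-5 : ∀ (V : Fin 5 → ℤ) → Signed V → degree V ≤ 16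
degree≤-5 V signed = Standardise.standard-bound V signed bounded-5

degree≤-6 : ∀ (V : Fin 6 → ℤ) → Signed V → degree V ≤ 23
degree≤-6 V signed = six-step (degree V) (averaging V (λ p → degree≤-5 (del p V) (Signed-del p signed)))

degree≤-top : ∀ {n} (V : Fin (2 + n) → ℤ) {b₁ b₂} → 5 ≤ n → Signed V →
  (∀ W → Signed W → degree {1 + n} W ≤ b₁) → (∀ W → Signed W → degree {n} W ≤ b₂) →
  ∀ p → Top V p → degree V ≤ (2 + n) + b₁ ⊎ degree V ≤ 2 * (2 + n) + b₂
degree≤-top V 5≤n signed h₁ h₂ p top = light-bound V (light-top V signed 5≤n p top)
  (λ p → h₁ (del p V) (Signed-del p signed)) (λ p q → h₂ (del q (del p V)) (Signed-del q (Signed-del p signed)))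

degree≤-step : ∀ {n} (V : Fin (2 + n) → ℤ) {b₁ b₂} → 5 ≤ n → Signed V →
  (∀ W → Signed W → degree {1 + n} W ≤ b₁) → (∀ W → Signed W → degree {n} W ≤ b₂) →
  degree V ≤ (2 + n) + b₁ ⊎ degree V ≤ 2 * (2 + n) + b₂
degree≤-step {n} V 5≤n signed h₁ h₂ with argmax (λ k → ℤ.∣ V k ∣)
... | p , max with ℤ.<-cmp 0ℤ (V p)
... | tri< pos _ _ = degree≤-top V 5≤n signed h₁ h₂ p (Top-intro V signed p pos max)
... | tri≈ _ eq _  = contradiction (trans (sym eq) (cong -_ eq)) (proj₂ signed p p)
... | tri> _ _ neg = Sum.map (ℕ.≤-trans (degree-negate V)) (ℕ.≤-trans (degree-negate V))
        (degree≤-top (negate V) 5≤n (Signed-negate {V = V} signed) h₁ h₂ p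
          (Top-intro (negate V) (Signed-negate {V = V} signed) p (pos-neg neg)
            (λ k → subst₂ _≤_ (sym (ℤ.∣-i∣≡∣i∣ (V k))) (sym (ℤ.∣-i∣≡∣i∣ (V p))) (max k))))

degree≤ : ∀ m (V : Fin (5 + m) → ℤ) → Signed V → degree V ≤ maxDegree m
degree≤ 0 = degree≤-5
degree≤ 1 = degree≤-6
degree≤ (suc (suc m)) V signed = [ one , two ]′ (degree≤-step V (ℕ.m≤m+n 5 m) signed (degree≤ (suc m)) (degree≤ m))
  where
  one : ∀ {d} → d ≤ (7 + m) + maxDegree (suc m) → d ≤ maxDegree (2 + m)
  one h = ℕ.≤-trans h (ℕ.≤-trans (ℕ.≤-reflexive (ℕ.+-comm (7 + m) (maxDegree (suc m)))) (maxDegree-step (suc m)))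
  two : ∀ {d} → d ≤ 2 * (7 + m) + maxDegree m → d ≤ maxDegree (2 + m)
  two h = ℕ.≤-trans h (ℕ.≤-reflexive (ℕ.+-comm (2 * (7 + m)) (maxDegree m)))

-- Negation on the symmetric set

neg : ∀ {n} → Elt n → Elt n
neg (b , i) = not b , i

_≟ᴱ_ : ∀ {n} (z w : Elt n) → Dec (z ≡ w)
_≟ᴱ_ = ≡-dec Bool._≟_ F._≟_

module _ {n : ℕ} where

  neg-neg : (z : Elt n) → neg (neg z) ≡ z
  neg-neg (b , i) = cong (_, i) (Bool.not-involutive b)

  neg-injective : {z w : Elt n} → neg z ≡ neg w → z ≡ w
  neg-injective {z} {w} eq = trans (sym (neg-neg z)) (trans (cong neg eq) (neg-neg w))

  z≢neg : (z : Elt n) → z ≢ neg z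
  z≢neg (false , _) ()
  z≢neg (true  , _) ()

  key-neg : (z : Elt n) → key (neg z) ≡ - key z
  key-neg (false , _) = refl
  key-neg (true  , _) = refl

  key-injective : {z w : Elt n} → key z ≡ key w → z ≡ w
  key-injective {false , i} {false , j} eq = cong (false ,_) (F.toℕ-injective (ℕ.suc-injective (ℤ.+-injective eq)))
  key-injective {true  , i} {true  , j} eq = cong (true ,_) (F.toℕ-injective (ℤ.-[1+-injective eq))

  key≢0 : (z : Elt n) → key z ≢ 0ℤ
  key≢0 (false , _) ()
  key≢0 (true  , _) ()

  ±-cases : (z w : Elt n) → proj₂ z ≡ proj₂ w → z ≡ w ⊎ z ≡ neg w
  ±-cases (false , i) (false , .i) refl = inj₁ refl
  ±-cases (false , i) (true  , .i) refl = inj₂ refl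
  ±-cases (true  , i) (false , .i) refl = inj₂ refl
  ±-cases (true  , i) (true  , .i) refl = inj₁ refl

-- Signed permutations as odd maps

record Odd {n} (f : Elt n → Elt n) : Set where
  field
    odd : ∀ z → f (neg z) ≡ neg (f z)
    inj : ∀ {z w} → f z ≡ f w → z ≡ w
open Odd

Odd-∘ : ∀ {n} {f g : Elt n → Elt n} → Odd f → Odd g → Odd (f ∘ g)
Odd-∘ {f = f} {g} F G = record { odd = λ z → trans (cong f (odd G z)) (odd F (g z)) ; inj = λ eq → inj G (inj F eq) }

module _ {n : ℕ} where

  act-lookup : (π : W n) (b : Bool) (i : Fin n) → act π (b , i) ≡ (b xor proj₁ (lookup π i) , proj₂ (lookup π i))
  act-lookup π b i with lookup π i
  ... | c , j = refl

  act-false : (π : W n) (i : Fin n) → act π (false , i) ≡ lookup π i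
  act-false π i = act-lookup π false i

  act-odd : (π : W n) → ∀ z → act π (neg z) ≡ neg (act π z)
  act-odd π (b , i) rewrite act-lookup π (not b) i | act-lookup π b i =
    cong (_, proj₂ (lookup π i)) (sym (Bool.not-distribˡ-xor b (proj₁ (lookup π i))))

  act-ext : {π σ : W n} → (∀ z → act π z ≡ act σ z) → π ≡ σ
  act-ext {π} {σ} h = begin
    π                    ≡⟨ tabulate∘lookup π ⟨
    tabulate (lookup π)  ≡⟨ tabulate-cong (λ i → trans (sym (act-false π i)) (trans (h (false , i)) (act-false σ i))) ⟩
    tabulate (lookup σ)  ≡⟨ tabulate∘lookup σ ⟩
    σ                    ∎
    where open ≡-Reasoning

  odd-ext : {f g : Elt n → Elt n} → (∀ z → f (neg z) ≡ neg (f z)) → (∀ z → g (neg z) ≡ neg (g z)) →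
            (∀ i → f (false , i) ≡ g (false , i)) → ∀ z → f z ≡ g z
  odd-ext f-odd g-odd h (false , i) = h i
  odd-ext f-odd g-odd h (true  , i) = trans (f-odd (false , i)) (trans (cong neg (h i)) (sym (g-odd (false , i))))

  act-∘ : (π σ : W n) → ∀ z → act (π ∘ˢ σ) z ≡ act π (act σ z)
  act-∘ π σ = odd-ext (act-odd (π ∘ˢ σ)) (λ z → trans (cong (act π) (act-odd σ z)) (act-odd π (act σ z)))
    (λ i → trans (act-false (π ∘ˢ σ) i) (trans (lookup-map i (act π) σ) (cong (act π) (sym (act-false σ i)))))

  ∘-assoc : (π σ τ : W n) → (π ∘ˢ σ) ∘ˢ τ ≡ π ∘ˢ (σ ∘ˢ τ)
  ∘-assoc π σ τ = act-ext λ z → begin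
    act ((π ∘ˢ σ) ∘ˢ τ) z       ≡⟨ act-∘ (π ∘ˢ σ) τ z ⟩
    act (π ∘ˢ σ) (act τ z)      ≡⟨ act-∘ π σ (act τ z) ⟩
    act π (act σ (act τ z))     ≡⟨ cong (act π) (act-∘ σ τ z) ⟨
    act π (act (σ ∘ˢ τ) z)      ≡⟨ act-∘ π (σ ∘ˢ τ) z ⟨
    act (π ∘ˢ (σ ∘ˢ τ)) z       ∎
    where open ≡-Reasoning

  act-id : ∀ z → act (idˢ {n}) z ≡ z
  act-id = odd-ext (act-odd idˢ) (λ _ → refl) (λ i → trans (act-false idˢ i) (lookup∘tabulate _ i))

  ∘-identityʳ : (π : W n) → π ∘ˢ idˢ ≡ π
  ∘-identityʳ π = act-ext λ z → trans (act-∘ π idˢ z) (cong (act π) (act-id z))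

  ∘-identityˡ : (π : W n) → idˢ ∘ˢ π ≡ π
  ∘-identityˡ π = act-ext λ z → trans (act-∘ idˢ π z) (act-id (act π z))

  vec : (Elt n → Elt n) → W n
  vec f = tabulate (λ i → f (false , i))

  act-vec : {f : Elt n → Elt n} → (∀ z → f (neg z) ≡ neg (f z)) → ∀ z → act (vec f) z ≡ f z
  act-vec {f} f-odd = odd-ext (act-odd (vec f)) f-odd (λ i → trans (act-false (vec f) i) (lookup∘tabulate _ i))

  Odd-act : {π : W n} → DistinctAbs π → Odd (act π)
  Odd-act {π} d = record { odd = act-odd π ; inj = inj′ }
    where
    index : ∀ z → proj₂ (act π z) ≡ proj₂ (lookup π (proj₂ z))
    index (b , i) = cong proj₂ (act-lookup π b i)
    inj′ : ∀ {z w} → act π z ≡ act π w → z ≡ w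
    inj′ {z} {w} eq with ±-cases z w (d (trans (sym (index z)) (trans (cong proj₂ eq) (index w))))
    ... | inj₁ h = h
    ... | inj₂ refl = contradiction (trans (sym eq) (act-odd π w)) (z≢neg (act π w))

  DistinctAbs-act : {π : W n} → (∀ {z w} → act π z ≡ act π w → z ≡ w) → DistinctAbs π
  DistinctAbs-act {π} inj {i} {j} eq with ±-cases (act π (false , i)) (act π (false , j))
      (trans (cong proj₂ (act-false π i)) (trans eq (cong proj₂ (sym (act-false π j)))))
  ... | inj₁ h = cong proj₂ (inj {false , i} {false , j} h)
  ... | inj₂ h = cong proj₂ (inj {false , i} {true , j} (trans h (sym (act-odd π (false , j)))))

module _ {n : ℕ} where

  -- Exchanges x with y and -x with -y. The cases overlap when y is x or -x; that the overlaps agree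
  -- (`trBy-unique`) lets a single definition serve transpositions, signed transpositions and sign
  -- changes (y = -x).
  data View (x y z : Elt n) : Set where
    isX   : z ≡ x → View x y z
    isY   : z ≡ y → View x y z
    isNX  : z ≡ neg x → View x y z
    isNY  : z ≡ neg y → View x y z
    other : z ≢ x → z ≢ y → z ≢ neg x → z ≢ neg y → View x y z

  view : ∀ x y z → View x y z
  view x y z with z ≟ᴱ x | z ≟ᴱ y | z ≟ᴱ neg x | z ≟ᴱ neg y
  ... | yes p | _     | _     | _     = isX p
  ... | no _  | yes p | _     | _     = isY p
  ... | no _  | no _  | yes p | _     = isNX p
  ... | no _  | no _  | no _  | yes p = isNY p
  ... | no a  | no b  | no c  | no d  = other a b c d

  trBy : ∀ {x y z} → View x y z → Elt n
  trBy {x} {y} {z} (isX _)         = y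
  trBy {x} {y} {z} (isY _)         = x
  trBy {x} {y} {z} (isNX _)        = neg y
  trBy {x} {y} {z} (isNY _)        = neg x
  trBy {x} {y} {z} (other _ _ _ _) = z

  trBy-unique : ∀ {x y z} (v w : View x y z) → trBy v ≡ trBy w
  trBy-unique (isX _) (isX _) = refl
  trBy-unique (isX p) (isY q) = trans (sym q) p
  trBy-unique {x} (isX p) (isNX q) = contradiction (trans (sym p) q) (z≢neg x)
  trBy-unique {x} {y} (isX p) (isNY q) = trans (sym (neg-neg y)) (cong neg (trans (sym q) p))
  trBy-unique (isY p) (isX q) = trans (sym q) p
  trBy-unique (isY p) (isY q) = refl
  trBy-unique {x} (isY p) (isNX q) = trans (sym (neg-neg x)) (cong neg (trans (sym q) p))
  trBy-unique {x} {y} (isY p) (isNY q) = contradiction (trans (sym p) q) (z≢neg y)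
  trBy-unique {x} (isNX p) (isX q) = contradiction (trans (sym q) p) (z≢neg x)
  trBy-unique {x} (isNX p) (isY q) = trans (cong neg (trans (sym q) p)) (neg-neg x)
  trBy-unique (isNX p) (isNX q) = refl
  trBy-unique (isNX p) (isNY q) = trans (sym q) p
  trBy-unique {x} {y} (isNY p) (isX q) = trans (cong neg (trans (sym q) p)) (neg-neg y)
  trBy-unique {x} {y} (isNY p) (isY q) = contradiction (trans (sym q) p) (z≢neg y)
  trBy-unique (isNY p) (isNX q) = trans (sym q) p
  trBy-unique (isNY p) (isNY q) = refl
  trBy-unique (other a b c d) (isX q)  = contradiction q a
  trBy-unique (other a b c d) (isY q)  = contradiction q b
  trBy-unique (other a b c d) (isNX q) = contradiction q c
  trBy-unique (other a b c d) (isNY q) = contradiction q d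
  trBy-unique (isX q)  (other a b c d) = contradiction q a
  trBy-unique (isY q)  (other a b c d) = contradiction q b
  trBy-unique (isNX q) (other a b c d) = contradiction q c
  trBy-unique (isNY q) (other a b c d) = contradiction q d
  trBy-unique (other _ _ _ _) (other _ _ _ _) = refl

  -- Opaque, so that goals keep the form `tr x y z` and a case is selected explicitly through
  -- `tr-by`.
  abstract

    tr : Elt n → Elt n → Elt n → Elt n
    tr x y z = trBy (view x y z)

    tr-by : ∀ {x y z} (v : View x y z) → tr x y z ≡ trBy v
    tr-by v = trBy-unique _ v

    tr-x : ∀ x y → tr x y x ≡ y
    tr-x x y = tr-by (isX refl)

    tr-y : ∀ x y → tr x y y ≡ x
    tr-y x y = tr-by (isY refl)

    tr-neg : ∀ x y z → tr x y (neg z) ≡ neg (tr x y z)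
    tr-neg x y z with view x y z
    ... | isX p  = tr-by (isNX (cong neg p))
    ... | isY p  = tr-by (isNY (cong neg p))
    ... | isNX p = trans (tr-by (isX (trans (cong neg p) (neg-neg x)))) (sym (neg-neg y))
    ... | isNY p = trans (tr-by (isY (trans (cong neg p) (neg-neg y)))) (sym (neg-neg x))
    ... | other a b c d = tr-by (other (λ h → c (flip h)) (λ h → d (flip h)) (a ∘ neg-injective) (b ∘ neg-injective))
      where
      flip : ∀ {w} → neg z ≡ w → z ≡ neg w
      flip h = trans (sym (neg-neg z)) (cong neg h)

    tr-involutive : ∀ x y z → tr x y (tr x y z) ≡ z
    tr-involutive x y z with view x y z
    ... | isX p  = trans (tr-y x y) (sym p)
    ... | isY p  = trans (tr-x x y) (sym p)
    ... | isNX p = trans (tr-by (isNY refl)) (sym p)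
    ... | isNY p = trans (tr-by (isNX refl)) (sym p)
    ... | other a b c d = tr-by (other a b c d)

    tr-injective : ∀ x y {z w} → tr x y z ≡ tr x y w → z ≡ w
    tr-injective x y {z} {w} eq = trans (sym (tr-involutive x y z)) (trans (cong (tr x y) eq) (tr-involutive x y w))

    Odd-tr : ∀ x y → Odd (tr x y)
    Odd-tr x y = record { odd = tr-neg x y ; inj = tr-injective x y }

    -- The conjugation rule for reflections, written as a commutation so that no inverse of `g` is
    -- called for.
    tr-conj : ∀ {g} → Odd g → ∀ x y z → g (tr x y z) ≡ tr (g x) (g y) (g z)
    tr-conj {g} G x y z with view x y z
    ... | isX p  = sym (tr-by (isX (cong g p)))
    ... | isY p  = sym (tr-by (isY (cong g p)))
    ... | isNX p = trans (odd G y) (sym (tr-by (isNX (trans (cong g p) (odd G x)))))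
    ... | isNY p = trans (odd G x) (sym (tr-by (isNY (trans (cong g p) (odd G y)))))
    ... | other a b c d = sym (tr-by (other (a ∘ inj G) (b ∘ inj G)
            (λ h → c (inj G (trans h (sym (odd G x))))) (λ h → d (inj G (trans h (sym (odd G y)))))))

    tr-comm : ∀ x y z → tr y x z ≡ tr x y z
    tr-comm x y z with view x y z
    ... | isX p  = tr-by (isY p)
    ... | isY p  = tr-by (isX p)
    ... | isNX p = tr-by (isNY p)
    ... | isNY p = tr-by (isNX p)
    ... | other a b c d = tr-by (other b a d c)

    tr-negs : ∀ x y z → tr (neg x) (neg y) z ≡ tr x y z
    tr-negs x y z with view x y z
    ... | isX p  = trans (tr-by (isNX (trans p (sym (neg-neg x))))) (neg-neg y)
    ... | isY p  = trans (tr-by (isNY (trans p (sym (neg-neg y))))) (neg-neg x)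
    ... | isNX p = tr-by (isX p)
    ... | isNY p = tr-by (isY p)
    ... | other a b c d = tr-by (other c d (λ h → a (trans h (neg-neg x))) (λ h → b (trans h (neg-neg y))))

  refl-vec : Elt n → Elt n → W n
  refl-vec x y = vec (tr x y)

  act-refl : ∀ x y z → act (refl-vec x y) z ≡ tr x y z
  act-refl x y = act-vec (tr-neg x y)

  act-∘-refl : ∀ π x y z → act (π ∘ˢ refl-vec x y) z ≡ act π (tr x y z)
  act-∘-refl π x y z = trans (act-∘ π (refl-vec x y) z) (cong (act π) (act-refl x y z))

-- Inversions

⟦_⟧ : Bool → ℕ
⟦ b ⟧ = if b then 1 else 0

_<ᵇ_ : ℤ → ℤ → Bool
a <ᵇ b = does (a ℤ.<? b)

<ᵇ-true : ∀ {a b} → a ℤ.< b → (a <ᵇ b) ≡ true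
<ᵇ-true {a} {b} = dec-true (a ℤ.<? b)

<ᵇ-false : ∀ {a b} → ¬ (a ℤ.< b) → (a <ᵇ b) ≡ false
<ᵇ-false {a} {b} = dec-false (a ℤ.<? b)

<ᵇ-sound : ∀ a b → (a <ᵇ b) ≡ true → a ℤ.< b
<ᵇ-sound a b eq with a ℤ.<? b
... | yes p = p
... | no _ with () ← eq

<ᵇ-flip : ∀ {a b} → a ≢ b → (b <ᵇ a) ≡ not (a <ᵇ b)
<ᵇ-flip {a} {b} a≢b with ℤ.<-cmp a b
... | tri< h _ ¬h rewrite <ᵇ-true h | <ᵇ-false ¬h = refl
... | tri≈ _ h _  = contradiction h a≢b
... | tri> ¬h _ h rewrite <ᵇ-true h | <ᵇ-false ¬h = refl

<ᵇ-cong : ∀ {a b c d} → (a ℤ.< b → c ℤ.< d) → (c ℤ.< d → a ℤ.< b) → (a <ᵇ b) ≡ (c <ᵇ d)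
<ᵇ-cong {a} {b} {c} {d} f g = does-⇔ (mk⇔ f g) (a ℤ.<? b) (c ℤ.<? d)

<ᵇ-trans : ∀ {a b} → a ℤ.< b → ∀ c → (b <ᵇ c) ≡ true → (a <ᵇ c) ≡ true
<ᵇ-trans {a} {b} lt c eq = <ᵇ-true (ℤ.<-trans lt (<ᵇ-sound b c eq))

-- The box is half-open: u = y and fu = fy pass the test. In this form `swap-law` is a Boolean
-- identity for every u, and `boxᵇ-true` removes the boundary afterwards.
boxᵇ : (x y u fx fy fu : ℤ) → Bool
boxᵇ x y u fx fy fu = (x <ᵇ u) ∧ not (y <ᵇ u) ∧ (fx <ᵇ fu) ∧ not (fy <ᵇ fu)

-- Exchanging the values at two corners of a box adds two inversions for every point
-- inside the box; it applies to the origin as well.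
swap-law : ∀ {x y u fx fy fu} → x ℤ.< y → fx ℤ.< fy →
  ⟦ (x <ᵇ u) xor (fy <ᵇ fu) ⟧ + ⟦ (y <ᵇ u) xor (fx <ᵇ fu) ⟧ ≡
  ⟦ (x <ᵇ u) xor (fx <ᵇ fu) ⟧ + ⟦ (y <ᵇ u) xor (fy <ᵇ fu) ⟧ + 2 * ⟦ boxᵇ x y u fx fy fu ⟧
swap-law {x} {y} {u} {fx} {fy} {fu} x<y fx<fy
  with x <ᵇ u | y <ᵇ u | fx <ᵇ fu | fy <ᵇ fu
     | <ᵇ-trans x<y u | <ᵇ-trans fx<fy fu
... | false | true  | _     | _     | h | _ = case h refl of λ ()
... | _     | _     | false | true  | _ | h = case h refl of λ ()
... | true  | true  | true  | true  | _ | _ = refl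
... | true  | true  | true  | false | _ | _ = refl
... | true  | true  | false | false | _ | _ = refl
... | true  | false | true  | true  | _ | _ = refl
... | true  | false | true  | false | _ | _ = refl
... | true  | false | false | false | _ | _ = refl
... | false | false | true  | true  | _ | _ = refl
... | false | false | true  | false | _ | _ = refl
... | false | false | false | false | _ | _ = refl

boxᵇ-true : ∀ {x y u fx fy fu} → u ≢ y → fu ≢ fy → boxᵇ x y u fx fy fu ≡ true →
  (x ℤ.< u × u ℤ.< y) × (fx ℤ.< fu × fu ℤ.< fy)
boxᵇ-true {x} {y} {u} {fx} {fy} {fu} u≢y fu≢fy eq with x ℤ.<? u | y ℤ.<? u | fx ℤ.<? fu | fy ℤ.<? fu
... | yes a | no b | yes c | no d = (a , ℤ.≤∧≢⇒< (ℤ.≮⇒≥ b) u≢y) , (c , ℤ.≤∧≢⇒< (ℤ.≮⇒≥ d) fu≢fy)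
... | no _  | _     | _     | _     with () ← eq
... | yes _ | yes _ | _     | _     with () ← eq
... | yes _ | no _  | no _  | _     with () ← eq
... | yes _ | no _  | yes _ | yes _ with () ← eq

module _ {n : ℕ} (f : Elt n → Elt n) where

  inv : Elt n → Elt n → Bool
  inv z w = (key z <ᵇ key w) xor (key (f z) <ᵇ key (f w))

  inv₀ : Elt n → Bool
  inv₀ z = (key z <ᵇ 0ℤ) xor (key (f z) <ᵇ 0ℤ)

  -- len counts the inversions of f on ±[n] up to sign, where the origin counts as a
  -- further point (inv₀): for signed permutations this is the Coxeter length.
  lenBy : ∀ i j → Tri (i F.< j) (i ≡ j) (j F.< i) → ℕ
  lenBy i j (tri< _ _ _) = ⟦ inv (false , i) (false , j) ⟧
  lenBy i j (tri≈ _ _ _) = ⟦ inv₀ (false , i) ⟧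
  lenBy i j (tri> _ _ _) = ⟦ inv (true , i) (false , j) ⟧

  lenMatrix : Fin n → Fin n → ℕ
  lenMatrix i j = lenBy i j (F.<-cmp i j)

  len : ℕ
  len = total lenMatrix

  pairInv : Elt n → Fin n → ℕ
  pairInv x r = ⟦ inv x (false , r) ⟧ + ⟦ inv x (true , r) ⟧

xor-not-not : ∀ a b → not a xor not b ≡ a xor b
xor-not-not true  true  = refl
xor-not-not true  false = refl
xor-not-not false true  = refl
xor-not-not false false = refl

module _ {n : ℕ} where

  <ᵇ-neg : ∀ (z w : Elt n) → (key (neg z) <ᵇ key (neg w)) ≡ (key w <ᵇ key z)
  <ᵇ-neg z w rewrite key-neg z | key-neg w = <ᵇ-cong {c = key w} {key z} ℤ.neg-cancel-< ℤ.neg-mono-<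

  <ᵇ-neg₀ : ∀ (z : Elt n) → (key (neg z) <ᵇ 0ℤ) ≡ not (key z <ᵇ 0ℤ)
  <ᵇ-neg₀ (false , _) = refl
  <ᵇ-neg₀ (true  , _) = refl

  index≢ : ∀ {z w : Elt n} → proj₂ z ≢ proj₂ w → z ≢ w
  index≢ h refl = h refl

module _ {n : ℕ} {f : Elt n → Elt n} (odd-f : Odd f) where
  private
    f-neg = odd odd-f
    f-inj = inj odd-f

  inv-sym : ∀ z w → z ≢ w → inv f z w ≡ inv f w z
  inv-sym z w z≢w rewrite <ᵇ-flip {key w} {key z} (λ h → z≢w (sym (key-injective h)))
                            | <ᵇ-flip {key (f w)} {key (f z)} (λ h → z≢w (sym (f-inj (key-injective h)))) =
    xor-not-not (key w <ᵇ key z) (key (f w) <ᵇ key (f z))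

  inv-neg : ∀ z w → z ≢ w → inv f (neg z) (neg w) ≡ inv f z w
  inv-neg z w z≢w rewrite f-neg z | f-neg w | <ᵇ-neg z w | <ᵇ-neg (f z) (f w) = inv-sym w z (z≢w ∘ sym)

  inv₀-neg : ∀ z → inv₀ f (neg z) ≡ inv₀ f z
  inv₀-neg z rewrite f-neg z | <ᵇ-neg₀ z | <ᵇ-neg₀ (f z) = xor-not-not (key z <ᵇ 0ℤ) (key (f z) <ᵇ 0ℤ)

  len-diag : ∀ x → lenMatrix f (proj₂ x) (proj₂ x) ≡ ⟦ inv₀ f x ⟧
  len-diag (b , i) with F.<-cmp i i
  ... | tri< _ ≢ _ = contradiction refl ≢
  ... | tri> _ ≢ _ = contradiction refl ≢
  len-diag (false , i) | tri≈ _ _ _ = refl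
  len-diag (true  , i) | tri≈ _ _ _ = cong ⟦_⟧ (sym (inv₀-neg (false , i)))

  cross-len : ∀ {i j} → i ≢ j → cross (lenMatrix f) i j ≡ ⟦ inv f (false , i) (false , j) ⟧ + ⟦ inv f (true , i) (false , j) ⟧
  cross-len {i} {j} i≢j with F.<-cmp i j | F.<-cmp j i
  ... | tri≈ _ i≡j _ | _            = contradiction i≡j i≢j
  ... | _            | tri≈ _ j≡i _ = contradiction (sym j≡i) i≢j
  ... | tri< _ _ ¬a  | tri< a _ _   = contradiction a ¬a
  ... | tri> ¬a _ _  | tri> _ _ a   = contradiction a ¬a
  ... | tri< _ _ _   | tri> _ _ _   = cong (λ z → ⟦ inv f (false , i) (false , j) ⟧ + ⟦ z ⟧)
          (trans (inv-sym (true , j) (false , i) (i≢j ∘ sym ∘ cong proj₂)) (inv-neg (true , i) (false , j) (i≢j ∘ cong proj₂)))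
  ... | tri> _ _ _   | tri< _ _ _   = trans (ℕ.+-comm ⟦ inv f (true , i) (false , j) ⟧ _)
          (cong (λ z → ⟦ z ⟧ + ⟦ inv f (true , i) (false , j) ⟧) (inv-sym (false , j) (false , i) (i≢j ∘ sym ∘ cong proj₂)))

  -- Up to a common sign, {x, r} and {x, -r} are all the pairs over the two indices, whatever the
  -- sign of x. So the inversions can be read off at the corner x of a box instead of at its index.
  cross-pairInv : ∀ x r → proj₂ x ≢ r → cross (lenMatrix f) (proj₂ x) r ≡ pairInv f x r
  cross-pairInv (false , i) r h = trans (cross-len h)
    (cong (λ z → ⟦ inv f (false , i) (false , r) ⟧ + ⟦ z ⟧) (inv-neg (false , i) (true , r) (h ∘ cong proj₂)))
  cross-pairInv (true , i) r h = trans (cross-len h) (trans (ℕ.+-comm ⟦ inv f (false , i) (false , r) ⟧ _)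
    (cong (λ z → ⟦ inv f (true , i) (false , r) ⟧ + ⟦ z ⟧) (inv-neg (true , i) (true , r) (h ∘ cong proj₂))))

  pairInv-± : ∀ x y → pairInv f x (proj₂ y) ≡ ⟦ inv f x y ⟧ + ⟦ inv f x (neg y) ⟧
  pairInv-± x (false , j) = refl
  pairInv-± x (true  , j) = ℕ.+-comm ⟦ inv f x (false , j) ⟧ _

len-cong : ∀ {n} {f g : Elt n → Elt n} → (∀ z → f z ≡ g z) → len f ≡ len g
len-cong {n} {f} {g} h = sum-cong-≗ {n} (λ i → sum-cong-≗ {n} (λ j → entry i j))
  where
  entry : ∀ i j → lenMatrix f i j ≡ lenMatrix g i j
  entry i j with F.<-cmp i j
  ... | tri< _ _ _ rewrite h (false , i) | h (false , j) = refl
  ... | tri≈ _ _ _ rewrite h (false , i) = refl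
  ... | tri> _ _ _ rewrite h (true , i) | h (false , j) = refl

lenMatrix-cong : ∀ {n} {f g : Elt n → Elt n} i j → (∀ b → f (b , i) ≡ g (b , i)) → (∀ b → f (b , j) ≡ g (b , j)) →
  lenMatrix f i j ≡ lenMatrix g i j
lenMatrix-cong i j hi hj with F.<-cmp i j
... | tri< _ _ _ rewrite hi false | hj false = refl
... | tri≈ _ _ _ rewrite hi false = refl
... | tri> _ _ _ rewrite hi true | hj false = refl

InBox : ∀ {n} (f : Elt n → Elt n) (x y z : Elt n) → Set
InBox f x y z = (key x ℤ.< key z × key z ℤ.< key y) × (key (f x) ℤ.< key (f z) × key (f z) ℤ.< key (f y))

Origin : ∀ {n} (f : Elt n → Elt n) (x y : Elt n) → Set
Origin f x y = (key x ℤ.< 0ℤ × 0ℤ ℤ.< key y) × (key (f x) ℤ.< 0ℤ × 0ℤ ℤ.< key (f y))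

record Clear {n} (f : Elt n → Elt n) (x y : Elt n) : Set where
  constructor clear
  field
    origin : y ≡ neg x ⊎ ¬ Origin f x y
    empty  : ∀ z → ¬ InBox f x y z

-- `tight` goes from empty boxes to excess 0 only; that a cover has an empty box is obtained from
-- chains in the Bruhat order instead.
record LenChange {n} (f : Elt n → Elt n) (x y : Elt n) : Set where
  field
    excess  : ℕ
    formula : len (f ∘ tr x y) ≡ len f + (1 + 2 * excess)
    tight   : Clear f x y → excess ≡ 0

module _ {n} {f : Elt n → Elt n} (odd-f : Odd f) {x y : Elt n} (x<y : key x ℤ.< key y) (fx<fy : key (f x) ℤ.< key (f y)) where
  private
    f′ = f ∘ tr x y
    odd-f′ : Odd f′
    odd-f′ = Odd-∘ odd-f (Odd-tr x y)

  box : Elt n → Bool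
  box z = boxᵇ (key x) (key y) (key z) (key (f x)) (key (f y)) (key (f z))

  box₀ : Bool
  box₀ = boxᵇ (key x) (key y) 0ℤ (key (f x)) (key (f y)) 0ℤ

  f′x : f′ x ≡ f y
  f′x = cong f (tr-x x y)

  f′y : f′ y ≡ f x
  f′y = cong f (tr-y x y)

  f′-fix : ∀ {z} → proj₂ z ≢ proj₂ x → proj₂ z ≢ proj₂ y → f′ z ≡ f z
  f′-fix h k = cong f (tr-by (other (h ∘ cong proj₂) (k ∘ cong proj₂) (h ∘ cong proj₂) (k ∘ cong proj₂)))

  swap-inv : ∀ {z} → proj₂ z ≢ proj₂ x → proj₂ z ≢ proj₂ y →
    ⟦ inv f′ x z ⟧ + ⟦ inv f′ y z ⟧ ≡ ⟦ inv f x z ⟧ + ⟦ inv f y z ⟧ + 2 * ⟦ box z ⟧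
  swap-inv {z} h k rewrite f′x | f′y | f′-fix {z} h k = swap-law x<y fx<fy

  swap-inv₀ : ⟦ inv₀ f′ x ⟧ + ⟦ inv₀ f′ y ⟧ ≡ ⟦ inv₀ f x ⟧ + ⟦ inv₀ f y ⟧ + 2 * ⟦ box₀ ⟧
  swap-inv₀ rewrite f′x | f′y = swap-law x<y fx<fy

  inv-own : inv f x y ≡ false
  inv-own rewrite <ᵇ-true x<y | <ᵇ-true fx<fy = refl

  inv′-own : inv f′ x y ≡ true
  inv′-own rewrite f′x | f′y | <ᵇ-true x<y | <ᵇ-false (ℤ.<-asym fx<fy) = refl

  -- f y < - f x and f x < - f y are the same inequality.
  inv-own-neg : inv f′ x (neg y) ≡ inv f x (neg y)
  inv-own-neg rewrite odd odd-f′ y | f′x | f′y | odd odd-f y | key-neg (f x) | key-neg (f y) =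
    cong ((key x <ᵇ key (neg y)) xor_) (<ᵇ-cong {key (f y)} {c = key (f x)} neg-flip neg-flip)

  empty-box : (∀ z → ¬ InBox f x y z) → ∀ {z} → z ≢ y → box z ≡ false
  empty-box h {z} z≢y with box z in eq
  ... | false = refl
  ... | true  = ⊥-elim (h z (boxᵇ-true (λ e → z≢y (key-injective e)) (λ e → z≢y (inj odd-f (key-injective e))) eq))

  empty-box₀ : ¬ Origin f x y → box₀ ≡ false
  empty-box₀ h with box₀ in eq
  ... | false = refl
  ... | true  = ⊥-elim (h (boxᵇ-true (λ e → key≢0 y (sym e)) (λ e → key≢0 (f y) (sym e)) eq))

sum-zero : ∀ {n} {g : Fin n → ℕ} → (∀ i → g i ≡ 0) → sum g ≡ 0
sum-zero {zero}  h = refl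
sum-zero {suc n} h = cong₂ _+_ (h zero) (sum-zero (h ∘ suc))

sum-*2 : ∀ {n} (g : Fin n → ℕ) → sum (λ i → 2 * g i) ≡ 2 * sum g
sum-*2 {zero}  g = refl
sum-*2 {suc n} g = trans (cong (2 * g zero +_) (sum-*2 (g ∘ suc))) (sym (ℕ.*-distribˡ-+ 2 (g zero) _))

-- The inversion with the origin accounts for the 1: the diagonal entry rises from 0 to 1. The box
-- is symmetric about the origin, so its points are counted once for each pair ±r.
len-flip : ∀ {n} {f : Elt n → Elt n} → Odd f → ∀ x → key x ℤ.< key (neg x) → key (f x) ℤ.< key (f (neg x)) → LenChange f x (neg x)
len-flip {suc n} {f} odd-f x x<y fx<fy = record
  { excess  = sum box↑
  ; formula = begin
      len f′
        ≡⟨ total-remove (lenMatrix f′) a ⟩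
      (lenMatrix f′ a a + sum (λ r → cross (lenMatrix f′) a (↑ r))) + total (minor a (lenMatrix f′))
        ≡⟨ cong₂ _+_ (cong₂ _+_ diag′ (sum-cong-≗ {n} rows)) (sum-cong-≗ {n} (λ i → sum-cong-≗ {n} (λ j →
             lenMatrix-cong (↑ i) (↑ j) (λ b → fix i b) (λ b → fix j b)))) ⟩
      (1 + sum (λ r → cross (lenMatrix f) a (↑ r) + 2 * box↑ r)) + total (minor a (lenMatrix f))
        ≡⟨ cong (λ z → 1 + z + total (minor a (lenMatrix f)))
             (trans (∑-distrib-+ {n} (λ r → cross (lenMatrix f) a (↑ r)) _) (cong (sum (λ r → cross (lenMatrix f) a (↑ r)) +_) (sum-*2 box↑))) ⟩
      1 + (sum (λ r → cross (lenMatrix f) a (↑ r)) + 2 * sum box↑) + total (minor a (lenMatrix f))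
        ≡⟨ rearr (sum (λ r → cross (lenMatrix f) a (↑ r))) (sum box↑) _ ⟩
      (0 + sum (λ r → cross (lenMatrix f) a (↑ r))) + total (minor a (lenMatrix f)) + (1 + 2 * sum box↑)
        ≡⟨ cong (λ z → (z + sum (λ r → cross (lenMatrix f) a (↑ r))) + total (minor a (lenMatrix f)) + (1 + 2 * sum box↑)) diag ⟨
      (lenMatrix f a a + sum (λ r → cross (lenMatrix f) a (↑ r))) + total (minor a (lenMatrix f)) + (1 + 2 * sum box↑)
        ≡⟨ cong (_+ (1 + 2 * sum box↑)) (total-remove (lenMatrix f) a) ⟨
      len f + (1 + 2 * sum box↑) ∎
  ; tight = λ c → sum-zero (λ r → cong ⟦_⟧ (empty-box odd-f x<y fx<fy (Clear.empty c) (index≢ (F.punchInᵢ≢i a r))))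
  }
  where
  open ≡-Reasoning
  a = proj₂ x
  y = neg x
  f′ = f ∘ tr x y
  odd-f′ : Odd f′
  odd-f′ = Odd-∘ odd-f (Odd-tr x y)
  ↑ = punchIn a
  box↑ : Fin n → ℕ
  box↑ r = ⟦ box odd-f x<y fx<fy (false , ↑ r) ⟧
  rearr : ∀ s b t → 1 + (s + 2 * b) + t ≡ (0 + s) + t + (1 + 2 * b)
  rearr = solve-∀
  fix : ∀ i b → f′ (b , ↑ i) ≡ f (b , ↑ i)
  fix i b = f′-fix odd-f x<y fx<fy (F.punchInᵢ≢i a i) (F.punchInᵢ≢i a i)
  negative : ∀ {z : Elt (suc n)} → key z ℤ.< key (neg z) → key z ℤ.< 0ℤ
  negative {false , _} ()
  negative {true  , _} _ = ℤ.-<+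
  fx<0 : key (f x) ℤ.< 0ℤ
  fx<0 = negative (subst (λ z → key (f x) ℤ.< key z) (odd odd-f x) fx<fy)
  diag : lenMatrix f a a ≡ 0
  diag = trans (len-diag odd-f x) (cong₂ (λ b c → ⟦ b xor c ⟧) (<ᵇ-true (negative x<y)) (<ᵇ-true fx<0))
  diag′ : lenMatrix f′ a a ≡ 1
  diag′ = trans (len-diag odd-f′ x) (cong₂ (λ b c → ⟦ b xor c ⟧) (<ᵇ-true (negative x<y))
    (trans (cong (λ z → key z <ᵇ 0ℤ) (trans (cong f (tr-x x y)) (odd odd-f x)))
      (trans (<ᵇ-neg₀ (f x)) (cong not (<ᵇ-true fx<0)))))
  two : ∀ {g : Elt (suc n) → Elt (suc n)} → Odd g → ∀ r → cross (lenMatrix g) a (↑ r) ≡ ⟦ inv g x (false , ↑ r) ⟧ + ⟦ inv g y (false , ↑ r) ⟧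
  two {g} G r = trans (cross-pairInv G x (↑ r) (F.punchInᵢ≢i a r ∘ sym))
    (cong (λ z → ⟦ inv g x (false , ↑ r) ⟧ + ⟦ z ⟧) (sym (inv-neg G x (true , ↑ r) (index≢ (F.punchInᵢ≢i a r ∘ sym)))))
  rows : ∀ r → cross (lenMatrix f′) a (↑ r) ≡ cross (lenMatrix f) a (↑ r) + 2 * box↑ r
  rows r = trans (two odd-f′ r) (trans (swap-inv odd-f x<y fx<fy {false , ↑ r} (F.punchInᵢ≢i a r) (F.punchInᵢ≢i a r))
    (cong (_+ 2 * box↑ r) (sym (two odd-f r))))

-- The pair {x, y} becomes an inversion and {x, -y} keeps its status, which accounts for the 1. The
-- two diagonal entries obey `swap-law` at the origin, the rows obey it at the points ±r, and pairs
-- avoiding both indices do not change.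
len-swap₂ : ∀ {n} {f : Elt (2 + n) → Elt (2 + n)} → Odd f → ∀ x y → proj₂ x ≢ proj₂ y →
  key x ℤ.< key y → key (f x) ℤ.< key (f y) → LenChange f x y
len-swap₂ {n} {f} odd-f x y a≢b x<y fx<fy = record
  { excess  = B
  ; formula = begin
      len f′
        ≡⟨ total-remove₂ (lenMatrix f′) a b′ ⟩
      (lenMatrix f′ a a + lenMatrix f′ q q + cross (lenMatrix f′) a q + sum (rows′ f′)) + rest f′
        ≡⟨ cong₂ _+_ (cong₂ _+_ (cong₂ _+_ diags own) (trans (sum-cong-≗ {n} rows) sumrows)) rest-eq ⟩
      (lenMatrix f a a + lenMatrix f q q + 2 * ⟦ b₀ ⟧) + (1 + cross (lenMatrix f) a q) + (sum (rows′ f) + 2 * sum box↑) + rest f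
        ≡⟨ rearr (lenMatrix f a a + lenMatrix f q q) ⟦ b₀ ⟧ (cross (lenMatrix f) a q) (sum (rows′ f)) (sum box↑) (rest f) ⟩
      (lenMatrix f a a + lenMatrix f q q + cross (lenMatrix f) a q + sum (rows′ f)) + rest f + (1 + 2 * B)
        ≡⟨ cong (_+ (1 + 2 * B)) (total-remove₂ (lenMatrix f) a b′) ⟨
      len f + (1 + 2 * B) ∎
  ; tight = λ c → cong₂ _+_
      (cong ⟦_⟧ (empty-box₀ odd-f x<y fx<fy ([ (λ h → contradiction (sym (cong proj₂ h)) a≢b) , id ]′ (Clear.origin c))))
      (sum-zero (λ r → cong₂ _+_ (cong ⟦_⟧ (empty-box odd-f x<y fx<fy (Clear.empty c) (index≢ (↑≢b r))))
                                 (cong ⟦_⟧ (empty-box odd-f x<y fx<fy (Clear.empty c) (index≢ (↑≢b r))))))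
  }
  where
  open ≡-Reasoning
  a = proj₂ x
  b = proj₂ y
  b′ = punchOut a≢b
  q = punchIn a b′
  q≡b : q ≡ b
  q≡b = F.punchIn-punchOut a≢b
  ↑ : Fin n → Fin (2 + n)
  ↑ r = punchIn a (punchIn b′ r)
  ↑≢a : ∀ r → ↑ r ≢ a
  ↑≢a r = F.punchInᵢ≢i a _
  ↑≢b : ∀ r → ↑ r ≢ b
  ↑≢b r h = F.punchInᵢ≢i b′ r (F.punchIn-injective a _ _ (trans h (sym q≡b)))
  f′ = f ∘ tr x y
  odd-f′ : Odd f′
  odd-f′ = Odd-∘ odd-f (Odd-tr x y)
  rows′ : (Elt (2 + n) → Elt (2 + n)) → Fin n → ℕ
  rows′ g r = cross (lenMatrix g) a (↑ r) + cross (lenMatrix g) q (↑ r)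
  rest : (Elt (2 + n) → Elt (2 + n)) → ℕ
  rest g = total (minor b′ (minor a (lenMatrix g)))
  box′ : Elt (2 + n) → Bool
  box′ = box odd-f x<y fx<fy
  b₀ : Bool
  b₀ = box₀ odd-f x<y fx<fy
  box↑ : Fin n → ℕ
  box↑ r = ⟦ box′ (false , ↑ r) ⟧ + ⟦ box′ (true , ↑ r) ⟧
  B = ⟦ b₀ ⟧ + sum box↑
  rearr : ∀ d b₀ c s t r → (d + 2 * b₀) + (1 + c) + (s + 2 * t) + r ≡ (d + c + s) + r + (1 + 2 * (b₀ + t))
  rearr = solve-∀
  diag-q : ∀ {g} → Odd g → lenMatrix g q q ≡ ⟦ inv₀ g y ⟧
  diag-q {g} G = trans (cong (λ z → lenMatrix g z z) q≡b) (len-diag G y)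
  diags : lenMatrix f′ a a + lenMatrix f′ q q ≡ lenMatrix f a a + lenMatrix f q q + 2 * ⟦ b₀ ⟧
  diags = trans (cong₂ _+_ (len-diag odd-f′ x) (diag-q odd-f′)) (trans (swap-inv₀ odd-f x<y fx<fy)
    (cong (_+ 2 * ⟦ b₀ ⟧) (sym (cong₂ _+_ (len-diag odd-f x) (diag-q odd-f)))))
  cross-q : ∀ {g} → Odd g → cross (lenMatrix g) a q ≡ ⟦ inv g x y ⟧ + ⟦ inv g x (neg y) ⟧
  cross-q {g} G = trans (cong (cross (lenMatrix g) a) q≡b) (trans (cross-pairInv G x b a≢b) (pairInv-± G x y))
  own : cross (lenMatrix f′) a q ≡ 1 + cross (lenMatrix f) a q
  own = trans (cross-q odd-f′) (trans (cong₂ (λ s t → ⟦ s ⟧ + ⟦ t ⟧) (inv′-own odd-f x<y fx<fy) (inv-own-neg odd-f x<y fx<fy))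
    (cong suc (sym (trans (cross-q odd-f) (cong (λ s → ⟦ s ⟧ + ⟦ inv f x (neg y) ⟧) (inv-own odd-f x<y fx<fy))))))
  rows-pair : ∀ {g} → Odd g → ∀ r → rows′ g r ≡ pairInv g x (↑ r) + pairInv g y (↑ r)
  rows-pair {g} G r = cong₂ _+_ (cross-pairInv G x (↑ r) (↑≢a r ∘ sym))
    (trans (cong (λ z → cross (lenMatrix g) z (↑ r)) q≡b) (cross-pairInv G y (↑ r) (↑≢b r ∘ sym)))
  interchange : ∀ a b c d → (a + b) + (c + d) ≡ (a + c) + (b + d)
  interchange = solve-∀
  collect : ∀ a c u b d v → (a + c + 2 * u) + (b + d + 2 * v) ≡ (a + b) + (c + d) + 2 * (u + v)
  collect = solve-∀
  rows : ∀ r → rows′ f′ r ≡ rows′ f r + 2 * box↑ r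
  rows r = begin
    rows′ f′ r
      ≡⟨ rows-pair odd-f′ r ⟩
    pairInv f′ x (↑ r) + pairInv f′ y (↑ r)
      ≡⟨ interchange ⟦ inv f′ x (false , ↑ r) ⟧ _ _ _ ⟩
    (⟦ inv f′ x (false , ↑ r) ⟧ + ⟦ inv f′ y (false , ↑ r) ⟧) + (⟦ inv f′ x (true , ↑ r) ⟧ + ⟦ inv f′ y (true , ↑ r) ⟧)
      ≡⟨ cong₂ _+_ (swap-inv odd-f x<y fx<fy {false , ↑ r} (↑≢a r) (↑≢b r)) (swap-inv odd-f x<y fx<fy {true , ↑ r} (↑≢a r) (↑≢b r)) ⟩
    (⟦ inv f x (false , ↑ r) ⟧ + ⟦ inv f y (false , ↑ r) ⟧ + 2 * ⟦ box′ (false , ↑ r) ⟧) + (⟦ inv f x (true , ↑ r) ⟧ + ⟦ inv f y (true , ↑ r) ⟧ + 2 * ⟦ box′ (true , ↑ r) ⟧)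
      ≡⟨ collect ⟦ inv f x (false , ↑ r) ⟧ _ ⟦ box′ (false , ↑ r) ⟧ _ _ _ ⟩
    (pairInv f x (↑ r) + pairInv f y (↑ r)) + 2 * box↑ r
      ≡⟨ cong (_+ 2 * box↑ r) (rows-pair odd-f r) ⟨
    rows′ f r + 2 * box↑ r ∎
  sumrows : sum (λ r → rows′ f r + 2 * box↑ r) ≡ sum (rows′ f) + 2 * sum box↑
  sumrows = trans (∑-distrib-+ {n} (rows′ f) _) (cong (sum (rows′ f) +_) (sum-*2 box↑))
  fix : ∀ i b → f′ (b , ↑ i) ≡ f (b , ↑ i)
  fix i b = f′-fix odd-f x<y fx<fy (↑≢a i) (↑≢b i)
  rest-eq : rest f′ ≡ rest f
  rest-eq = sum-cong-≗ {n} (λ i → sum-cong-≗ {n} (λ j → lenMatrix-cong (↑ i) (↑ j) (fix i) (fix j)))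

len-swap : ∀ {n} {f : Elt n → Elt n} → Odd f → ∀ {x y} → key x ℤ.< key y → key (f x) ℤ.< key (f y) → LenChange f x y
len-swap {n} odd-f {x} {y} x<y fx<fy with proj₂ x F.≟ proj₂ y
len-swap {n} odd-f {x} {y} x<y fx<fy | yes eq with ±-cases y x (sym eq)
... | inj₁ refl = contradiction x<y (ℤ.<-irrefl refl)
... | inj₂ refl = len-flip odd-f x x<y fx<fy
len-swap {suc zero} odd-f {_ , zero} {_ , zero} x<y fx<fy | no a≢b = contradiction refl a≢b
len-swap {suc (suc n)} odd-f {x} {y} x<y fx<fy | no a≢b = len-swap₂ odd-f x y a≢b x<y fx<fy

-- Coxeter length

simple : ∀ {n} → Fin n → Elt n × Elt n
simple zero    = (true , zero) , (false , zero)
simple (suc i) = (false , F.inject₁ i) , (false , suc i)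

low high : ∀ {n} → Fin n → Elt n
low  = proj₁ ∘ simple
high = proj₂ ∘ simple

low<high : ∀ {n} (s : Fin n) → key (low s) ℤ.< key (high s)
low<high zero    = ℤ.-<+
low<high (suc i) = ℤ.+<+ (s≤s (s≤s (ℕ.≤-reflexive (F.toℕ-inject₁ i))))

act-gen : ∀ {n} (s : Fin n) z → act (gen s) z ≡ tr (low s) (high s) z
act-gen {suc m} s = odd-ext (act-odd (gen s)) (tr-neg (low s) (high s)) (λ i → trans (act-false (gen s) i) (entry s i))
  where
  entry : ∀ s i → lookup (gen s) i ≡ tr (low s) (high s) (false , i)
  entry zero zero    = sym (tr-y _ _)
  entry zero (suc i) = trans (lookup∘tabulate (λ k → (does (k F.≟ zero) , k)) (suc i)) (sym (tr-by (other (λ ()) (λ ()) (λ ()) (λ ()))))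
  entry (suc i) j = trans (lookup∘tabulate (λ k → (false , (if does (k F.≟ F.inject₁ i) then suc i else (if does (k F.≟ suc i) then F.inject₁ i else k)))) j) (swap-entry j (j F.≟ F.inject₁ i) (j F.≟ suc i))
    where
    swap-entry : ∀ j (p : Dec (j ≡ F.inject₁ i)) (q : Dec (j ≡ suc i)) →
      (false , (if does p then suc i else (if does q then F.inject₁ i else j))) ≡ tr (low (suc i)) (high (suc i)) (false , j)
    swap-entry j (yes refl) _          = sym (tr-x _ _)
    swap-entry j (no _)     (yes refl) = sym (tr-y _ _)
    swap-entry j (no a)     (no b)     = sym (tr-by (other (a ∘ cong proj₂) (b ∘ cong proj₂) (a ∘ cong proj₂) (b ∘ cong proj₂)))

low≢high : ∀ {n} (s : Fin n) → low s ≢ high s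
low≢high s eq = ℤ.<-irrefl (cong key eq) (low<high s)

-- The two positions are consecutive in ±[n], so the box is empty whatever the values are.
simple-clear : ∀ {n} (f : Elt n → Elt n) s → Clear f (low s) (high s)
simple-clear f zero = clear (inj₁ refl) empty
  where
  empty : ∀ z → ¬ InBox f (low zero) (high zero) z
  empty (false , i) ((_ , ℤ.+<+ (s≤s ())) , _)
  empty (true  , i) ((ℤ.-<- () , _) , _)
simple-clear f (suc s) = clear (inj₂ (λ { ((ℤ.+<+ () , _) , _) })) empty
  where
  empty : ∀ z → ¬ InBox f (low (suc s)) (high (suc s)) z
  empty (false , i) ((ℤ.+<+ (s≤s a) , ℤ.+<+ (s≤s b)) , _) =
    ℕ.<⇒≱ a (ℕ.≤-trans (ℕ.≤-pred b) (ℕ.≤-reflexive (sym (F.toℕ-inject₁ s))))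

module _ {n : ℕ} where

  DistinctAbs-∘ : {π σ : W n} → DistinctAbs π → DistinctAbs σ → DistinctAbs (π ∘ˢ σ)
  DistinctAbs-∘ {π} {σ} dπ dσ = DistinctAbs-act {π = π ∘ˢ σ} λ {z} {w} eq →
    inj (Odd-act {π = σ} dσ) (inj (Odd-act {π = π} dπ) (trans (sym (act-∘ π σ z)) (trans eq (act-∘ π σ w))))

  DistinctAbs-id : DistinctAbs (idˢ {n})
  DistinctAbs-id = DistinctAbs-act {π = idˢ} λ {z} {w} eq → trans (sym (act-id z)) (trans eq (act-id w))

  DistinctAbs-gen : (s : Fin n) → DistinctAbs (gen s)
  DistinctAbs-gen s = DistinctAbs-act {π = gen s} λ {z} {w} eq →
    tr-injective (low s) (high s) (trans (sym (act-gen s z)) (trans eq (act-gen s w)))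

  DistinctAbs-eval : (ws : List (Fin n)) → DistinctAbs (eval ws)
  DistinctAbs-eval []       = DistinctAbs-id
  DistinctAbs-eval (s ∷ ws) = DistinctAbs-∘ {gen s} {eval ws} (DistinctAbs-gen s) (DistinctAbs-eval ws)

  ℓ : W n → ℕ
  ℓ π = len (act π)

  act-∘-gen : ∀ (π : W n) s z → act (π ∘ˢ gen s) z ≡ act π (tr (low s) (high s) z)
  act-∘-gen π s z = trans (act-∘ π (gen s) z) (cong (act π) (act-gen s z))

  ∘-gen-gen : ∀ (π : W n) s → (π ∘ˢ gen s) ∘ˢ gen s ≡ π
  ∘-gen-gen π s = act-ext λ z → trans (act-∘-gen (π ∘ˢ gen s) s z)
    (trans (act-∘-gen π s _) (cong (act π) (tr-involutive (low s) (high s) z)))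

  gen-ascent : ∀ {π : W n} → DistinctAbs π → ∀ s → key (act π (low s)) ℤ.< key (act π (high s)) → ℓ (π ∘ˢ gen s) ≡ suc (ℓ π)
  gen-ascent {π} d s asc = begin
    ℓ (π ∘ˢ gen s)                       ≡⟨ len-cong (act-∘-gen π s) ⟩
    len (act π ∘ tr (low s) (high s))    ≡⟨ formula ⟩
    ℓ π + (1 + 2 * excess)               ≡⟨ cong (λ e → ℓ π + (1 + 2 * e)) (tight (simple-clear (act π) s)) ⟩
    ℓ π + 1                              ≡⟨ ℕ.+-comm (ℓ π) 1 ⟩
    suc (ℓ π)                            ∎
    where
    open ≡-Reasoning
    open LenChange (len-swap (Odd-act {π = π} d) (low<high s) asc)

  gen-descent : ∀ {π : W n} → DistinctAbs π → ∀ s → key (act π (high s)) ℤ.< key (act π (low s)) → ℓ π ≡ suc (ℓ (π ∘ˢ gen s))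
  gen-descent {π} d s desc = trans (cong ℓ (sym (∘-gen-gen π s)))
    (gen-ascent {π ∘ˢ gen s} (DistinctAbs-∘ {π} {gen s} d (DistinctAbs-gen s)) s
      (subst₂ ℤ._<_ (cong key (sym (trans (act-∘-gen π s (low s)) (cong (act π) (tr-x _ _)))))
                    (cong key (sym (trans (act-∘-gen π s (high s)) (cong (act π) (tr-y _ _))))) desc))

  gen-step : ∀ {π : W n} → DistinctAbs π → ∀ s → ℓ (π ∘ˢ gen s) ≤ suc (ℓ π)
  gen-step {π} d s with ℤ.<-cmp (key (act π (low s))) (key (act π (high s)))
  ... | tri< asc _ _  = ℕ.≤-reflexive (gen-ascent {π} d s asc)
  ... | tri≈ _ eq _   = contradiction (inj (Odd-act {π = π} d) (key-injective eq)) (low≢high s)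
  ... | tri> _ _ desc = ℕ.≤-trans (ℕ.n≤1+n _) (ℕ.≤-trans (ℕ.≤-reflexive (sym (gen-descent {π} d s desc))) (ℕ.n≤1+n _))

  ℓ-word : ∀ ws {π : W n} → DistinctAbs π → ℓ (π ∘ˢ eval ws) ≤ ℓ π + length ws
  ℓ-word []       {π} d = ℕ.≤-reflexive (trans (cong ℓ (∘-identityʳ π)) (sym (ℕ.+-identityʳ _)))
  ℓ-word (s ∷ ws) {π} d = begin
    ℓ (π ∘ˢ (gen s ∘ˢ eval ws))      ≡⟨ cong ℓ (∘-assoc π (gen s) (eval ws)) ⟨
    ℓ ((π ∘ˢ gen s) ∘ˢ eval ws)      ≤⟨ ℓ-word ws {π ∘ˢ gen s} (DistinctAbs-∘ {π} {gen s} d (DistinctAbs-gen s)) ⟩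
    ℓ (π ∘ˢ gen s) + length ws       ≤⟨ ℕ.+-monoˡ-≤ (length ws) (gen-step {π} d s) ⟩
    suc (ℓ π) + length ws            ≡⟨ ℕ.+-suc (ℓ π) (length ws) ⟨
    ℓ π + suc (length ws)            ∎
    where open ℕ.≤-Reasoning

  ℓ-id : ℓ (idˢ {n}) ≡ 0
  ℓ-id = trans (len-cong {f = act (idˢ {n})} {id} act-id) (sum-zero {n} (λ i → sum-zero {n} (entry i)))
    where
    entry : ∀ i j → lenMatrix {n} id i j ≡ 0
    entry i j with F.<-cmp i j
    ... | tri< _ _ _ = cong ⟦_⟧ (Bool.xor-same (key {n} (false , i) <ᵇ key {n} (false , j)))
    ... | tri≈ _ _ _ = refl
    ... | tri> _ _ _ = refl

  ℓ≤length : ∀ ws → ℓ (eval ws) ≤ length ws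
  ℓ≤length ws = ℕ.≤-trans (ℕ.≤-reflexive (cong ℓ (sym (∘-identityˡ (eval ws)))))
    (ℕ.≤-trans (ℓ-word ws {idˢ} DistinctAbs-id) (ℕ.≤-reflexive (cong (_+ length ws) ℓ-id)))

  eval-++ : ∀ u v → eval {n} (u ++ v) ≡ eval u ∘ˢ eval v
  eval-++ []      v = sym (∘-identityˡ (eval v))
  eval-++ (s ∷ u) v = trans (cong (gen s ∘ˢ_) (eval-++ u v)) (sym (∘-assoc (gen s) (eval u) (eval v)))

  eval-single : ∀ s → eval {n} (s ∷ []) ≡ gen s
  eval-single s = ∘-identityʳ (gen s)

rise : ∀ {m} (h : Fin (suc m) → ℕ) → (∀ i → h (F.inject₁ i) < h (suc i)) → ∀ i → h zero + toℕ i ≤ h i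
rise h inc zero = ℕ.≤-reflexive (ℕ.+-identityʳ _)
rise {suc m} h inc (suc i) = ℕ.≤-trans (ℕ.≤-reflexive (ℕ.+-suc (h zero) (toℕ i)))
  (ℕ.≤-trans (ℕ.+-monoˡ-≤ (toℕ i) (inc zero)) (rise (h ∘ suc) (inc ∘ suc) i))

fall : ∀ {m} (h : Fin (suc m) → ℕ) → (∀ i → h (F.inject₁ i) < h (suc i)) → ∀ i → h i + m ≤ h (F.fromℕ m) + toℕ i
fall {m} h inc zero = ℕ.≤-trans (ℕ.≤-reflexive (cong (h zero +_) (sym (F.toℕ-fromℕ m))))
  (ℕ.≤-trans (rise h inc (F.fromℕ m)) (ℕ.≤-reflexive (sym (ℕ.+-identityʳ _))))
fall {suc m} h inc (suc i) = ℕ.≤-trans (ℕ.≤-reflexive (ℕ.+-suc (h (suc i)) m))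
  (ℕ.≤-trans (s≤s (fall (h ∘ suc) (inc ∘ suc) i)) (ℕ.≤-reflexive (sym (ℕ.+-suc _ (toℕ i)))))

-- Each step raises h by at least one: counting up from the first value gives one inequality,
-- counting down from the last value, which is at most m, gives the other.
increasing⇒id : ∀ {m} (h : Fin (suc m) → ℕ) → (∀ i → h (F.inject₁ i) < h (suc i)) → (∀ i → h i ≤ m) → ∀ i → h i ≡ toℕ i
increasing⇒id {m} h inc bound i = ℕ.≤-antisym
  (ℕ.+-cancelʳ-≤ m (h i) (toℕ i) (ℕ.≤-trans (fall h inc i) (ℕ.≤-trans (ℕ.+-monoˡ-≤ (toℕ i) (bound (F.fromℕ m))) (ℕ.≤-reflexive (ℕ.+-comm m (toℕ i))))))
  (ℕ.≤-trans (ℕ.m≤n+m (toℕ i) (h zero)) (rise h inc i))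

-- The generator s₀ yields π(-1) < π(1), hence π(1) > 0; the other generators make the window
-- increasing, hence positive throughout.
no-descent⇒id : ∀ {n} (π : W n) → (∀ s → key (act π (low s)) ℤ.< key (act π (high s))) → π ≡ idˢ
no-descent⇒id {zero}  []  _   = refl
no-descent⇒id {suc m} π asc = act-ext λ z → trans (odd-ext {g = id} (act-odd π) (λ _ → refl) fixed z) (sym (act-id z))
  where
  f = act π
  above-neg : ∀ {z : Elt (suc m)} → key (neg z) ℤ.< key z → 0ℤ ℤ.< key z
  above-neg {false , _} _ = ℤ.+<+ (s≤s z≤n)
  above-neg {true  , _} ()
  positive : ∀ {k} (g : Fin (suc k) → Elt (suc m)) → 0ℤ ℤ.< key (g zero) →
    (∀ i → key (g (F.inject₁ i)) ℤ.< key (g (suc i))) → ∀ i → 0ℤ ℤ.< key (g i)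
  positive g p inc zero = p
  positive {suc k} g p inc (suc i) = positive (g ∘ suc) (ℤ.<-trans p (inc zero)) (inc ∘ suc) i
  f⁺ : Fin (suc m) → Elt (suc m)
  f⁺ i = f (false , i)
  f⁺>0 : ∀ i → 0ℤ ℤ.< key (f⁺ i)
  f⁺>0 = positive f⁺ (above-neg (subst (λ z → key z ℤ.< key (f⁺ zero)) (act-odd π (false , zero)) (asc zero))) (asc ∘ suc)
  sign : ∀ {z : Elt (suc m)} → 0ℤ ℤ.< key z → proj₁ z ≡ false
  sign {false , _} _ = refl
  sign {true  , _} ()
  abs< : ∀ {z w : Elt (suc m)} → 0ℤ ℤ.< key z → key z ℤ.< key w → toℕ (proj₂ z) < toℕ (proj₂ w)
  abs< {false , _} {false , _} _ (ℤ.+<+ (s≤s h)) = h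
  abs< {false , _} {true  , _} _ ()
  abs< {true  , _} ()
  fixed : ∀ i → f (false , i) ≡ (false , i)
  fixed i = cong₂ _,_ (sign (f⁺>0 i)) (F.toℕ-injective (increasing⇒id (λ i → toℕ (proj₂ (f⁺ i)))
    (λ i → abs< {f⁺ (F.inject₁ i)} {f⁺ (suc i)} (f⁺>0 (F.inject₁ i)) (asc (suc i))) (λ i → ℕ.≤-pred (F.toℕ<n (proj₂ (f⁺ i)))) i))

-- Multiplying by a generator at a descent lowers `ℓ` by exactly one, and only the identity has no
-- descent. In particular the generators generate all signed permutations.
reduced-word : ∀ {n} k (π : W n) → DistinctAbs π → ℓ π ≡ k → ∃[ ws ] (eval ws ≡ π × length ws ≡ k)
reduced-word {n} k π d ℓ≡k with F.any? (λ s → key (act π (high s)) ℤ.<? key (act π (low s)))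
... | no none = [] , sym π≡id , trans (sym (ℓ-id {n})) (trans (cong ℓ (sym π≡id)) ℓ≡k)
  where
  π≡id : π ≡ idˢ
  π≡id = no-descent⇒id π λ s → ℤ.≤∧≢⇒< (ℤ.≮⇒≥ (λ h → none (s , h)))
    (λ eq → low≢high s (inj (Odd-act {π = π} d) (key-injective eq)))
reduced-word zero    π d ℓ≡k | yes (s , desc) = case trans (sym ℓ≡k) (gen-descent {π = π} d s desc) of λ ()
reduced-word (suc k) π d ℓ≡k | yes (s , desc)
  with ws , eq , l ← reduced-word k (π ∘ˢ gen s) (DistinctAbs-∘ {π = π} {gen s} d (DistinctAbs-gen s))
                       (ℕ.suc-injective (trans (sym (gen-descent {π = π} d s desc)) ℓ≡k)) =
  ws ++ s ∷ [] ,
  trans (eval-++ ws (s ∷ [])) (trans (cong₂ _∘ˢ_ eq (eval-single s)) (∘-gen-gen π s)) ,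
  trans (List.length-++ ws) (trans (ℕ.+-comm (length ws) 1) (cong suc l))

hasLength : ∀ {n} (π : W n) → DistinctAbs π → HasLength π (ℓ π)
hasLength π d = reduced-word (ℓ π) π d refl , λ { ws refl → ℓ≤length ws }

hasLength-unique : ∀ {n} (π : W n) → DistinctAbs π → ∀ {k} → HasLength π k → k ≡ ℓ π
hasLength-unique π d {k} ((ws , refl , refl) , min) with ws′ , eq , l ← proj₁ (hasLength π d) =
  ℕ.≤-antisym (ℕ.≤-trans (min ws′ eq) (ℕ.≤-reflexive l)) (ℓ≤length ws)

-- Reflections

module _ {n : ℕ} where

  palindrome : List (Fin n) → Fin n → List (Fin n)
  palindrome u s = u ++ (s ∷ reverse u)

  act-palindrome : ∀ g u s z → act (eval (palindrome (g ∷ u) s)) z ≡ act (gen g) (act (eval (palindrome u s)) (act (gen g) z))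
  act-palindrome g u s z = begin
    act (eval (g ∷ (u ++ (s ∷ reverse (g ∷ u))))) z              ≡⟨ cong (λ r → act (eval (g ∷ (u ++ (s ∷ r)))) z) (List.unfold-reverse g u) ⟩
    act (eval (g ∷ (u ++ (s ∷ (reverse u ++ g ∷ []))))) z        ≡⟨ cong (λ r → act (gen g ∘ˢ eval r) z) (List.++-assoc u (s ∷ reverse u) (g ∷ [])) ⟨
    act (gen g ∘ˢ eval (palindrome u s ++ g ∷ [])) z             ≡⟨ act-∘ (gen g) (eval (palindrome u s ++ g ∷ [])) z ⟩
    act (gen g) (act (eval (palindrome u s ++ g ∷ [])) z)        ≡⟨ cong (λ e → act (gen g) (act e z)) (trans (eval-++ (palindrome u s) (g ∷ [])) (cong (eval (palindrome u s) ∘ˢ_) (eval-single g))) ⟩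
    act (gen g) (act (eval (palindrome u s) ∘ˢ gen g) z)         ≡⟨ cong (act (gen g)) (act-∘ (eval (palindrome u s)) (gen g) z) ⟩
    act (gen g) (act (eval (palindrome u s)) (act (gen g) z))    ∎
    where open ≡-Reasoning

  Realises : List (Fin n) → Fin n → Elt n → Elt n → Set
  Realises u s x y = ∀ z → act (eval (palindrome u s)) z ≡ tr x y z

  Odd-gen : ∀ g → Odd (act (gen {n} g))
  Odd-gen g = Odd-act {π = gen g} (DistinctAbs-gen g)

  gen-gen : ∀ g z → act (gen {n} g) (act (gen g) z) ≡ z
  gen-gen g z = trans (act-gen g _) (trans (cong (tr (low g) (high g)) (act-gen g z)) (tr-involutive (low g) (high g) z))

  realises-[] : ∀ s → Realises [] s (low s) (high s)
  realises-[] s z = trans (cong (λ e → act e z) (eval-single s)) (act-gen s z)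

  realises-∷ : ∀ g {u s x y} → Realises u s x y → Realises (g ∷ u) s (act (gen g) x) (act (gen g) y)
  realises-∷ g {u} {s} {x} {y} h z = trans (act-palindrome g u s z) (trans (cong (act (gen g)) (h (act (gen g) z)))
    (trans (tr-conj (Odd-gen g) x y (act (gen g) z)) (cong (tr (act (gen g) x) (act (gen g) y)) (gen-gen g z))))

  realised : ∀ u s → ∃[ x ] ∃[ y ] (x ≢ y × Realises u s x y)
  realised []      s = low s , high s , low≢high s , realises-[] s
  realised (g ∷ u) s with x , y , x≢y , h ← realised u s =
    act (gen g) x , act (gen g) y , x≢y ∘ inj (Odd-gen g) , realises-∷ g {u} {s} h

  Realisable : Elt n → Elt n → Set
  Realisable x y = ∃[ u ] ∃[ s ] Realises u s x y

  realisable-eval : ∀ ws {x y} → Realisable x y → Realisable (act (eval ws) x) (act (eval ws) y)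
  realisable-eval []       {x} {y} h = subst₂ Realisable (sym (act-id x)) (sym (act-id y)) h
  realisable-eval (g ∷ ws) {x} {y} h with u , s , r ← realisable-eval ws h =
    subst₂ Realisable (sym (act-∘ (gen g) (eval ws) x)) (sym (act-∘ (gen g) (eval ws) y)) (g ∷ u , s , realises-∷ g {u} {s} r)

  realisable-act : ∀ {π : W n} → DistinctAbs π → ∀ {x y} → Realisable x y → Realisable (act π x) (act π y)
  realisable-act {π} d {x} {y} h with ws , refl , _ ← proj₁ (hasLength π d) = realisable-eval ws h

  DistinctAbs-refl : ∀ x y → DistinctAbs (refl-vec {n} x y)
  DistinctAbs-refl x y = DistinctAbs-act {π = refl-vec x y} λ {z} {w} eq →
    tr-injective x y (trans (sym (act-refl x y z)) (trans eq (act-refl x y w)))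

-- Conjugate a simple reflection by a signed permutation that carries its two elements to x and y:
-- the pair -1, 1 if y = -x, the pair 1, 2 otherwise.
realisable : ∀ {n} {x y : Elt n} → x ≢ y → Realisable x y
realisable {n} {x} {y} x≢y with proj₂ y F.≟ proj₂ x
realisable {zero} {_ , ()} {y} x≢y | _
realisable {suc n} {x} {y} x≢y | yes eq with ±-cases y x eq
... | inj₁ h = contradiction (sym h) x≢y
... | inj₂ refl = subst₂ Realisable first second
        (realisable-act {π = refl-vec (true , zero) x} (DistinctAbs-refl _ x) ([] , zero , realises-[] zero))
  where
  first : act (refl-vec (true , zero) x) (true , zero) ≡ x
  first = trans (act-refl (true , zero) x (true , zero)) (tr-x (true , zero) x)
  second : act (refl-vec (true , zero) x) (false , zero) ≡ neg x
  second = trans (act-odd (refl-vec (true , zero) x) (true , zero)) (cong neg first)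
realisable {suc zero} {_ , zero} {_ , zero} x≢y | no idx≢ = contradiction refl idx≢
realisable {suc (suc n)} {x} {y} x≢y | no idx≢ = subst₂ Realisable first second
  (realisable-act {π = refl-vec p x ∘ˢ refl-vec q y₁} (DistinctAbs-∘ {π = refl-vec p x} {refl-vec q y₁} (DistinctAbs-refl p x) (DistinctAbs-refl q y₁))
    ([] , suc zero , realises-[] (suc zero)))
  where
  p q : Elt (suc (suc n))
  p = false , zero
  q = false , suc zero
  -- The preimage of y under the outer map: the inner one sends q to `y₁` and fixes p, the outer one
  -- then sends p to x and `y₁` to y.
  y₁ = tr p x y
  p≢y₁ : p ≢ y₁
  p≢y₁ h = idx≢ (cong proj₂ (trans (sym (tr-involutive p x y)) (trans (cong (tr p x) (sym h)) (tr-x p x))))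
  p≢ny₁ : p ≢ neg y₁
  p≢ny₁ h = idx≢ (cong proj₂ (trans (sym (tr-involutive p x y)) (trans (cong (tr p x) (trans (sym (neg-neg y₁)) (cong neg (sym h))))
    (trans (tr-neg p x p) (cong neg (tr-x p x))))))
  act-both : ∀ z → act (refl-vec p x ∘ˢ refl-vec q y₁) z ≡ tr p x (tr q y₁ z)
  act-both z = trans (act-∘-refl (refl-vec p x) q y₁ z) (act-refl p x _)
  first : act (refl-vec p x ∘ˢ refl-vec q y₁) p ≡ x
  first = trans (act-both p) (trans (cong (tr p x) (tr-by (other (λ ()) p≢y₁ (λ ()) p≢ny₁))) (tr-x p x))
  second : act (refl-vec p x ∘ˢ refl-vec q y₁) q ≡ y
  second = trans (act-both q) (trans (cong (tr p x) (tr-x q y₁)) (tr-involutive p x y))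

reflection-refl : ∀ {n} {x y : Elt n} → x ≢ y → Reflection (refl-vec x y)
reflection-refl {x = x} {y} x≢y with u , s , h ← realisable x≢y = u , s , act-ext (λ z → trans (act-refl x y z) (sym (h z)))

-- Bruhat order

<⇒≢ : ∀ {n} {x y : Elt n} → key x ℤ.< key y → x ≢ y
<⇒≢ lt refl = ℤ.<-irrefl refl lt

∘-refl-refl : ∀ {n} (π : W n) x y → (π ∘ˢ refl-vec x y) ∘ˢ refl-vec x y ≡ π
∘-refl-refl π x y = act-ext λ z → trans (act-∘-refl (π ∘ˢ refl-vec x y) x y z)
  (trans (act-∘-refl π x y _) (cong (act π) (tr-involutive x y z)))

DistinctAbs-∘-refl : ∀ {n} {π : W n} → DistinctAbs π → ∀ x y → DistinctAbs (π ∘ˢ refl-vec x y)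
DistinctAbs-∘-refl {π = π} d x y = DistinctAbs-∘ {π = π} {refl-vec x y} d (DistinctAbs-refl x y)

ℓ-∘-refl : ∀ {n} (π : W n) x y → ℓ (π ∘ˢ refl-vec x y) ≡ len (act π ∘ tr x y)
ℓ-∘-refl π x y = len-cong (act-∘-refl π x y)

Ascent : ∀ {n} → W n → Elt n → Elt n → Set
Ascent π x y = key x ℤ.< key y × key (act π x) ℤ.< key (act π y)

ascent-ℓ : ∀ {n} {π : W n} → DistinctAbs π → ∀ {x y} → Ascent π x y → ℓ π < ℓ (π ∘ˢ refl-vec x y)
ascent-ℓ {π = π} d {x} {y} (a , b) = ℕ.≤-trans
  (ℕ.≤-trans (ℕ.≤-reflexive (ℕ.+-comm 1 (ℓ π))) (ℕ.+-monoʳ-≤ (ℓ π) (ℕ.m≤m+n 1 (2 * excess))))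
  (ℕ.≤-reflexive (trans (sym formula) (sym (ℓ-∘-refl π x y))))
  where open LenChange (len-swap (Odd-act {π = π} d) a b)

arrow-intro : ∀ {n} {π : W n} → DistinctAbs π → ∀ {x y} → Ascent π x y → Arrow π (π ∘ˢ refl-vec x y)
arrow-intro {π = π} d {x} {y} asc = refl-vec x y , reflection-refl (<⇒≢ (proj₁ asc)) , refl ,
  ℓ π , ℓ (π ∘ˢ refl-vec x y) , hasLength π d , hasLength _ (DistinctAbs-∘-refl {π = π} d x y) , ascent-ℓ {π = π} d asc

refl-vec-comm : ∀ {n} (x y : Elt n) → refl-vec x y ≡ refl-vec y x
refl-vec-comm x y = act-ext λ z → trans (act-refl x y z) (trans (sym (tr-comm x y z)) (sym (act-refl y x z)))

act-∘-refl-x : ∀ {n} (π : W n) x y → act (π ∘ˢ refl-vec x y) x ≡ act π y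
act-∘-refl-x π x y = trans (act-∘-refl π x y x) (cong (act π) (tr-x x y))

act-∘-refl-y : ∀ {n} (π : W n) x y → act (π ∘ˢ refl-vec x y) y ≡ act π x
act-∘-refl-y π x y = trans (act-∘-refl π x y y) (cong (act π) (tr-y x y))

descent⇒ascent : ∀ {n} (π : W n) {x y} → key x ℤ.< key y → key (act π y) ℤ.< key (act π x) → Ascent (π ∘ˢ refl-vec x y) x y
descent⇒ascent π {x} {y} lt desc = lt , subst₂ ℤ._<_ (cong key (sym (act-∘-refl-x π x y))) (cong key (sym (act-∘-refl-y π x y))) desc

-- The reflection exchanges some x < y. If the values of u descended there, u would arise from w by
-- an ascent and would be the longer of the two.
arrow-elim : ∀ {n} {u w : W n} → DistinctAbs u → Arrow u w →
  DistinctAbs w × ℓ u < ℓ w × ∃[ x ] ∃[ y ] (Ascent u x y × w ≡ u ∘ˢ refl-vec x y)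
arrow-elim {n} {u} {w} d (t , (ws , s , refl) , refl , a , b , ha , hb , a<b) with x , y , x≢y , h ← realised ws s =
  dw , ℓu<ℓw , choose
  where
  t≡ : eval (palindrome ws s) ≡ refl-vec x y
  t≡ = act-ext λ z → trans (h z) (sym (act-refl x y z))
  dw : DistinctAbs (u ∘ˢ eval (palindrome ws s))
  dw = DistinctAbs-∘ {π = u} {eval (palindrome ws s)} d (DistinctAbs-eval (palindrome ws s))
  ℓu<ℓw : ℓ u < ℓ (u ∘ˢ eval (palindrome ws s))
  ℓu<ℓw = subst₂ _<_ (hasLength-unique u d ha) (hasLength-unique _ dw hb) a<b
  ordered : ∀ x y → key x ℤ.< key y → eval (palindrome ws s) ≡ refl-vec x y →
    ∃[ x ] ∃[ y ] (Ascent u x y × u ∘ˢ eval (palindrome ws s) ≡ u ∘ˢ refl-vec x y)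
  ordered x y lt eq with ℤ.<-cmp (key (act u x)) (key (act u y))
  ... | tri< asc _ _  = x , y , (lt , asc) , cong (u ∘ˢ_) eq
  ... | tri≈ _ e _    = contradiction (inj (Odd-act {π = u} d) (key-injective e)) (<⇒≢ lt)
  ... | tri> _ _ desc = contradiction
          (subst₂ _<_ (cong (λ r → ℓ (u ∘ˢ r)) (sym eq)) (cong ℓ (∘-refl-refl u x y))
            (ascent-ℓ {π = u ∘ˢ refl-vec x y} (DistinctAbs-∘-refl {π = u} d x y) (descent⇒ascent u lt desc)))
          (ℕ.<-asym ℓu<ℓw)
  choose : ∃[ x ] ∃[ y ] (Ascent u x y × u ∘ˢ eval (palindrome ws s) ≡ u ∘ˢ refl-vec x y)
  choose with ℤ.<-cmp (key x) (key y)
  ... | tri< lt _ _ = ordered x y lt t≡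
  ... | tri≈ _ e _  = contradiction (key-injective e) x≢y
  ... | tri> _ _ gt = ordered y x gt (trans t≡ (refl-vec-comm x y))

star-elim : ∀ {n} {u w : W n} → DistinctAbs u → u ≤B w → DistinctAbs w × (u ≡ w ⊎ ℓ u < ℓ w)
star-elim d ε = d , inj₁ refl
star-elim {u = u} d (a ◅ as) with arrow-elim {u = u} d a
... | dv , lt , _ with star-elim dv as
... | dw , inj₁ refl = dw , inj₂ lt
... | dw , inj₂ lt′  = dw , inj₂ (ℕ.<-trans lt lt′)

-- The pigeonhole principle and membership in the group

injective⇒surjective : ∀ {n} (g : Fin n → Fin n) → (∀ {i j} → g i ≡ g j → i ≡ j) → ∀ k → ∃[ i ] g i ≡ k
injective⇒surjective {suc n} g inj k with F.any? (λ i → g i F.≟ k)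
... | yes found = found
... | no none   = contradiction (F.injective⇒≤ {f = λ i → punchOut {i = k} {j = g i} (λ h → none (i , sym h))}
                    (λ {a} {b} eq → inj (F.punchOut-injective (λ h → none (a , sym h)) (λ h → none (b , sym h)) eq))) ℕ.1+n≰n

-- A section of g is injective, hence surjective, so g is its two-sided inverse.
surjective⇒injective : ∀ {n} (g : Fin n → Fin n) → (∀ k → ∃[ i ] g i ≡ k) → ∀ {i j} → g i ≡ g j → i ≡ j
surjective⇒injective g surj {i} {j} eq = trans (sym (proj₂ (hit i))) (trans (cong section a≡b) (proj₂ (hit j)))
  where
  section = λ k → proj₁ (surj k)
  g-section : ∀ k → g (section k) ≡ k
  g-section k = proj₂ (surj k)
  hit = injective⇒surjective section (λ {a} {b} h → trans (sym (g-section a)) (trans (cong g h) (g-section b)))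
  g-hit : ∀ i → g i ≡ proj₁ (hit i)
  g-hit i = trans (cong g (sym (proj₂ (hit i)))) (g-section (proj₁ (hit i)))
  a≡b : proj₁ (hit i) ≡ proj₁ (hit j)
  a≡b = trans (sym (g-hit i)) (trans eq (g-hit j))

module _ {A : Set} (p : A → Bool) where

  any-lookup : ∀ {m} (v : Vec A m) → T (ListAction.any p (toList v)) → ∃[ i ] T (p (lookup v i))
  any-lookup (x ∷ v) h with p x in eq
  ... | true  = zero , subst T (sym eq) tt
  ... | false with i , q ← any-lookup v h = suc i , q

  lookup-any : ∀ {m} (v : Vec A m) i → T (p (lookup v i)) → T (ListAction.any p (toList v))
  lookup-any (x ∷ v) zero    h with p x
  ... | true = tt
  lookup-any (x ∷ v) (suc i) h with p x
  ... | true  = tt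
  ... | false = lookup-any v i h

  all-list : ∀ xs → (∀ x → T (p x)) → T (ListAction.all p xs)
  all-list []       h = tt
  all-list (x ∷ xs) h with p x | h x
  ... | true | _ = all-list xs h

all-tabulate : ∀ {n} {A : Set} (p : A → Bool) (g : Fin n → A) → T (ListAction.all p (List.tabulate g)) → ∀ i → T (p (g i))
all-tabulate {suc n} p g h i with p (g zero) in eq
all-tabulate {suc n} p g h zero    | true = subst T (sym eq) tt
all-tabulate {suc n} p g h (suc i) | true = all-tabulate p (g ∘ suc) h i

does-sound : ∀ {A : Set} (a? : Dec A) → T (does a?) → A
does-sound (yes a) _ = a

does-complete : ∀ {A : Set} (a? : Dec A) → A → T (does a?)
does-complete (yes _) _ = tt
does-complete (no ¬a) a = contradiction a ¬a

InB⇒distinct : ∀ {n} (v : W n) → InB v → DistinctAbs v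
InB⇒distinct {n} v h = surjective⇒injective (λ i → proj₂ (lookup v i)) λ k →
  let i , q = any-lookup (λ e → does (proj₂ e F.≟ k)) v (all-tabulate (λ j → ListAction.any (λ e → does (proj₂ e F.≟ j)) (toList v)) id h k)
  in i , does-sound (proj₂ (lookup v i) F.≟ k) q

distinct⇒InB : ∀ {n} (v : W n) → DistinctAbs v → InB v
distinct⇒InB {n} v d = all-list (λ j → ListAction.any (λ e → does (proj₂ e F.≟ j)) (toList v)) (allFin n) λ j →
  let i , q = injective⇒surjective (λ i → proj₂ (lookup v i)) d j
  in lookup-any (λ e → does (proj₂ e F.≟ j)) v i (does-complete (proj₂ (lookup v i) F.≟ j) q)

-- Covers correspond to reflections with empty boxes

uncons : ∀ {n} {u v : W n} → u ≤B v → u ≡ v ⊎ (∃[ w ] (Arrow u w × w ≤B v))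
uncons ε        = inj₁ refl
uncons (a ◅ as) = inj₂ (_ , a , as)

module _ {n : ℕ} {u v : W n} where

  between : DistinctAbs u → Covers u v → ∀ {w} → u ≤B w → w ≤B v → ℓ u < ℓ w → ℓ w < ℓ v → ⊥
  between d (_ , _ , _ , _ , minimal) {w} u≤w w≤v lt lt′ with minimal w (distinct⇒InB w (proj₁ (star-elim {u = u} d u≤w))) u≤w w≤v
  ... | inj₁ refl = ℕ.<-irrefl refl lt
  ... | inj₂ refl = ℕ.<-irrefl refl lt′

  module _ (d : DistinctAbs u) (cov : Covers u v) where
    private f = act u

    -- u < u t₁ < u t₁ t₂ < u t₁ t₂ t₁, and the last element is u t for the conjugate reflection t
    no-chain : ∀ {a b c e x y} → Ascent u a b → key c ℤ.< key e →
      (let t₁ = tr a b ; t₂ = tr c e in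
       key (f (t₁ c)) ℤ.< key (f (t₁ e)) → key (f (t₁ (t₂ a))) ℤ.< key (f (t₁ (t₂ b))) →
       (∀ z → tr (t₁ c) (t₁ e) z ≡ tr x y z) → v ≡ u ∘ˢ refl-vec x y → ⊥)
    no-chain {a} {b} {c} {e} {x} {y} asc₁ c<e asc₂ asc₃ conj v≡ = between d cov
      (arrow-intro {π = u} d asc₁ ◅ ε)
      (arrow-intro {π = w₁} d₁ asc₂′ ◅ subst (Arrow w₂) w₃≡v (arrow-intro {π = w₂} d₂ asc₃′) ◅ ε)
      (ascent-ℓ {π = u} d asc₁)
      (ℕ.<-trans (ascent-ℓ {π = w₁} d₁ asc₂′) (subst (λ r → ℓ w₂ < ℓ r) w₃≡v (ascent-ℓ {π = w₂} d₂ asc₃′)))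
      where
      w₁ = u ∘ˢ refl-vec a b
      w₂ = w₁ ∘ˢ refl-vec c e
      w₃ = w₂ ∘ˢ refl-vec a b
      d₁ : DistinctAbs w₁
      d₁ = DistinctAbs-∘-refl {π = u} d a b
      d₂ : DistinctAbs w₂
      d₂ = DistinctAbs-∘-refl {π = w₁} d₁ c e
      act₁ : ∀ z → act w₁ z ≡ f (tr a b z)
      act₁ = act-∘-refl u a b
      act₂ : ∀ z → act w₂ z ≡ f (tr a b (tr c e z))
      act₂ z = trans (act-∘-refl w₁ c e z) (act₁ (tr c e z))
      asc₂′ : Ascent w₁ c e
      asc₂′ = c<e , subst₂ ℤ._<_ (cong key (sym (act₁ c))) (cong key (sym (act₁ e))) asc₂
      asc₃′ : Ascent w₂ a b
      asc₃′ = proj₁ asc₁ , subst₂ ℤ._<_ (cong key (sym (act₂ a))) (cong key (sym (act₂ b))) asc₃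
      w₃≡v : w₃ ≡ v
      w₃≡v = trans (act-ext λ z → begin
        act w₃ z                                       ≡⟨ act-∘-refl w₂ a b z ⟩
        act w₂ (tr a b z)                              ≡⟨ act₂ (tr a b z) ⟩
        f (tr a b (tr c e (tr a b z)))                 ≡⟨ cong f (tr-conj (Odd-tr a b) c e (tr a b z)) ⟩
        f (tr (tr a b c) (tr a b e) (tr a b (tr a b z))) ≡⟨ cong (λ r → f (tr (tr a b c) (tr a b e) r)) (tr-involutive a b z) ⟩
        f (tr (tr a b c) (tr a b e) z)                 ≡⟨ cong f (conj z) ⟩
        f (tr x y z)                                   ≡⟨ act-∘-refl u x y z ⟨
        act (u ∘ˢ refl-vec x y) z                      ∎) (sym v≡)
        where open ≡-Reasoning

    private
      _≺_ : Elt n → Elt n → Set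
      z ≺ w = key z ℤ.< key w

      tr-other : ∀ (x y z : Elt n) → z ≢ x → z ≢ y → z ≢ neg x → z ≢ neg y → tr x y z ≡ z
      tr-other x y z a b c d = tr-by (other a b c d)

      swap-neg : ∀ {z w : Elt n} → z ≢ neg w → w ≢ neg z
      swap-neg {z} {w} h eq = h (trans (sym (neg-neg z)) (cong neg (sym eq)))

      neg-≺ : ∀ {z w : Elt n} → z ≺ w → neg w ≺ neg z
      neg-≺ {z} {w} h rewrite key-neg z | key-neg w = ℤ.neg-mono-< h

      negative⇒≺neg : ∀ {z : Elt n} → key z ℤ.< 0ℤ → z ≺ neg z
      negative⇒≺neg {z} h = ℤ.<-trans h (subst (0ℤ ℤ.<_) (sym (key-neg z)) (pos-neg h))

      positive⇒neg≺ : ∀ {z : Elt n} → 0ℤ ℤ.< key z → neg z ≺ z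
      positive⇒neg≺ {z} h = ℤ.<-trans (subst (ℤ._< 0ℤ) (sym (key-neg z)) (neg-pos h)) h

      ≺neg⇒negative : ∀ {z : Elt n} → z ≺ neg z → key z ℤ.< 0ℤ
      ≺neg⇒negative {false , _} ()
      ≺neg⇒negative {true  , _} _ = ℤ.-<+

      neg≺⇒positive : ∀ {z : Elt n} → neg z ≺ z → 0ℤ ℤ.< key z
      neg≺⇒positive {false , _} _ = ℤ.+<+ (s≤s z≤n)
      neg≺⇒positive {true  , _} ()

      f-neg : ∀ z → f (neg z) ≡ neg (f z)
      f-neg = act-odd u

    -- The sign change at x is the sign change at z conjugated by the exchange of x and z; for
    -- negative z all three steps go up.
    no-loop-box : ∀ x → Ascent u x (neg x) → v ≡ u ∘ˢ refl-vec x (neg x) → ∀ z → key z ℤ.< 0ℤ → ¬ InBox f x (neg x) z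
    no-loop-box x (_ , fx<fy) v≡ z z<0 ((x<z , z<y) , (fx<fz , fz<fy)) =
      no-chain {x} {z} {z} {neg z} {x} {neg x} (x<z , fx<fz) (negative⇒≺neg z<0)
        (subst₂ (λ p q → f p ≺ f q) (sym (tr-y x z)) (sym t₁-negz) fx<fy)
        (subst₂ (λ p q → f p ≺ f q) (sym (trans (cong (tr x z) t₂x) (tr-x x z))) (sym (trans (cong (tr x z) (tr-x z (neg z))) t₁-negz)) fz<fy)
        (λ w → cong₂ (λ p q → tr p q w) (tr-y x z) t₁-negz) v≡
      where
      x≢z : x ≢ z
      x≢z = <⇒≢ x<z
      z≢nx : z ≢ neg x
      z≢nx = <⇒≢ z<y
      t₁-negz : tr x z (neg z) ≡ neg x
      t₁-negz = trans (tr-neg x z z) (cong neg (tr-y x z))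
      t₂x : tr z (neg z) x ≡ x
      t₂x = tr-other z (neg z) x x≢z (swap-neg {z} {x} z≢nx) (swap-neg {z} {x} z≢nx) (λ h → x≢z (trans h (neg-neg z)))

    -- The exchange of x and y is the exchange of x and -y conjugated by the sign change at y. The
    -- middle step starts from x < -y; the opposite case is this one for the corners -y and -x.
    no-origin : ∀ x y → Ascent u x y → v ≡ u ∘ˢ refl-vec x y → key (f x) ℤ.< 0ℤ → 0ℤ ℤ.< key y → 0ℤ ℤ.< key (f y) → x ≺ neg y → ⊥
    no-origin x y (x<y , fx<fy) v≡ fx<0 0<y 0<fy x<ny =
      no-chain {neg y} {y} {x} {neg y} {x} {y}
        (positive⇒neg≺ 0<y , subst (λ p → p ≺ f y) (sym (f-neg y)) (positive⇒neg≺ 0<fy)) x<ny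
        (subst₂ (λ p q → f p ≺ f q) (sym t₁x) (sym (tr-x (neg y) y)) fx<fy)
        (subst₂ (λ p q → f p ≺ f q) (sym (trans (cong (tr (neg y) y) (tr-y x (neg y))) t₁x)) (sym t₁t₂y)
          (subst (λ p → f x ≺ p) (sym (f-neg x)) (negative⇒≺neg fx<0)))
        (λ w → cong₂ (λ p q → tr p q w) t₁x (tr-x (neg y) y)) v≡
      where
      x≢y : x ≢ y
      x≢y = <⇒≢ x<y
      x≢ny : x ≢ neg y
      x≢ny = <⇒≢ x<ny
      t₁x : tr (neg y) y x ≡ x
      t₁x = tr-other (neg y) y x x≢ny x≢y (λ h → x≢y (trans h (neg-neg y))) x≢ny
      t₂y : tr x (neg y) y ≡ neg x
      t₂y = tr-by (isNY (sym (neg-neg y)))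
      t₁t₂y : tr (neg y) y (tr x (neg y) y) ≡ neg x
      t₁t₂y = trans (cong (tr (neg y) y) t₂y) (trans (tr-neg (neg y) y x) (cong neg t₁x))

    -- The exchange of x and y is the exchange of z and y conjugated by that of x and z. For this z
    -- must differ from -x and -y, and the origin takes care of it: together with x and -x the box
    -- would also contain their midpoint.
    no-pair-box : ∀ x y → Ascent u x y → v ≡ u ∘ˢ refl-vec x y → y ≢ neg x → ¬ Origin f x y → ∀ z → ¬ InBox f x y z
    no-pair-box x y (x<y , fx<fy) v≡ y≢nx no-o z ((x<z , z<y) , (fx<fz , fz<fy)) =
      no-chain {x} {z} {z} {y} {x} {y} (x<z , fx<fz) z<y
        (subst₂ (λ p q → f p ≺ f q) (sym (tr-y x z)) (sym t₁y) fx<fy)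
        (subst₂ (λ p q → f p ≺ f q) (sym (trans (cong (tr x z) t₂x) (tr-x x z))) (sym (trans (cong (tr x z) (tr-x z y)) t₁y)) fz<fy)
        (λ w → cong₂ (λ p q → tr p q w) (tr-y x z) t₁y) v≡
      where
      z≢nx : z ≢ neg x
      z≢nx refl = no-o ((x<0 , ℤ.<-trans (subst (0ℤ ℤ.<_) (sym (key-neg x)) (pos-neg x<0)) z<y) ,
                        (fx<0 , ℤ.<-trans (subst (0ℤ ℤ.<_) (sym (key-neg (f x))) (pos-neg fx<0)) (subst (_≺ f y) (f-neg x) fz<fy)))
        where
        x<0 = ≺neg⇒negative x<z
        fx<0 = ≺neg⇒negative (subst (f x ≺_) (f-neg x) fx<fz)
      z≢ny : z ≢ neg y
      z≢ny refl = no-o ((ℤ.<-trans x<z (subst (ℤ._< 0ℤ) (sym (key-neg y)) (neg-pos 0<y)) , 0<y) ,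
                        (ℤ.<-trans (subst (f x ≺_) (f-neg y) fx<fz) (subst (ℤ._< 0ℤ) (sym (key-neg (f y))) (neg-pos 0<fy)) , 0<fy))
        where
        0<y = neg≺⇒positive z<y
        0<fy = neg≺⇒positive (subst (_≺ f y) (f-neg y) fz<fy)
      t₁y : tr x z y ≡ y
      t₁y = tr-other x z y (λ h → <⇒≢ x<y (sym h)) (λ h → <⇒≢ z<y (sym h)) y≢nx (swap-neg {z} {y} z≢ny)
      t₂x : tr z y x ≡ x
      t₂x = tr-other z y x (<⇒≢ x<z) (<⇒≢ x<y) (swap-neg {z} {x} z≢nx) (swap-neg {y} {x} y≢nx)

    -- By minimality the first arrow of a chain from u to v already ends at v; a point in its box
    -- would insert further elements.
    covers⇒clear : ∃[ x ] ∃[ y ] (Ascent u x y × Clear f x y × v ≡ u ∘ˢ refl-vec x y)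
    covers⇒clear with uncons (proj₁ (proj₂ (proj₂ cov)))
    ... | inj₁ u≡v = contradiction u≡v (proj₁ (proj₂ (proj₂ (proj₂ cov))))
    ... | inj₂ (w , a , as) with arrow-elim {u = u} d a
    ... | dw , lt , x , y , asc , w≡ with proj₂ (proj₂ (proj₂ (proj₂ cov))) w (distinct⇒InB w dw) (a ◅ ε) as
    ... | inj₁ refl = contradiction refl (ℕ.<⇒≢ lt)
    ... | inj₂ refl with y ≟ᴱ neg x
    ... | yes refl = x , neg x , asc , clear (inj₁ refl) empty , w≡
      where
      empty : ∀ z → ¬ InBox f x (neg x) z
      empty z box@((x<z , z<y) , (fx<fz , fz<fy)) with ℤ.<-cmp (key z) 0ℤ
      ... | tri< z<0 _ _ = no-loop-box x asc w≡ z z<0 box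
      ... | tri≈ _ eq _  = key≢0 z eq
      -- The box of a sign change is centrally symmetric, so it contains -z as well.
      ... | tri> _ _ 0<z = no-loop-box x asc w≡ (neg z) (subst (ℤ._< 0ℤ) (sym (key-neg z)) (neg-pos 0<z))
              ( (subst (_≺ neg z) (neg-neg x) (neg-≺ z<y) , neg-≺ x<z)
              , (subst₂ _≺_ (trans (sym (f-neg (neg x))) (cong f (neg-neg x))) (sym (f-neg z)) (neg-≺ fz<fy)
              ,  subst₂ _≺_ (sym (f-neg z)) (sym (f-neg x)) (neg-≺ fx<fz)))
    ... | no y≢nx = x , y , asc , clear (inj₂ no-o) (no-pair-box x y asc w≡ y≢nx no-o) , w≡
      where
      no-o : ¬ Origin f x y
      no-o ((x<0 , 0<y) , (fx<0 , 0<fy)) with ℤ.<-cmp (key x) (key (neg y))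
      ... | tri< h _ _ = no-origin x y asc w≡ fx<0 0<y 0<fy h
      ... | tri≈ _ h _ = y≢nx (trans (sym (neg-neg y)) (cong neg (sym (key-injective h))))
      ... | tri> _ _ h = no-origin (neg y) (neg x)
              (neg-≺ (proj₁ asc) , subst₂ _≺_ (sym (f-neg y)) (sym (f-neg x)) (neg-≺ (proj₂ asc)))
              (trans w≡ (cong (u ∘ˢ_) (act-ext λ z → trans (act-refl x y z) (trans (sym (tr-comm x y z)) (trans (sym (tr-negs y x z)) (sym (act-refl (neg y) (neg x) z)))))))
              (subst (ℤ._< 0ℤ) (sym (trans (cong key (f-neg y)) (key-neg (f y)))) (neg-pos 0<fy))
              (subst (0ℤ ℤ.<_) (sym (key-neg x)) (pos-neg x<0))
              (subst (0ℤ ℤ.<_) (sym (trans (cong key (f-neg x)) (key-neg (f x)))) (pos-neg fx<0))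
              (subst (neg y ≺_) (sym (neg-neg x)) h)

-- The length grows by exactly one, and every element strictly between would have a length strictly
-- between.
clear⇒covers : ∀ {n} {u : W n} → DistinctAbs u → ∀ {x y} → Ascent u x y → Clear (act u) x y → Covers u (u ∘ˢ refl-vec x y)
clear⇒covers {n} {u} d {x} {y} asc c = distinct⇒InB u d , distinct⇒InB v dv , arrow-intro {π = u} d asc ◅ ε ,
  (λ eq → ℕ.<⇒≢ (ascent-ℓ {π = u} d asc) (cong ℓ eq)) , minimal
  where
  v = u ∘ˢ refl-vec x y
  dv : DistinctAbs v
  dv = DistinctAbs-∘-refl {π = u} d x y
  open LenChange (len-swap (Odd-act {π = u} d) (proj₁ asc) (proj₂ asc))
  ℓv : ℓ v ≡ suc (ℓ u)
  ℓv = trans (ℓ-∘-refl u x y) (trans formula (trans (cong (λ e → ℓ u + (1 + 2 * e)) (tight c)) (ℕ.+-comm (ℓ u) 1)))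
  minimal : ∀ w → InB w → u ≤B w → w ≤B v → w ≡ u ⊎ w ≡ v
  minimal w _ u≤w w≤v with star-elim {u = u} d u≤w
  ... | dw , inj₁ eq = inj₁ (sym eq)
  ... | dw , inj₂ lt with star-elim {u = w} dw w≤v
  ... | _ , inj₁ eq  = inj₂ eq
  ... | _ , inj₂ lt′ = contradiction (ℕ.≤-trans lt′ (ℕ.≤-reflexive ℓv)) (ℕ.<⇒≱ (s≤s lt))

-- Empty boxes and edges

record UClear {n} (f : Elt n → Elt n) (x y : Elt n) : Set where
  constructor uclear
  field
    origin : y ≡ neg x ⊎ ¬ (Btwᶻ (key x) 0ℤ (key y) × Btwᶻ (key (f x)) 0ℤ (key (f y)))
    empty  : ∀ z → Btwᶻ (key x) (key z) (key y) → ¬ Btwᶻ (key (f x)) (key (f z)) (key (f y))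

Btwᶻ-ordered : ∀ {a b c} → a ℤ.< c → Btwᶻ a b c → a ℤ.< b × b ℤ.< c
Btwᶻ-ordered a<c (inj₁ h)       = h
Btwᶻ-ordered a<c (inj₂ (p , q)) = contradiction (ℤ.<-trans p q) (ℤ.<-asym a<c)

-- `UClear` forgets which corners are lower. It is thus invariant under exchange and negation of the
-- corners and under the reflection itself, so that covering and covered elements can be treated
-- alike.
clear⇒uclear : ∀ {n} {f : Elt n → Elt n} {x y} → key x ℤ.< key y → key (f x) ℤ.< key (f y) → Clear f x y → UClear f x y
clear⇒uclear {f = f} {x} {y} lt lt′ (clear o e) = uclear
  ([ inj₁ , (λ h → inj₂ (λ (a , b) → h (Btwᶻ-ordered lt a , Btwᶻ-ordered lt′ b))) ]′ o)
  (λ z a b → e z (Btwᶻ-ordered lt a , Btwᶻ-ordered lt′ b))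

uclear⇒clear : ∀ {n} {f : Elt n → Elt n} {x y} → UClear f x y → Clear f x y
uclear⇒clear (uclear o e) = clear
  ([ inj₁ , (λ h → inj₂ (λ (a , b) → h (inj₁ a , inj₁ b))) ]′ o)
  (λ z (a , b) → e z (inj₁ a) (inj₁ b))

Btw-irreflˡ : ∀ {a c} → ¬ Btwᶻ a a c
Btw-irreflˡ (inj₁ (p , _)) = ℤ.<-irrefl refl p
Btw-irreflˡ (inj₂ (_ , p)) = ℤ.<-irrefl refl p

Btw-neg⇒0 : ∀ {a c} → Btwᶻ a (- a) c → Btwᶻ a 0ℤ c
Btw-neg⇒0 { +[1+ _ ]} (inj₂ (p , _)) = inj₂ (ℤ.<-trans p ℤ.-<+ , ℤ.+<+ (s≤s z≤n))
Btw-neg⇒0 { -[1+ _ ]} (inj₁ (_ , q)) = inj₁ (ℤ.-<+ , ℤ.<-trans (ℤ.+<+ (s≤s z≤n)) q)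
Btw-neg⇒0 {ℤ.+ zero} h = h
Btw-neg⇒0 { +[1+ _ ]} (inj₁ (() , _))
Btw-neg⇒0 { -[1+ _ ]} (inj₂ (_ , ()))

UClear-swap : ∀ {n} {f : Elt n → Elt n} {x y} → UClear f x y → UClear f y x
UClear-swap {x = x} (uclear o e) = uclear
  ([ (λ h → inj₁ (trans (sym (neg-neg x)) (cong neg (sym h)))) , (λ h → inj₂ (λ (a , b) → h (swap a , swap b))) ]′ o)
  (λ z a b → e z (swap a) (swap b))

UClear-neg : ∀ {n} {f : Elt n → Elt n} → (∀ z → f (neg z) ≡ neg (f z)) → ∀ {x y} → UClear f x y → UClear f (neg x) (neg y)
UClear-neg {f = f} f-odd {x} {y} (uclear o e) = uclear
  ([ (λ h → inj₁ (cong neg h)) , (λ h → inj₂ (λ (a , b) → h (un 0ℤ (key-neg x) (key-neg y) a , un 0ℤ (f-key x) (f-key y) b))) ]′ o)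
  (λ z a b → e (neg z) (un (key (neg z)) (key-neg x) (key-neg y) (subst (λ k → Btwᶻ _ k _) (double z) a))
                       (un (key (f (neg z))) (f-key x) (f-key y) (subst (λ k → Btwᶻ _ k _) (double′ z) b)))
  where
  f-key : ∀ z → key (f (neg z)) ≡ - key (f z)
  f-key z = trans (cong key (f-odd z)) (key-neg (f z))
  double : ∀ z → key z ≡ - key (neg z)
  double z = trans (cong key (sym (neg-neg z))) (key-neg (neg z))
  double′ : ∀ z → key (f z) ≡ - key (f (neg z))
  double′ z = trans (cong (key ∘ f) (sym (neg-neg z))) (f-key (neg z))
  un : ∀ {a a′ c c′} b → a′ ≡ - a → c′ ≡ - c → Btwᶻ a′ (- b) c′ → Btwᶻ a b c
  un b refl refl h = Btwᶻ-neg⁻¹ h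

module _ {n} {f g : Elt n → Elt n} (odd-f : Odd f) {x y : Elt n} (g≗ : ∀ z → g z ≡ f (tr x y z)) where
  private
    gx : g x ≡ f y
    gx = trans (g≗ x) (cong f (tr-x x y))
    gy : g y ≡ f x
    gy = trans (g≗ y) (cong f (tr-y x y))

    empty-tr : y ≡ neg x ⊎ ¬ (Btwᶻ (key x) 0ℤ (key y) × Btwᶻ (key (f x)) 0ℤ (key (f y))) →
      (∀ z → Btwᶻ (key x) (key z) (key y) → ¬ Btwᶻ (key (f x)) (key (f z)) (key (f y))) →
      ∀ z → Btwᶻ (key x) (key z) (key y) → ¬ Btwᶻ (key (f y)) (key (g z)) (key (f x))
    empty-tr o e z a b with view x y z
    ... | isX refl = Btw-irreflˡ a
    ... | isY refl = Btw-irreflˡ (swap a)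
    ... | other p q r s = e z a (swap (subst (λ k → Btwᶻ (key (f y)) (key k) (key (f x))) (trans (g≗ z) (cong f (tr-by (other p q r s)))) b))
    empty-tr (inj₁ y≡nx) e z a b | isNX refl = Btw-irreflˡ (swap (subst (λ k → Btwᶻ (key x) (key (neg x)) (key k)) y≡nx a))
    empty-tr (inj₂ no-o) e z a b | isNX refl =
      no-o (Btw-neg⇒0 (subst (λ k → Btwᶻ (key x) k (key y)) (key-neg x) a) ,
            swap (Btw-neg⇒0 (subst (λ k → Btwᶻ (key (f y)) k (key (f x))) gz b)))
      where
      gz : key (g (neg x)) ≡ - key (f y)
      gz = trans (cong key (trans (g≗ (neg x)) (trans (cong f (trans (tr-neg x y x) (cong neg (tr-x x y)))) (odd odd-f y)))) (key-neg (f y))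
    empty-tr (inj₁ y≡nx) e z a b | isNY refl = Btw-irreflˡ (subst (λ k → Btwᶻ (key x) (key k) (key y)) (trans (cong neg y≡nx) (neg-neg x)) a)
    empty-tr (inj₂ no-o) e z a b | isNY refl =
      no-o (swap (Btw-neg⇒0 (subst (λ k → Btwᶻ (key y) k (key x)) (key-neg y) (swap a))) ,
            Btw-neg⇒0 (subst (λ k → Btwᶻ (key (f x)) k (key (f y))) gz (swap b)))
      where
      gz : key (g (neg y)) ≡ - key (f x)
      gz = trans (cong key (trans (g≗ (neg y)) (trans (cong f (trans (tr-neg x y y) (cong neg (tr-y x y)))) (odd odd-f x)))) (key-neg (f x))

  -- Exchanging the two values keeps the box in place and moves only points over ±x and ±y. A point
  -- over -x or -y could enter only together with the origin, unless y = -x, when it is a corner.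
  uclear-tr : UClear f x y → UClear g x y
  uclear-tr (uclear o e) = uclear
    ([ inj₁ , (λ h → inj₂ (λ (a , b) → h (a , swap (subst₂ (λ k m → Btwᶻ (key k) 0ℤ (key m)) gx gy b)))) ]′ o)
    (λ z a b → empty-tr o e z a (subst₂ (λ k m → Btwᶻ (key k) (key (g z)) (key m)) gx gy b))

module _ {n : ℕ} where

  key-mono : ∀ {i j : Fin n} → i F.< j → key {n} (false , i) ℤ.< key {n} (false , j)
  key-mono h = ℤ.+<+ (s≤s h)

  key-cancel : ∀ {i j : Fin n} → key {n} (false , i) ℤ.< key {n} (false , j) → i F.< j
  key-cancel (ℤ.+<+ (s≤s h)) = h

  -- The reflections are the maps tr (rx i j) (false , j), one for each pair (i , j).
  rx : Fin n → Fin n → Elt n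
  rx i j with F.<-cmp i j
  ... | tri< _ _ _ = false , i
  ... | tri≈ _ _ _ = true , i
  ... | tri> _ _ _ = true , i

  rx-< : ∀ {i j} → i F.< j → rx i j ≡ (false , i)
  rx-< {i} {j} h with F.<-cmp i j
  ... | tri< _ _ _  = refl
  ... | tri≈ ¬h _ _ = contradiction h ¬h
  ... | tri> ¬h _ _ = contradiction h ¬h

  rx-≮ : ∀ {i j} → ¬ (i F.< j) → rx i j ≡ (true , i)
  rx-≮ {i} {j} ¬h with F.<-cmp i j
  ... | tri< h _ _ = contradiction h ¬h
  ... | tri≈ _ _ _ = refl
  ... | tri> _ _ _ = refl

  rx< : ∀ i j → key (rx i j) ℤ.< key {n} (false , j)
  rx< i j with F.<-cmp i j
  ... | tri< h _ _ = key-mono h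
  ... | tri≈ _ _ _ = ℤ.-<+
  ... | tri> _ _ _ = ℤ.-<+

  rx-index : ∀ (i j : Fin n) → proj₂ (rx i j) ≡ i
  rx-index i j with F.<-cmp i j
  ... | tri< _ _ _ = refl
  ... | tri≈ _ _ _ = refl
  ... | tri> _ _ _ = refl

  rx-positive : ∀ (i j : Fin n) {k} → rx i j ≡ (false , k) → i F.< j
  rx-positive i j eq with F.<-cmp i j
  ... | tri< h _ _ = h
  ... | tri≈ _ _ _ with () ← eq
  ... | tri> _ _ _ with () ← eq

  rx-negative : ∀ (i j : Fin n) {k} → rx i j ≡ (true , k) → ¬ (i F.< j)
  rx-negative i j eq h with () ← trans (sym eq) (rx-< h)

  -- Evaluate both reflections at the positive corner `(false , j)`, which the first one sends to
  -- `rx i j`, and distinguish where the second one sends it.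
  tr-rx-injective : ∀ (i j i′ j′ : Fin n) → (∀ z → tr (rx i j) (false , j) z ≡ tr (rx i′ j′) (false , j′) z) → (i , j) ≡ (i′ , j′)
  tr-rx-injective i j i′ j′ h = go (view (rx i′ j′) (false , j′) (false , j)) (trans (sym (tr-y (rx i j) (false , j))) (h (false , j)))
    where
    x = rx i j
    x′ = rx i′ j′
    go : View x′ (false , j′) (false , j) → x ≡ tr x′ (false , j′) (false , j) → (i , j) ≡ (i′ , j′)
    go (isX p) eq = contradiction i′<j′ (ℕ.<-asym (subst₂ F._<_ i≡j′ j≡i′ i<j))
      where
      i′<j′ = rx-positive i′ j′ (sym p)
      x≡ : x ≡ (false , j′)
      x≡ = trans eq (tr-by (isX p))
      i<j = rx-positive i j x≡
      i≡j′ : i ≡ j′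
      i≡j′ = trans (sym (rx-index i j)) (cong proj₂ x≡)
      j≡i′ : j ≡ i′
      j≡i′ = trans (cong proj₂ p) (rx-index i′ j′)
    go (isY p) eq = cong₂ _,_ (trans (sym (rx-index i j)) (trans (cong proj₂ (trans eq (tr-by (isY p)))) (rx-index i′ j′))) (cong proj₂ p)
    go (isNX p) eq = cong₂ _,_ (trans i≡j j≡i′) (trans (sym i≡j) i≡j′)
      where
      x≡ : x ≡ (true , j′)
      x≡ = trans eq (tr-by (isNX p))
      i≡j′ : i ≡ j′
      i≡j′ = trans (sym (rx-index i j)) (cong proj₂ x≡)
      j≡i′ : j ≡ i′
      j≡i′ = trans (cong proj₂ p) (rx-index i′ j′)
      j≤i : j F.≤ i
      j≤i = ℕ.≮⇒≥ (rx-negative i j x≡)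
      x′≡ : x′ ≡ (true , j)
      x′≡ = trans (sym (neg-neg x′)) (cong neg (sym p))
      i≤j : i F.≤ j
      i≤j = subst₂ F._≤_ (sym i≡j′) (sym j≡i′) (ℕ.≮⇒≥ (rx-negative i′ j′ x′≡))
      i≡j : i ≡ j
      i≡j = F.toℕ-injective (ℕ.≤-antisym i≤j j≤i)
    go (isNY ()) eq
    go (other a b c d) eq = contradiction (trans (sym (rx-index i j)) (cong proj₂ x≡)) (λ i≡j → ℕ.<-irrefl (cong toℕ i≡j) (rx-positive i j x≡))
      where
      x≡ : x ≡ (false , j)
      x≡ = trans eq (tr-by (other a b c d))

module _ {n : ℕ} (π : W n) where
  private
    f = act π
    V = window π

  uclear⇒R : ∀ {i j} → UClear f (false , i) (false , j) → R V i j
  uclear⇒R (uclear _ e) k (inj₁ (a , b)) = e (false , k) (inj₁ (key-mono a , key-mono b))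
  uclear⇒R (uclear _ e) k (inj₂ (a , b)) = e (false , k) (inj₂ (key-mono a , key-mono b))

  R⇒uclear : ∀ {i j} → R V i j → UClear f (false , i) (false , j)
  R⇒uclear {i} {j} r = uclear (inj₂ (λ { (inj₁ (ℤ.+<+ () , _) , _) ; (inj₂ (ℤ.+<+ () , _) , _) })) e
    where
    e : ∀ z → Btwᶻ (key {n} (false , i)) (key z) (key {n} (false , j)) → ¬ Btwᶻ (V i) (key (f z)) (V j)
    e (false , k) (inj₁ (a , b)) = r k (inj₁ (key-cancel a , key-cancel b))
    e (false , k) (inj₂ (a , b)) = r k (inj₂ (key-cancel a , key-cancel b))
    e (true  , k) (inj₁ (() , _))
    e (true  , k) (inj₂ (() , _))

  V-neg : ∀ i → key (f (true , i)) ≡ - V i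
  V-neg i = trans (cong key (act-odd π (false , i))) (key-neg (lookup π i))

  private
    turn : ∀ {i j k} → Btwᶻ (- V i) (- V k) (V j) → Btwᶻ (- V j) (V k) (V i)
    turn {i} {j} {k} h = swap (subst₂ (λ a b → Btwᶻ a b (- V j)) (ℤ.neg-involutive _) (ℤ.neg-involutive _) (Btwᶻ-neg h))

    turn⁻¹ : ∀ {i j k} → Btwᶻ (- V j) (V k) (V i) → Btwᶻ (- V i) (- V k) (V j)
    turn⁻¹ {i} {j} {k} h = swap (subst (λ a → Btwᶻ a (- V k) (- V i)) (ℤ.neg-involutive _) (Btwᶻ-neg h))

  -- A point over a negative position -k appears in `D` through its antipode over k, tested against
  -- the box turned by 180 degrees.
  empty⇒D : ∀ {i j} → (∀ z → Btwᶻ (key {n} (true , i)) (key z) (key {n} (false , j)) → ¬ Btwᶻ (key (f (true , i))) (key (f z)) (V j)) → D V i j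
  empty⇒D {i} {j} e k =
    (λ k<j b → e (false , k) (inj₁ (ℤ.-<+ , key-mono k<j)) (subst (λ a → Btwᶻ a (V k) (V j)) (sym (V-neg i)) b)) ,
    (λ k<i b → e (true , k) (inj₁ (ℤ.-<- k<i , ℤ.-<+)) (subst₂ (λ a c → Btwᶻ a c (V j)) (sym (V-neg i)) (sym (V-neg k)) (turn⁻¹ b)))

  D⇒empty : ∀ {i j} → D V i j → ∀ z → Btwᶻ (key {n} (true , i)) (key z) (key {n} (false , j)) → ¬ Btwᶻ (key (f (true , i))) (key (f z)) (V j)
  D⇒empty {i} {j} d (false , k) (inj₁ (_ , b)) h = proj₁ (d k) (key-cancel b) (subst (λ a → Btwᶻ a (V k) (V j)) (V-neg i) h)
  D⇒empty {i} {j} d (true  , k) (inj₁ (ℤ.-<- a , _)) h = proj₂ (d k) a (turn (subst₂ (λ a c → Btwᶻ a c (V j)) (V-neg i) (V-neg k) h))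
  D⇒empty d z (inj₂ (a , b)) with () ← ℤ.<-trans a b

  edge⇒uclear : ∀ i j → Edge V i j → UClear f (rx i j) (false , j)
  edge⇒uclear i j h with F.<-cmp i j
  ... | tri< _ _ _    = R⇒uclear h
  ... | tri≈ _ refl _ = uclear (inj₁ refl) (D⇒empty h)
  ... | tri> _ _ _    = uclear (inj₂ (λ (_ , b) → proj₁ h (subst (λ a → Btwᶻ a 0ℤ (V j)) (V-neg i) b))) (D⇒empty (proj₂ h))

  uclear⇒edge : ∀ i j → UClear f (rx i j) (false , j) → Edge V i j
  uclear⇒edge i j h with F.<-cmp i j
  ... | tri< _ _ _    = uclear⇒R h
  ... | tri≈ _ refl _ = empty⇒D (UClear.empty h)
  ... | tri> _ i≢j _  = [ (λ eq → contradiction (sym (cong proj₂ eq)) i≢j) ,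
      (λ o b → o (inj₁ (ℤ.-<+ , ℤ.+<+ (s≤s z≤n)) , subst (λ a → Btwᶻ a 0ℤ (V j)) (sym (V-neg i)) b)) ]′ (UClear.origin h) ,
      empty⇒D (UClear.empty h)

  Normal : Elt n → Elt n → Set
  Normal x y = ∃[ i ] ∃[ j ] (Edge V i j × (∀ z → tr x y z ≡ tr (rx i j) (false , j) z))

  normal : ∀ {x y} i j → (rx i j ≡ x) → (false , j) ≡ y → UClear f x y → Normal x y
  normal i j refl refl u = i , j , uclear⇒edge i j u , λ z → refl

  normal-swap : ∀ {x y} → Normal y x → Normal x y
  normal-swap {x} {y} (i , j , e , h) = i , j , e , λ z → trans (sym (tr-comm x y z)) (h z)

  normal-neg : ∀ {x y} → Normal (neg x) (neg y) → Normal x y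
  normal-neg {x} {y} (i , j , e , h) = i , j , e , λ z → trans (sym (tr-negs x y z)) (h z)

  -- Exchanging the corners and negating both of them leaves the reflection unchanged; this suffices
  -- to make the second corner positive and the first one of the form `rx i j`.
  normalise : ∀ x y → x ≢ y → UClear f x y → Normal x y
  normalise (false , i) (false , j) ne u with F.<-cmp i j
  ... | tri< h _ _    = normal i j (rx-< h) refl u
  ... | tri≈ _ refl _ = contradiction refl ne
  ... | tri> _ _ h    = normal-swap (normal j i (rx-< h) refl (UClear-swap u))
  normalise (true , i) (false , j) ne u with i F.<? j
  ... | no ¬h = normal i j (rx-≮ ¬h) refl u
  ... | yes h = normal-neg (normal-swap (normal j i (rx-≮ (ℕ.<-asym h)) refl (UClear-swap (UClear-neg (act-odd π) u))))
  normalise (false , i) (true , j) ne u = normal-swap (normalise (true , j) (false , i) (ne ∘ sym) (UClear-swap u))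
  normalise (true , i) (true , j) ne u = normal-neg (normalise (false , i) (false , j) (ne ∘ cong neg) (UClear-neg (act-odd π) u))

-- The degree in the Hasse diagram

module _ {n : ℕ} (π : W n) (d : DistinctAbs π) where
  private V = window π

  neighbour : Fin n × Fin n → W n
  neighbour (i , j) = π ∘ˢ refl-vec (rx i j) (false , j)

  covered⇒uclear : ∀ {v} → DistinctAbs v → Covers v π → ∃[ x ] ∃[ y ] (x ≢ y × UClear (act π) x y × v ≡ π ∘ˢ refl-vec x y)
  covered⇒uclear {v} dv cov with x , y , (a , b) , c , π≡ ← covers⇒clear {u = v} dv cov =
    x , y , <⇒≢ a ,
    uclear-tr (Odd-act {π = v} dv) (λ z → trans (cong (λ r → act r z) π≡) (act-∘-refl v x y z)) (clear⇒uclear a b c) ,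
    trans (sym (∘-refl-refl v x y)) (cong (_∘ˢ refl-vec x y) (sym π≡))

  adjacent⇒uclear : ∀ {v} → Adjacent π v → ∃[ x ] ∃[ y ] (x ≢ y × UClear (act π) x y × v ≡ π ∘ˢ refl-vec x y)
  adjacent⇒uclear (inj₁ cov) with x , y , (a , b) , c , v≡ ← covers⇒clear {u = π} d cov = x , y , <⇒≢ a , clear⇒uclear a b c , v≡
  adjacent⇒uclear {v} (inj₂ cov) = covered⇒uclear {v} (InB⇒distinct v (proj₁ cov)) cov

  adjacent⇒edge : ∀ {v} → Adjacent π v → ∃[ i ] ∃[ j ] (Edge V i j × v ≡ neighbour (i , j))
  adjacent⇒edge {v} adj with x , y , x≢y , u , v≡ ← adjacent⇒uclear adj
    with i , j , e , h ← normalise π x y x≢y u =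
    i , j , e , trans v≡ (cong (π ∘ˢ_) (act-ext λ z → trans (act-refl x y z) (trans (h z) (sym (act-refl (rx i j) (false , j) z)))))

  -- An empty box does not tell which of the two elements is the lower one; the order of the values
  -- at its corners does.
  edge⇒adjacent : ∀ i j → Edge V i j → Adjacent π (neighbour (i , j))
  edge⇒adjacent i j e = go (ℤ.<-cmp (key (act π x)) (key (act π y)))
    where
    x = rx i j
    y : Elt n
    y = false , j
    w = π ∘ˢ refl-vec x y
    dw : DistinctAbs w
    dw = DistinctAbs-∘-refl {π = π} d x y
    u : UClear (act π) x y
    u = edge⇒uclear π i j e
    u′ : UClear (act w) x y
    u′ = uclear-tr (Odd-act {π = π} d) (act-∘-refl π x y) u
    go : Tri (key (act π x) ℤ.< key (act π y)) (key (act π x) ≡ key (act π y)) (key (act π y) ℤ.< key (act π x)) → Adjacent π w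
    go (tri< lt _ _) = inj₁ (clear⇒covers {u = π} d (rx< i j , lt) (uclear⇒clear u))
    go (tri≈ _ eq _) = contradiction (inj (Odd-act {π = π} d) (key-injective eq)) (<⇒≢ (rx< i j))
    go (tri> _ _ gt) = inj₂ (subst (Covers w) (∘-refl-refl π x y)
      (clear⇒covers {u = w} dw (descent⇒ascent π (rx< i j) gt) (uclear⇒clear u′)))

  neighbour-injective : ∀ {p q} → neighbour p ≡ neighbour q → p ≡ q
  neighbour-injective {i , j} {i′ , j′} eq = tr-rx-injective i j i′ j′ λ z →
    inj (Odd-act {π = π} d) (trans (sym (act-∘-refl π (rx i j) (false , j) z))
      (trans (cong (λ r → act r z) eq) (act-∘-refl π (rx i′ j′) (false , j′) z)))

  Edge′? : (p : Fin n × Fin n) → Dec (Edge V (proj₁ p) (proj₂ p))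
  Edge′? (i , j) = Edge? V i j

  neighbours : List (W n)
  neighbours = List.map neighbour (filter Edge′? (cartesianProduct (allFin n) (allFin n)))

  neighbours-unique : Unique neighbours
  neighbours-unique = Unique.map⁺ neighbour-injective
    (Unique.filter⁺ Edge′? (Unique.cartesianProduct⁺ (Unique.allFin⁺ n) (Unique.allFin⁺ n)))

  ∈-neighbours : ∀ v → v ∈ neighbours ⇔ Adjacent π v
  ∈-neighbours v = mk⇔ to from
    where
    to : v ∈ neighbours → Adjacent π v
    to m with (i , j) , m′ , refl ← ∈-map⁻ neighbour m =
      edge⇒adjacent i j (proj₂ (∈-filter⁻ Edge′? {xs = cartesianProduct (allFin n) (allFin n)} m′))
    from : Adjacent π v → v ∈ neighbours
    from adj with i , j , e , refl ← adjacent⇒edge adj =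
      ∈-map⁺ neighbour (∈-filter⁺ Edge′? (∈-cartesianProduct⁺ (∈-allFin i) (∈-allFin j)) e)

-- From the number of edges to the maximum degree

length-filter-++ : ∀ {A : Set} {P : A → Set} (P? : ∀ a → Dec (P a)) {m} (g : Fin m → A) ys →
  length (filter P? (List.tabulate g ++ ys)) ≡ sum (ι ∘ P? ∘ g) + length (filter P? ys)
length-filter-++ P? {zero}  g ys = refl
length-filter-++ P? {suc m} g ys with does (P? (g zero))
... | true  = cong suc (length-filter-++ P? (g ∘ suc) ys)
... | false = length-filter-++ P? (g ∘ suc) ys

length-filter-product : ∀ {A : Set} {n m} {P : A × Fin n → Set} (P? : ∀ a → Dec (P a)) (g : Fin m → A) →
  length (filter P? (cartesianProduct (List.tabulate g) (allFin n))) ≡ sum (λ i → sum (λ j → ι (P? (g i , j))))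
length-filter-product {m = zero}  P? g = refl
length-filter-product {n = n} {suc m} P? g = trans
  (cong (λ r → length (filter P? (r ++ cartesianProduct (List.tabulate (g ∘ suc)) (allFin n)))) (List.map-tabulate id (g zero ,_)))
  (trans (length-filter-++ P? (λ j → (g zero , j)) _) (cong (sum (λ j → ι (P? (g zero , j))) +_) (length-filter-product P? (g ∘ suc))))

hasDegree : ∀ {n} (π : W n) → DistinctAbs π → HasDegree π (degree (window π))
hasDegree {n} π d = neighbours π d , neighbours-unique π d ,
  trans (List.length-map (neighbour π d) (filter (Edge′? π d) (cartesianProduct (allFin n) (allFin n)))) (length-filter-product (Edge′? π d) id) , ∈-neighbours π d

unique⇒lookup-injective : ∀ {A : Set} {xs : List A} → Unique xs → ∀ {i j} → List.lookup xs i ≡ List.lookup xs j → i ≡ j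
unique⇒lookup-injective (x∉ ∷ u) {zero}  {zero}  eq = refl
unique⇒lookup-injective (x∉ ∷ u) {zero}  {suc j} eq = contradiction eq (All.lookup x∉ (∈-lookup j))
unique⇒lookup-injective (x∉ ∷ u) {suc i} {zero}  eq = contradiction (sym eq) (All.lookup x∉ (∈-lookup i))
unique⇒lookup-injective (x∉ ∷ u) {suc i} {suc j} eq = cong suc (unique⇒lookup-injective u eq)

unique-⊆⇒length≤ : ∀ {A : Set} {xs ys : List A} → Unique xs → (∀ {x} → x ∈ xs → x ∈ ys) → length xs ≤ length ys
unique-⊆⇒length≤ {xs = xs} {ys} u sub = F.injective⇒≤ {f = λ i → Any.index (sub (∈-lookup {xs = xs} i))} λ {i} {j} eq →
  unique⇒lookup-injective u (trans (lookup-index (sub (∈-lookup {xs = xs} i)))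
    (trans (cong (List.lookup ys) eq) (sym (lookup-index (sub (∈-lookup {xs = xs} j))))))

degree-unique : ∀ {n} {π : W n} {k m} → HasDegree π k → HasDegree π m → k ≤ m
degree-unique (xs , u , refl , h) (ys , _ , refl , h′) =
  unique-⊆⇒length≤ u (λ {v} m → Equivalence.from (h′ v) (Equivalence.to (h v) m))

maxDegree-intro : ∀ {n M} → (∀ (π : W n) → DistinctAbs π → degree (window π) ≤ M) →
  (π : W n) → DistinctAbs π → M ≤ degree (window π) → MaxDegree n M
maxDegree-intro {n} {M} upper π d lower =
  (π , distinct⇒InB π d , subst (HasDegree π) (ℕ.≤-antisym (upper π d) lower) (hasDegree π d)) ,
  λ σ k inB h → let dσ = InB⇒distinct σ inB in ℕ.≤-trans (degree-unique {π = σ} h (hasDegree σ dσ)) (upper σ dσ)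

window-signed : ∀ {n} {π : W n} → DistinctAbs π → Signed (window π)
window-signed {π = π} d = (λ eq → d (cong proj₂ (key-injective eq))) , anti
  where
  anti : ∀ i j → window π i ≢ - window π j
  anti i j eq = contra (d {i} {j} (cong proj₂ eq′)) eq′
    where
    eq′ : lookup π i ≡ neg (lookup π j)
    eq′ = key-injective (trans eq (sym (key-neg (lookup π j))))
    contra : i ≡ j → lookup π i ≢ neg (lookup π j)
    contra refl h = z≢neg (lookup π i) h

-- The sequence 1, …, p, -(p+q), …, -(p+1)

sum-split : ∀ p {q} (f : Fin (p + q) → ℕ) → sum f ≡ sum (λ i → f (i ↑ˡ q)) + sum (λ j → f (p ↑ʳ j))
sum-split zero    f = refl
sum-split (suc p) f = trans (cong (f zero +_) (sum-split p (f ∘ suc))) (sym (ℕ.+-assoc (f zero) _ _))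

sum≥ : ∀ {n} {f : Fin n → ℕ} {c} → (∀ i → c ≤ f i) → n * c ≤ sum f
sum≥ {n} {f} {c} h = ℕ.≤-trans (ℕ.≤-reflexive (sym (sum-const n c))) (sum-mono h)

columns≥ : ∀ {n} (M : Fin n → Fin n → ℕ) → (∀ j → ∃[ i ] 1 ≤ M i j) → n ≤ total M
columns≥ {n} M h = ℕ.≤-trans (ℕ.≤-reflexive (sym (ℕ.*-identityʳ n))) (ℕ.≤-trans
  (sum≥ (λ j → ℕ.≤-trans (proj₂ (h j)) (f≤sum (λ i → M i j) (proj₁ (h j)))))
  (ℕ.≤-reflexive (sym (∑-comm {n} {n} M))))

columns≥′ : ∀ {n} (M : Fin (suc n) → Fin (suc n) → ℕ) → (∀ j → ∃[ i ] 1 ≤ M i (suc j)) → n ≤ total M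
columns≥′ {n} M h = ℕ.≤-trans (ℕ.≤-reflexive (sym (ℕ.*-identityʳ n))) (ℕ.≤-trans
  (ℕ.≤-trans (sum≥ (λ j → ℕ.≤-trans (proj₂ (h j)) (f≤sum (λ i → M i (suc j)) (proj₁ (h j)))))
             (ℕ.m≤n+m _ (sum (λ i → M i zero))))
  (ℕ.≤-reflexive (sym (∑-comm {suc n} {suc n} M))))

module _ {n} (V : Fin n → ℤ) where

  edge-R : ∀ {i j} → i F.< j → R V i j → 1 ≤ edge# V i j
  edge-R {i} {j} lt r with F.<-cmp i j
  ... | tri< _ _ _  = ℕ.≤-reflexive (sym (ι-yes (R? V i j) r))
  ... | tri≈ ¬h _ _ = contradiction lt ¬h
  ... | tri> ¬h _ _ = contradiction lt ¬h

  edge-L : ∀ {i j} → j F.< i → L V i j → 1 ≤ edge# V i j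
  edge-L {i} {j} gt l with F.<-cmp i j
  ... | tri> _ _ _  = ℕ.≤-reflexive (sym (ι-yes (L? V i j) l))
  ... | tri≈ _ _ ¬h = contradiction gt ¬h
  ... | tri< _ _ ¬h = contradiction gt ¬h

  edge-D : ∀ {i} → D V i i → 1 ≤ edge# V i i
  edge-D {i} d = ℕ.≤-reflexive (sym (trans (edge-diag V i) (ι-yes (D? V i i) d)))

  adjacent-R : ∀ {i j} → toℕ j ≡ suc (toℕ i) → R V i j
  adjacent-R {i} {j} eq k (inj₁ (a , b)) _ = ℕ.<⇒≱ a (ℕ.≤-pred (ℕ.≤-trans b (ℕ.≤-reflexive eq)))
  adjacent-R {i} {j} eq k (inj₂ (a , b)) _ = ℕ.<⇒≱ (ℕ.<-trans a b) (ℕ.≤-trans (ℕ.n≤1+n _) (ℕ.≤-reflexive (sym eq)))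

-- An increasing positive block followed by an increasing negative block of larger absolute values.
-- Then every pair across the blocks carries both an `R` edge and an `L` edge.
record TwoChains {n} (p : ℕ) (V : Fin n → ℤ) : Set where
  field
    pos  : ∀ {i} → toℕ i < p → 0ℤ ℤ.< V i
    negs : ∀ {i} → p ≤ toℕ i → V i ℤ.< 0ℤ
    inc⁺ : ∀ {i k} → i F.< k → toℕ k < p → V i ℤ.< V k
    inc⁻ : ∀ {i k} → p ≤ toℕ i → i F.< k → V i ℤ.< V k
    far  : ∀ {i j} → toℕ i < p → p ≤ toℕ j → V i ℤ.< - V j

module _ {n p} {V : Fin n → ℤ} (tc : TwoChains p V) where
  open TwoChains tc

  chains-R : ∀ {i j} → toℕ i < p → p ≤ toℕ j → R V i j
  chains-R {i} {j} i<p p≤j k (inj₂ (a , b)) _ = ℕ.<⇒≱ (ℕ.<-trans a b) (ℕ.≤-trans (ℕ.<⇒≤ i<p) p≤j)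
  chains-R {i} {j} i<p p≤j k (inj₁ (i<k , k<j)) b with toℕ k ℕ.<? p
  chains-R {i} {j} i<p p≤j k (inj₁ (i<k , k<j)) (inj₁ (_ , h)) | yes k<p = ℤ.<-asym (pos k<p) (ℤ.<-trans h (negs p≤j))
  chains-R {i} {j} i<p p≤j k (inj₁ (i<k , k<j)) (inj₂ (_ , h)) | yes k<p = ℤ.<-asym h (inc⁺ i<k k<p)
  chains-R {i} {j} i<p p≤j k (inj₁ (i<k , k<j)) (inj₁ (h , _)) | no k≮p = ℤ.<-asym (ℤ.<-trans (pos i<p) h) (negs (ℕ.≮⇒≥ k≮p))
  chains-R {i} {j} i<p p≤j k (inj₁ (i<k , k<j)) (inj₂ (h , _)) | no k≮p = ℤ.<-asym h (inc⁻ (ℕ.≮⇒≥ k≮p) k<j)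

  chains-L : ∀ {i j} → toℕ i < p → p ≤ toℕ j → L V j i
  chains-L {i} {j} i<p p≤j = origin , λ k → first k , second k
    where
    origin : ¬ Btwᶻ (- V j) 0ℤ (V i)
    origin (inj₁ (h , _)) = ℤ.<-asym h (pos-neg (negs p≤j))
    origin (inj₂ (h , _)) = ℤ.<-asym h (pos i<p)
    first : ∀ k → k F.< i → ¬ Btwᶻ (- V j) (V k) (V i)
    first k k<i (inj₁ (h , _)) = ℤ.<-asym (ℤ.<-trans h (inc⁺ k<i i<p)) (far i<p p≤j)
    first k k<i (inj₂ (h , _)) = ℤ.<-asym h (inc⁺ k<i i<p)
    second : ∀ k → k F.< j → ¬ Btwᶻ (- V i) (V k) (V j)
    second k k<j (inj₁ (h , h′)) = ℤ.<-asym (ℤ.<-trans h h′) (neg-flip (far i<p p≤j))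
    second k k<j (inj₂ (h , h′)) with toℕ k ℕ.<? p
    ... | yes k<p = ℤ.<-asym (ℤ.<-trans (pos k<p) h′) (neg-pos (pos i<p))
    ... | no k≮p  = ℤ.<-asym h (inc⁻ (ℕ.≮⇒≥ k≮p) k<j)

-- With n = p + q this is 2pq + n - 1: two edges for each pair across the blocks, n - 2 edges
-- between consecutive positions within a block, and one sign change. For p = ⌊n/2⌋ the product 2pq
-- equals ⌊n²/2⌋.
chains-degree : ∀ p′ q′ (V : Fin (suc p′ + suc q′) → ℤ) → TwoChains (suc p′) V →
  suc p′ + suc p′ * suc q′ + (suc q′ * suc p′ + q′) ≤ degree V
chains-degree p′ q′ V tc = begin
  p + p * q + (q * p + q′)
    ≤⟨ ℕ.+-mono-≤ (ℕ.+-mono-≤ blockAA blockAB) (ℕ.+-mono-≤ blockBA blockBB) ⟩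
  total AA + sum (λ i → sum (AB i)) + (sum (λ i → sum (BA i)) + total BB)
    ≡⟨ cong₂ _+_ (∑-distrib-+ {p} (λ i → sum (AA i)) (λ i → sum (AB i))) (∑-distrib-+ {q} (λ i → sum (BA i)) (λ i → sum (BB i))) ⟨
  sum {p} (λ i → sum (AA i) + sum (AB i)) + sum {q} (λ i → sum (BA i) + sum (BB i))
    ≡⟨ cong₂ _+_ (sum-cong-≗ {p} (λ i → sum-split p (edge# V (i ↑ˡ q)))) (sum-cong-≗ {q} (λ i → sum-split p (edge# V (p ↑ʳ i)))) ⟨
  sum {p} (λ i → sum (edge# V (i ↑ˡ q))) + sum {q} (λ i → sum (edge# V (p ↑ʳ i)))
    ≡⟨ sum-split p (λ i → sum (edge# V i)) ⟨
  degree V ∎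
  where
  open ℕ.≤-Reasoning
  p = suc p′
  q = suc q′
  AA : Fin p → Fin p → ℕ
  AA i j = edge# V (i ↑ˡ q) (j ↑ˡ q)
  AB : Fin p → Fin q → ℕ
  AB i j = edge# V (i ↑ˡ q) (p ↑ʳ j)
  BA : Fin q → Fin p → ℕ
  BA i j = edge# V (p ↑ʳ i) (j ↑ˡ q)
  BB : Fin q → Fin q → ℕ
  BB i j = edge# V (p ↑ʳ i) (p ↑ʳ j)
  i<p : ∀ (i : Fin p) → toℕ (i ↑ˡ q) < p
  i<p i = ℕ.≤-trans (s≤s (ℕ.≤-reflexive (F.toℕ-↑ˡ i q))) (F.toℕ<n i)
  p≤j : ∀ (j : Fin q) → p ≤ toℕ (p ↑ʳ j)
  p≤j j = ℕ.≤-trans (ℕ.m≤m+n p (toℕ j)) (ℕ.≤-reflexive (sym (F.toℕ-↑ʳ p j)))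
  blockAA : p ≤ total AA
  blockAA = columns≥ AA λ where
    -- The first column is credited with the sign change of the first entry, whose box no other
    -- position can meet.
    zero    → zero , edge-D V {zero} (λ k → (λ ()) , (λ ()))
    (suc j) → let eq = trans (F.toℕ-↑ˡ (suc j) q) (cong suc (trans (sym (F.toℕ-inject₁ j)) (sym (F.toℕ-↑ˡ (F.inject₁ j) q)))) in
              F.inject₁ j , edge-R V (ℕ.≤-reflexive (sym eq)) (adjacent-R V eq)
  blockBB : q′ ≤ total BB
  blockBB = columns≥′ BB λ j →
    let eq = trans (F.toℕ-↑ʳ p (suc j)) (trans (ℕ.+-suc p (toℕ j)) (cong suc (trans (cong (p +_) (sym (F.toℕ-inject₁ j))) (sym (F.toℕ-↑ʳ p (F.inject₁ j)))))) in
    F.inject₁ j , edge-R V (ℕ.≤-reflexive (sym eq)) (adjacent-R V eq)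
  blockAB : p * q ≤ sum (λ i → sum (AB i))
  blockAB = sum≥ {p} (λ i → ℕ.≤-trans (ℕ.≤-reflexive (sym (ℕ.*-identityʳ q))) (sum≥ {q} (λ j →
    edge-R V (ℕ.≤-trans (i<p i) (p≤j j)) (chains-R tc (i<p i) (p≤j j)))))
  blockBA : q * p ≤ sum (λ i → sum (BA i))
  blockBA = sum≥ {q} (λ i → ℕ.≤-trans (ℕ.≤-reflexive (sym (ℕ.*-identityʳ p))) (sum≥ {p} (λ j →
    edge-L V (ℕ.≤-trans (i<p j) (p≤j i)) (chains-L tc (i<p j) (p≤j i)))))

module Extremal (p q′ : ℕ) where
  private
    n = p + suc q′
    -- `c ∸ i` reverses the interval from p to p + q′, which holds both the zero-based positions and
    -- the zero-based absolute values of the negative block.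
    c = p + (p + q′)

    i≤p+q′ : ∀ (i : Fin n) → toℕ i ≤ p + q′
    i≤p+q′ i = ℕ.≤-pred (ℕ.≤-trans (F.toℕ<n i) (ℕ.≤-reflexive (ℕ.+-suc p q′)))

    i≤c : ∀ (i : Fin n) → toℕ i ≤ c
    i≤c i = ℕ.≤-trans (i≤p+q′ i) (ℕ.m≤n+m _ p)

    c∸i<n : ∀ {i} → p ≤ i → c ∸ i < n
    c∸i<n {i} p≤i = ℕ.≤-trans (s≤s (ℕ.≤-trans (ℕ.∸-monoʳ-≤ c p≤i) (ℕ.≤-reflexive (ℕ.m+n∸m≡n p (p + q′))))) (ℕ.≤-reflexive (sym (ℕ.+-suc p q′)))

    p≤c∸i : ∀ (i : Fin n) → p ≤ c ∸ toℕ i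
    p≤c∸i i = ℕ.≤-trans (ℕ.≤-reflexive (sym (ℕ.m+n∸n≡m p (p + q′)))) (ℕ.∸-monoʳ-≤ c (i≤p+q′ i))

  valueBy : ∀ (i : Fin n) → Dec (toℕ i < p) → Elt n
  valueBy i (yes _)  = false , i
  valueBy i (no i≮p) = true , F.fromℕ< (c∸i<n (ℕ.≮⇒≥ i≮p))

  value : Fin n → Elt n
  value i = valueBy i (toℕ i ℕ.<? p)

  extremal : W n
  extremal = tabulate value

  private
    ∣value∣ : ∀ (i : Fin n) → Dec (toℕ i < p) → ℕ
    ∣value∣ i (yes _) = toℕ i
    ∣value∣ i (no _)  = c ∸ toℕ i

    toℕ-value : ∀ i (t : Dec (toℕ i < p)) → toℕ (proj₂ (valueBy i t)) ≡ ∣value∣ i t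
    toℕ-value i (yes _)  = refl
    toℕ-value i (no i≮p) = F.toℕ-fromℕ< (c∸i<n (ℕ.≮⇒≥ i≮p))

    ∣value∣-injective : ∀ i j (s : Dec (toℕ i < p)) (t : Dec (toℕ j < p)) → ∣value∣ i s ≡ ∣value∣ j t → i ≡ j
    ∣value∣-injective i j (yes _)   (yes _)   eq = F.toℕ-injective eq
    ∣value∣-injective i j (yes i<p) (no _)    eq = contradiction (ℕ.≤-trans (p≤c∸i j) (ℕ.≤-reflexive (sym eq))) (ℕ.<⇒≱ i<p)
    ∣value∣-injective i j (no _)    (yes j<p) eq = contradiction (ℕ.≤-trans (p≤c∸i i) (ℕ.≤-reflexive eq)) (ℕ.<⇒≱ j<p)
    ∣value∣-injective i j (no _)    (no _)    eq = F.toℕ-injective (ℕ.∸-cancelˡ-≡ (i≤c i) (i≤c j) eq)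

  extremal-distinct : DistinctAbs extremal
  extremal-distinct {i} {j} eq = ∣value∣-injective i j (toℕ i ℕ.<? p) (toℕ j ℕ.<? p)
    (trans (sym (toℕ-value i (toℕ i ℕ.<? p))) (trans (cong toℕ (trans (cong proj₂ (sym (lookup∘tabulate value i))) (trans eq (cong proj₂ (lookup∘tabulate value j)))))
      (toℕ-value j (toℕ j ℕ.<? p))))

  private
    V = window extremal

    V⁺ : ∀ {i} → toℕ i < p → V i ≡ +[1+ toℕ i ]
    V⁺ {i} i<p = trans (cong key (lookup∘tabulate value i)) (by (toℕ i ℕ.<? p))
      where
      by : ∀ t → key (valueBy i t) ≡ +[1+ toℕ i ]
      by (yes _)  = refl
      by (no i≮p) = contradiction i<p i≮p

    V⁻ : ∀ {i} → p ≤ toℕ i → V i ≡ -[1+ c ∸ toℕ i ]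
    V⁻ {i} p≤i = trans (cong key (lookup∘tabulate value i)) (by (toℕ i ℕ.<? p))
      where
      by : ∀ t → key (valueBy i t) ≡ -[1+ c ∸ toℕ i ]
      by (yes i<p) = contradiction p≤i (ℕ.<⇒≱ i<p)
      by (no i≮p)  = cong -[1+_] (F.toℕ-fromℕ< (c∸i<n (ℕ.≮⇒≥ i≮p)))

  extremal-chains : TwoChains p V
  extremal-chains = record
    { pos  = λ i<p → subst (0ℤ ℤ.<_) (sym (V⁺ i<p)) (ℤ.+<+ (s≤s z≤n))
    ; negs = λ p≤i → subst (ℤ._< 0ℤ) (sym (V⁻ p≤i)) ℤ.-<+
    ; inc⁺ = λ i<k k<p → subst₂ ℤ._<_ (sym (V⁺ (ℕ.<-trans i<k k<p))) (sym (V⁺ k<p)) (ℤ.+<+ (s≤s i<k))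
    ; inc⁻ = λ {i} {k} p≤i i<k → subst₂ ℤ._<_ (sym (V⁻ p≤i)) (sym (V⁻ (ℕ.≤-trans p≤i (ℕ.<⇒≤ i<k)))) (ℤ.-<- (ℕ.∸-monoʳ-< i<k (i≤c k)))
    ; far  = λ {i} {j} i<p p≤j → subst₂ (λ a b → a ℤ.< - b) (sym (V⁺ i<p)) (sym (V⁻ p≤j)) (ℤ.+<+ (s≤s (ℕ.≤-trans i<p (p≤c∸i j))))
    }

-- The choice of the block lengths

Attains : ℕ → ℕ → Set
Attains n M = ∃[ π ] (DistinctAbs {n} π × M ≤ degree (window π))

extremal-attains : ∀ p′ q′ → Attains (suc p′ + suc q′) (suc p′ + suc p′ * suc q′ + (suc q′ * suc p′ + q′))
extremal-attains p′ q′ = extremal , extremal-distinct , chains-degree p′ q′ (window extremal) extremal-chains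
  where open Extremal (suc p′) q′

-- The predecessors of ⌊n/2⌋ and ⌈n/2⌉ for n = 5 + m, in steps of two to match the recursion of
-- `maxDegree`.
halves : ℕ → ℕ × ℕ
halves 0             = 1 , 2
halves 1             = 2 , 2
halves (suc (suc m)) = suc (proj₁ (halves m)) , suc (proj₂ (halves m))

halves-sum : ∀ m → suc (proj₁ (halves m)) + suc (proj₂ (halves m)) ≡ 5 + m
halves-sum 0 = refl
halves-sum 1 = refl
halves-sum (suc (suc m)) = trans (cong suc (ℕ.+-suc (suc (proj₁ (halves m))) (suc (proj₂ (halves m))))) (cong (λ k → suc (suc k)) (halves-sum m))

halves-degree : ∀ m → let p = suc (proj₁ (halves m)) ; q′ = proj₂ (halves m) ; q = suc q′ in
  p + p * q + (q * p + q′) ≡ maxDegree m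
halves-degree 0 = refl
halves-degree 1 = refl
halves-degree (suc (suc m)) = begin
  suc p + suc p * suc q + (suc q * suc p + q)              ≡⟨ arith p q′ ⟩
  (p + p * q + (q * p + q′)) + (2 * (p + q) + 4)           ≡⟨ cong₂ (λ a b → a + (2 * b + 4)) (halves-degree m) (halves-sum m) ⟩
  maxDegree m + (2 * (5 + m) + 4)                          ≡⟨ cong (maxDegree m +_) (arith′ m) ⟩
  maxDegree m + 2 * (7 + m)                                ∎
  where
  open ≡-Reasoning
  p = suc (proj₁ (halves m))
  q′ = proj₂ (halves m)
  q = suc q′
  arith : ∀ p q′ → suc p + suc p * suc (suc q′) + (suc (suc q′) * suc p + suc q′) ≡ (p + p * suc q′ + (suc q′ * p + q′)) + (2 * (p + suc q′) + 4)
  arith = solve-∀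
  arith′ : ∀ m → 2 * (5 + m) + 4 ≡ 2 * (7 + m)
  arith′ = solve-∀

maxDegree-attained : ∀ m → Attains (5 + m) (maxDegree m)
maxDegree-attained m = subst₂ Attains (halves-sum m) (halves-degree m) (extremal-attains (proj₁ (halves m)) (proj₂ (halves m)))

-- (n + 2)² exceeds n² by the even number 2 (2n + 2), so the rounding is the same for both and the
-- two-step recursion is respected.
maxDegree-formula : ∀ m → maxDegree m ≡ (5 + m) * (5 + m) / 2 + (5 + m) ∸ 1
maxDegree-formula m = trans (shifted m) (cong (_∸ 1) (sym (ℕ.+-suc ((5 + m) * (5 + m) / 2) (4 + m))))
  where
  shifted : ∀ m → maxDegree m ≡ (5 + m) * (5 + m) / 2 + (4 + m)
  shifted 0 = refl
  shifted 1 = refl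
  shifted (suc (suc m)) = begin
    maxDegree m + 2 * (7 + m)                                   ≡⟨ cong (_+ 2 * (7 + m)) (shifted m) ⟩
    (5 + m) * (5 + m) / 2 + (4 + m) + 2 * (7 + m)               ≡⟨ arith ((5 + m) * (5 + m) / 2) m ⟩
    ((5 + m) * (5 + m) / 2 + (12 + 2 * m)) + (6 + m)            ≡⟨ cong (λ z → (5 + m) * (5 + m) / 2 + z + (6 + m)) (m*n/n≡m (12 + 2 * m) 2) ⟨
    ((5 + m) * (5 + m) / 2 + (12 + 2 * m) * 2 / 2) + (6 + m)    ≡⟨ cong (_+ (6 + m)) (+-distrib-/-∣ʳ ((5 + m) * (5 + m)) {(12 + 2 * m) * 2} {2} (divides (12 + 2 * m) refl)) ⟨
    ((5 + m) * (5 + m) + (12 + 2 * m) * 2) / 2 + (6 + m)        ≡⟨ cong (λ z → z / 2 + (6 + m)) (square m) ⟩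
    (7 + m) * (7 + m) / 2 + (6 + m)                             ∎
    where
    open ≡-Reasoning
    arith : ∀ h m → h + (4 + m) + 2 * (7 + m) ≡ (h + (12 + 2 * m)) + (6 + m)
    arith = solve-∀
    square : ∀ m → (5 + m) * (5 + m) + (12 + 2 * m) * 2 ≡ (7 + m) * (7 + m)
    square = solve-∀

-- Conclusion for large and for small n

max≥5 : ∀ m → MaxDegree (5 + m) (maxDegree m)
max≥5 m = maxDegree-intro (λ σ dσ → degree≤ m (window σ) (window-signed {π = σ} dσ)) (proj₁ attained) (proj₁ (proj₂ attained)) (proj₂ (proj₂ attained))
  where attained = maxDegree-attained m

max-small : ∀ {n M} → BoundedBy n M → (π : W n) → InB π → T (M ≤ᵇ degree (window π)) → MaxDegree n M
max-small {M = M} bounded π inB lower = maxDegree-intro (small-bound bounded) π (InB⇒distinct π inB) (ℕ.≤ᵇ⇒≤ M _ lower)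

-- For n = 2, 3, 4 the count for two blocks gives only 3, 6 and 11. The witnesses here have
-- alternating signs and decreasing absolute values: n, -(n-1), n-2, and so on.
max₂ : MaxDegree 2 4
max₂ = max-small bounded-2 ((false , suc zero) ∷ (true , zero) ∷ []) _ _

max₃ : MaxDegree 3 8
max₃ = max-small bounded-3 ((false , suc (suc zero)) ∷ (true , suc zero) ∷ (false , zero) ∷ []) _ _

max₄ : MaxDegree 4 12
max₄ = max-small bounded-4 ((false , suc (suc (suc zero))) ∷ (true , suc (suc zero)) ∷ (false , suc zero) ∷ (true , zero) ∷ []) _ _

mainTheorem10 : ((n : ℕ) → 2 ≤ n → n ≤ 5 → MaxDegree n (4 * (n ∸ 1)))
    × ((n : ℕ) → 5 ≤ n → MaxDegree n (n * n / 2 + n ∸ 1))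
mainTheorem10 = small , large
  where
  small : (n : ℕ) → 2 ≤ n → n ≤ 5 → MaxDegree n (4 * (n ∸ 1))
  small 2 _ _ = max₂
  small 3 _ _ = max₃
  small 4 _ _ = max₄
  small 5 _ _ = max≥5 0
  small 0 () _
  small 1 (s≤s ()) _
  small (suc (suc (suc (suc (suc (suc _)))))) _ (s≤s (s≤s (s≤s (s≤s (s≤s ())))))
  large : (n : ℕ) → 5 ≤ n → MaxDegree n (n * n / 2 + n ∸ 1)
  large n 5≤n = subst (λ k → MaxDegree k (k * k / 2 + k ∸ 1)) (ℕ.m+[n∸m]≡n 5≤n)
    (subst (MaxDegree (5 + (n ∸ 5))) (maxDegree-formula (n ∸ 5)) (max≥5 (n ∸ 5)))
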